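{- Let $r\ge 3$ be a fixed integer and let $G=G(n,r)$ be a random $r$-regular graph on $n$ vertices ($rn$ even). Then, with high probability as $n\to\infty$, $$rc(G)=\begin{cases}O(\log^4 n) & r=3,\\ O(\log^{2\theta_r} n) & r\ge 4,\end{cases}\qquad\text{where }\theta_r=\frac{\log(r-1)}{\log(r-2)}.$$ That is, there is a constant $C$ depending only on $r$ such that, with probability tending to $1$, $G$ is connected and $rc(G)\le C\log^4 n$ if $r=3$, respectively $rc(G)\le C(\log n)^{2\theta_r}$ if $r\ge4$.
   Context: $G(n,r)$ is a graph chosen uniformly at random from all simple $r$-regular graphs on vertex set $[n]=\{1,\dots,n\}$. An edge-colored graph (the coloring is arbitrary, not necessarily proper) is rainbow edge connected if any two vertices are joined by a path whose edges have pairwise distinct colors. For a connected graph $G$, the rainbow connectivity $rc(G)$ is the smallest number of colors in an edge coloring of $G$ that makes $G$ rainbow edge connected. "With high probability" means with probability tending to $1$ as $n\to\infty$ (over $n$ with $rn$ even). All logarithms are natural; $\log^a n$ means $(\log n)^a$. -}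

module Defs where

import Algebra.Definitions.RawSemiring
open import Data.Fin using (Fin)
open import Data.Fin.Properties using (all?)
open import Data.Fin.Subset using (Subset; Side; inside; outside; ∣_∣; _∈_)
open import Data.Fin.Subset.Properties using (_∈?_)
open import Data.Integer using (+_)
open import Data.List using (List; []; _∷_; length; filter; cartesianProductWith)
open import Data.List.Membership.Propositional using () renaming (_∈_ to _∈ˡ_)
open import Data.List.Membership.Propositional.Properties
  using (∈-cartesianProductWith⁺; ∈-filter⁺; ∈-filter⁻)
open import Data.List.Relation.Binary.Sublist.Propositional using () renaming (_⊆_ to _⊑_)
open import Data.List.Relation.Unary.All using (All; []; _∷_)
open import Data.List.Relation.Unary.AllPairs using ([]; _∷_)
open import Data.List.Relation.Unary.Any using (here; there)
open import Data.List.Relation.Unary.Unique.Propositional using (Unique)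
open import Data.List.Relation.Unary.Unique.Propositional.Properties
  using (cartesianProductWith⁺; filter⁺)
open import Data.Nat as ℕ using (ℕ; zero; suc)
open import Data.Nat.Divisibility using (_∣_)
open import Data.Product using (_×_; _,_; proj₂; ∃-syntax)
open import Data.Rational as ℚ using (ℚ; 0ℚ; 1ℚ)
import Data.Rational.Properties as ℚ
open import Data.Vec as Vec using (Vec; lookup)
open import Data.Vec.Properties using (∷-injective)
open import Function using (_⇔_; mk⇔)
open import Relation.Binary.Construct.Closure.ReflexiveTransitive using (Star; ε; _◅_)
open import Relation.Binary.PropositionalEquality using (_≡_; refl)
open import Relation.Nullary using (¬_; yes; no)
open import Relation.Nullary.Decidable using (¬?; _×-dec_; _→-dec_)
open import Relation.Unary using (Decidable)

module ℚ^ = Algebra.Definitions.RawSemiring ℚ.+-*-rawSemiring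

-- A real number is represented by a sequence of rationals converging to
-- it.  The operations are defined on all sequences; they compute the
-- usual real functions whenever the arguments converge (to a positive
-- limit in the case of log, to a nonzero limit for a divisor).

RealSeq : Set
RealSeq = ℕ → ℚ

fromℚ : ℚ → RealSeq
fromℚ q _ = q

ℕ→ℚ : ℕ → ℚ
ℕ→ℚ n = + n ℚ./ 1

fromℕ : ℕ → RealSeq
fromℕ n = fromℚ (ℕ→ℚ n)

infixl 7 _/₀_
_/₀_ : ℚ → ℚ → ℚ
p /₀ q with q ℚ.≟ 0ℚ
... | yes _  = 0ℚ
... | no q≢0 = ℚ._÷_ p q {{ℚ.≢-nonZero q≢0}}

∑< : ℕ → (ℕ → ℚ) → ℚ
∑< zero    f = 0ℚ
∑< (suc m) f = ∑< m f ℚ.+ f m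

-- x ^ k / k !
expTerm : ℚ → ℕ → ℚ
expTerm x zero    = 1ℚ
expTerm x (suc k) = expTerm x k ℚ.* (x /₀ ℕ→ℚ (suc k))

-- t ^ (2 k + 1) / (2 k + 1)
artanhTerm : ℚ → ℕ → ℚ
artanhTerm t k = (t ℚ^.^ (2 ℕ.* k ℕ.+ 1)) /₀ ℕ→ℚ (2 ℕ.* k ℕ.+ 1)

infixl 7 _*ʳ_ _/ʳ_
infixr 8 _^ⁿ_ _^ʳ_
infix  4 _≤ʳ_

_*ʳ_ : RealSeq → RealSeq → RealSeq
(x *ʳ y) m = x m ℚ.* y m

_/ʳ_ : RealSeq → RealSeq → RealSeq
(x /ʳ y) m = x m /₀ y m

_^ⁿ_ : RealSeq → ℕ → RealSeq
(x ^ⁿ k) m = x m ℚ^.^ k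

-- Power series truncated at index m.  The partial sums converge locally
-- uniformly, so x m may vary together with the truncation index.
exp : RealSeq → RealSeq
exp x m = ∑< m (expTerm (x m))

-- Natural logarithm: log x = 2 artanh ((x - 1) / (x + 1)), where the
-- series converges for every x > 0.
log : RealSeq → RealSeq
log x m = ℕ→ℚ 2 ℚ.* ∑< m (artanhTerm ((x m ℚ.- 1ℚ) /₀ (x m ℚ.+ 1ℚ)))

_^ʳ_ : RealSeq → RealSeq → RealSeq
x ^ʳ y = exp (y *ʳ log x)

Convergent : RealSeq → Set
Convergent x = ∀ δ → 0ℚ ℚ.< δ →
  ∃[ N ] (∀ m n → N ℕ.≤ m → N ℕ.≤ n → ℚ.∣ x m ℚ.- x n ∣ ℚ.≤ δ)

-- lim x ≤ lim y.  Convergence is part of the relation, so that it never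
-- holds because of a sequence that represents no real number.
_≤ʳ_ : RealSeq → RealSeq → Set
x ≤ʳ y = Convergent x × Convergent y ×
  (∀ δ → 0ℚ ℚ.< δ → ∃[ N ] (∀ m → N ℕ.≤ m → x m ℚ.≤ y m ℚ.+ δ))

-- A graph on Fin n is given by the neighbourhood of each vertex.
Graph : ℕ → Set
Graph n = Vec (Subset n) n

module _ {n : ℕ} (G : Graph n) where

  Adj : Fin n → Fin n → Set
  Adj u v = v ∈ lookup G u

  Simple : Set
  Simple = (∀ u → ¬ Adj u u) × (∀ u v → Adj u v → Adj v u)

  Regular : ℕ → Set
  Regular r = ∀ u → ∣ lookup G u ∣ ≡ r

  Walk : Fin n → Fin n → Set
  Walk = Star Adj

  Connected : Set
  Connected = ∀ u v → Walk u v

  vertices : ∀ {u v} → Walk u v → List (Fin n)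
  vertices {u} ε       = u ∷ []
  vertices {u} (e ◅ w) = u ∷ vertices w

  IsPath : ∀ {u v} → Walk u v → Set
  IsPath w = Unique (vertices w)

  -- The two orientations of an edge receive the same color.
  record EdgeColoring (k : ℕ) : Set where
    field
      color     : ∀ {u v} → Adj u v → Fin k
      symmetric : ∀ {u v} (e : Adj u v) (e′ : Adj v u) → color e ≡ color e′

    colors : ∀ {u v} → Walk u v → List (Fin k)
    colors ε       = []
    colors (e ◅ w) = color e ∷ colors w

    RainbowEdgeConnected : Set
    RainbowEdgeConnected =
      ∀ u v → ∃[ w ] (IsPath {u} {v} w × Unique (colors w))

  RainbowColorable : ℕ → Set
  RainbowColorable k = ∃[ c ] EdgeColoring.RainbowEdgeConnected {k} c

  RainbowConnectivity : ℕ → Set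
  RainbowConnectivity k =
    RainbowColorable k × (∀ j → RainbowColorable j → k ℕ.≤ j)

allVecs : ∀ {A : Set} → List A → ∀ n → List (Vec A n)
allVecs xs zero    = Vec.[] ∷ []
allVecs xs (suc n) = cartesianProductWith Vec._∷_ xs (allVecs xs n)

sides : List Side
sides = inside ∷ outside ∷ []

allGraphs : ∀ n → List (Graph n)
allGraphs n = allVecs (allVecs sides n) n

SimpleRegular : ∀ r {n} → Graph n → Set
SimpleRegular r G = Simple G × Regular G r

simpleRegular? : ∀ r {n} → Decidable (SimpleRegular r {n})
simpleRegular? r G =
  ((all? λ u → ¬? (u ∈? lookup G u)) ×-dec
   (all? λ u → all? λ v → (v ∈? lookup G u) →-dec (u ∈? lookup G v)))
  ×-dec (all? λ u → ∣ lookup G u ∣ ℕ.≟ r)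

regularGraphs : ∀ r n → List (Graph n)
regularGraphs r n = filter (simpleRegular? r) (allGraphs n)

private
  allVecs-complete : ∀ {A : Set} {xs : List A} → (∀ x → x ∈ˡ xs) →
                     ∀ {n} (v : Vec A n) → v ∈ˡ allVecs xs n
  allVecs-complete all Vec.[]      = here refl
  allVecs-complete all (x Vec.∷ v) =
    ∈-cartesianProductWith⁺ Vec._∷_ (all x) (allVecs-complete all v)

  allVecs-unique : ∀ {A : Set} {xs : List A} → Unique xs →
                   ∀ n → Unique (allVecs xs n)
  allVecs-unique u zero    = [] ∷ []
  allVecs-unique u (suc n) =
    cartesianProductWith⁺ Vec._∷_ ∷-injective u (allVecs-unique u n)

  sides-complete : ∀ s → s ∈ˡ sides
  sides-complete inside  = here refl
  sides-complete outside = there (here refl)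

  sides-unique : Unique sides
  sides-unique = ((λ ()) ∷ []) ∷ [] ∷ []

∈-regularGraphs : ∀ r {n} (G : Graph n) →
                  (G ∈ˡ regularGraphs r n) ⇔ SimpleRegular r G
∈-regularGraphs r {n} G = mk⇔
  (λ p → proj₂ (∈-filter⁻ (simpleRegular? r) {xs = allGraphs n} p))
  (∈-filter⁺ (simpleRegular? r)
    (allVecs-complete (allVecs-complete sides-complete) G))

regularGraphs-unique : ∀ r n → Unique (regularGraphs r n)
regularGraphs-unique r n =
  filter⁺ (simpleRegular? r) (allVecs-unique (allVecs-unique sides-unique n) n)

-- P(E) ≥ p for a uniformly random element of xs.  The event E need not be
-- decidable, so a sublist of outcomes known to lie in E is exhibited.
ProbabilityAtLeast : ∀ {A : Set} → ℚ → List A → (A → Set) → Set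
ProbabilityAtLeast p xs E =
  ∃[ ys ] (ys ⊑ xs × All E ys × p ℚ.* ℕ→ℚ (length xs) ℚ.≤ ℕ→ℚ (length ys))

WithHighProbability : ℕ → (∀ n → Graph n → Set) → Set
WithHighProbability r E =
  ∀ δ → 0ℚ ℚ.< δ →
  ∃[ N ] (∀ n → N ℕ.≤ n → 2 ∣ r ℕ.* n →
    ProbabilityAtLeast (1ℚ ℚ.- δ) (regularGraphs r n) (E n))

θ : ℕ → RealSeq
θ r = log (fromℕ (r ℕ.∸ 1)) /ʳ log (fromℕ (r ℕ.∸ 2))

rcOrder : ℕ → ℕ → RealSeq
rcOrder 3 n = log (fromℕ n) ^ⁿ 4
rcOrder r n = log (fromℕ n) ^ʳ (fromℕ 2 *ʳ θ r)

-- A switching argument bounds the probability that G contains a given set of k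
-- edges by (r²/n)ᵏ, so with high probability every set of s ≤ n/M vertices
-- spans fewer than 5s/4 edges.  In such a graph balls grow by a factor 6/5
-- until they hold n/M vertices, and every component has radius O(log n): a
-- shortest path meets only M disjoint balls of radius O(log n).
--
-- If G is disconnected, replace non-tree edges uv and xy of two components by
-- ux and vy.  Given the result and ux, the edge vy lies on a short u–x walk
-- avoiding ux, so Ω(n²) switchings of each disconnected graph are undone in
-- only O(n log n) ways, and G is connected with high probability.
--
-- A connected graph of radius L in which every set with exactly one leaving
-- edge has more than n/M vertices can be rainbow coloured with O(L² + L M)
-- colours, in L stages.  A rainbow connected set D is closed under taking
-- parents in a breadth-first tree; the tree branches hanging from D get one of
-- two types such that every branch with a non-tree edge leaving it has one
-- leading to D or to a branch of the other type.  Tree edges are coloured by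
-- type and height over D, other edges get one extra colour, and the at most M
-- branches attached by a single edge get a colour each.  From the tree path
-- above such an exit one reaches D both upwards and through the exit, and two
-- vertices of the same type and comparable heights can use different routes.
--
-- The bound O(log² n) suffices because θ ≥ 1 and exp (2 log x) ≥ x²/6.

module Submission where

-- The density 5/4 sits between two constraints. The expected number of sets of s vertices spanning
-- d s edges is about (s/n)^((d-1)s), so the first moment needs d > 1; growth of balls from 3 s edge
-- ends at s vertices needs d < 3/2. The first moment works only for s ≤ n/M, so sparseness cannot
-- exclude two components of more than n/M vertices each. This is why connectedness gets a switching
-- count of its own, and why up to M branches hanging by a bridge have to be tolerated in every
-- stage of the colouring. Probabilities are ratios of lengths of duplicate-free lists of graphs,
-- with divisions cleared: a bound P ≤ a/b appears as count * b ≤ a * total. In the graph part the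
-- logarithm is only an integer ℓ with 2^ℓ ≤ n < 2^(ℓ+1). In the analytic part the estimates are
-- proved for the truncated power series at every large index. Since rc is a minimum, its value is
-- found by deciding colourability for each number of colours.

open import Defs

-- Double counting, sublists of a given length, factorials.

module Counting where

  open import Data.List using (List; []; _∷_; _++_; length; map; concatMap; filter)
  open import Data.List.Properties using (length-map; length-++)
  open import Data.List.Membership.Propositional using (_∈_; _∉_; find; lose)
  open import Data.List.Membership.Propositional.Properties
    using (∈-∃++; ∈-++⁺ˡ; ∈-++⁺ʳ; ∈-++⁻; ∈-map⁺; ∈-map⁻; ∈-concatMap⁺; ∈-concatMap⁻)
  open import Data.List.Relation.Binary.Sublist.Propositional using (_⊆_; []; _∷_; _∷ʳ_)
  open import Data.List.Relation.Unary.All as All using (All; []; _∷_)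
  open import Data.List.Relation.Unary.AllPairs using ([]; _∷_)
  open import Data.List.Relation.Unary.Any using (here; there)
  open import Data.List.Relation.Unary.Unique.Propositional using (Unique)
  import Data.List.Relation.Unary.Unique.Propositional.Properties as Unique
  open import Data.Nat
  open import Data.Nat.Properties
  open import Data.Nat.Tactic.RingSolver using (solve-∀)
  open import Data.Product using (_×_; _,_; proj₁; proj₂; ∃-syntax)
  open import Data.Sum using (inj₁; inj₂)
  open import Function using (_∘_)
  open import Relation.Binary.PropositionalEquality
  open import Relation.Nullary using (¬_; yes; no; contradiction)
  open import Relation.Nullary.Decidable using (¬?)
  open import Relation.Unary using (Decidable)

  private variable
    A B C : Set

  unique-length-≤ : {xs ys : List A} → Unique xs → (∀ {x} → x ∈ xs → x ∈ ys) →
                    length xs ≤ length ys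
  unique-length-≤ {xs = []}     _        _  = z≤n
  unique-length-≤ {xs = x ∷ xs} (x∉ ∷ u) xs⊆ with ∈-∃++ (xs⊆ (here refl))
  ... | as , bs , refl = begin
    suc (length xs)              ≤⟨ s≤s (unique-length-≤ u sub) ⟩
    suc (length (as ++ bs))      ≡⟨ cong suc (length-++ as) ⟩
    suc (length as + length bs)  ≡⟨ +-suc _ _ ⟨
    length as + suc (length bs)  ≡⟨ length-++ as ⟨
    length (as ++ x ∷ bs)        ∎
    where
    open ≤-Reasoning
    sub : ∀ {y} → y ∈ xs → y ∈ as ++ bs
    sub y∈ with ∈-++⁻ as (xs⊆ (there y∈))
    ... | inj₁ y∈as          = ∈-++⁺ˡ y∈as
    ... | inj₂ (here refl)   = contradiction refl (All.lookup x∉ y∈)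
    ... | inj₂ (there y∈bs)  = ∈-++⁺ʳ as y∈bs

  ∈-concatMap : (f : A → List B) {xs : List A} {x : A} {y : B} →
                x ∈ xs → y ∈ f x → y ∈ concatMap f xs
  ∈-concatMap f x∈ y∈ = ∈-concatMap⁺ f (lose x∈ y∈)

  concatMap-∈ : (f : A → List B) (xs : List A) {y : B} →
                y ∈ concatMap f xs → ∃[ x ] (x ∈ xs × y ∈ f x)
  concatMap-∈ f xs y∈ = find (∈-concatMap⁻ f {xs = xs} y∈)

  length-concatMap-≤ : (f : A → List B) (c : ℕ) (xs : List A) →
                       (∀ {x} → x ∈ xs → length (f x) ≤ c) →
                       length (concatMap f xs) ≤ length xs * c
  length-concatMap-≤ f c []       _ = z≤n
  length-concatMap-≤ f c (x ∷ xs) h = begin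
    length (f x ++ concatMap f xs)          ≡⟨ length-++ (f x) ⟩
    length (f x) + length (concatMap f xs)
      ≤⟨ +-mono-≤ (h (here refl)) (length-concatMap-≤ f c xs (h ∘ there)) ⟩
    c + length xs * c                       ∎
    where open ≤-Reasoning

  length-concatMap-≥ : (f : A → List B) (m c : ℕ) (xs : List A) →
                       (∀ {x} → x ∈ xs → c ≤ m * length (f x)) →
                       length xs * c ≤ m * length (concatMap f xs)
  length-concatMap-≥ f m c []       _ = z≤n
  length-concatMap-≥ f m c (x ∷ xs) h = begin
    c + length xs * c
      ≤⟨ +-mono-≤ (h (here refl)) (length-concatMap-≥ f m c xs (h ∘ there)) ⟩
    m * length (f x) + m * length (concatMap f xs)  ≡⟨ *-distribˡ-+ m (length (f x)) _ ⟨
    m * (length (f x) + length (concatMap f xs))    ≡⟨ cong (m *_) (length-++ (f x)) ⟨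
    m * length (f x ++ concatMap f xs)              ∎
    where open ≤-Reasoning

  unique-concatMap : (f : A → List B) {xs : List A} → Unique xs →
                     (∀ {x} → x ∈ xs → Unique (f x)) →
                     (∀ {x y z} → x ∈ xs → y ∈ xs → z ∈ f x → z ∈ f y → x ≡ y) →
                     Unique (concatMap f xs)
  unique-concatMap f {[]}     _        _  _   = []
  unique-concatMap f {x ∷ xs} (x∉ ∷ u) uf inj = Unique.++⁺ (uf (here refl))
    (unique-concatMap f u (uf ∘ there) (λ p q → inj (there p) (there q)))
    λ (p , q) → let (y , y∈ , z∈) = concatMap-∈ f xs q in
      All.lookup x∉ y∈ (inj (here refl) (there y∈) p z∈)

  unique-map : (φ : A → B) {xs : List A} → Unique xs →
               (∀ {x y} → x ∈ xs → y ∈ xs → φ x ≡ φ y → x ≡ y) → Unique (map φ xs)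
  unique-map φ {[]}     _        _   = []
  unique-map φ {x ∷ xs} (x∉ ∷ u) inj =
    All.tabulate (λ y∈ φx≡ → let (z , z∈ , eq) = ∈-map⁻ φ y∈ in
      All.lookup x∉ z∈ (inj (here refl) (there z∈) (trans φx≡ eq)))
    ∷ unique-map φ u (λ p q → inj (there p) (there q))

  -- Double counting for switchings: every `a` has at least c / m moves `b`, and the pairs of an
  -- outcome and a move are injected by `φ` into the labels `ws`. The factor `m` keeps the bound
  -- free of division.
  moves-bound : (f : A → List B) (φ : A → B → C) (m c : ℕ) {xs : List A} {ws : List C} →
    Unique xs →
    (∀ {a} → a ∈ xs → Unique (f a)) →
    (∀ {a} → a ∈ xs → c ≤ m * length (f a)) →
    (∀ {a b} → a ∈ xs → b ∈ f a → φ a b ∈ ws) →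
    (∀ {a b a′ b′} → a ∈ xs → b ∈ f a → a′ ∈ xs → b′ ∈ f a′ →
       φ a b ≡ φ a′ b′ → a ≡ a′ × b ≡ b′) →
    length xs * c ≤ m * length ws
  moves-bound f φ m c {xs} {ws} u uf lf ∈ws inj = ≤-trans
    (length-concatMap-≥ g m c xs (λ {a} a∈ → subst (λ k → c ≤ m * k) (sym (length-map (φ a) (f a))) (lf a∈)))
    (*-monoʳ-≤ m (unique-length-≤
      (unique-concatMap g u
        (λ a∈ → unique-map _ (uf a∈) (λ p q e → proj₂ (inj a∈ p a∈ q e)))
        λ {a} {a′} a∈ a′∈ p q → let (b , b∈ , e) = ∈-map⁻ (φ a) p
                                    (b′ , b′∈ , e′) = ∈-map⁻ (φ a′) q in
          proj₁ (inj a∈ b∈ a′∈ b′∈ (trans (sym e) e′)))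
      λ y∈ → let (a , a∈ , p) = concatMap-∈ g xs y∈
                 (b , b∈ , e) = ∈-map⁻ (φ a) p in
        subst (_∈ ws) (sym e) (∈ws a∈ b∈)))
    where
    g : _ → List _
    g a = map (φ a) (f a)

  length-filter-¬ : {P : A → Set} (P? : Decidable P) (xs : List A) →
    length (filter P? xs) + length (filter (¬? ∘ P?) xs) ≡ length xs
  length-filter-¬ P? []       = refl
  length-filter-¬ P? (x ∷ xs) with P? x
  ... | yes _ = cong suc (length-filter-¬ P? xs)
  ... | no  _ = trans (+-suc _ _) (cong suc (length-filter-¬ P? xs))

  -- On a duplicate-free list this enumerates the k-element subsets, each in the order of the list.
  combos : ℕ → List A → List (List A)
  combos zero    _        = [] ∷ []
  combos (suc k) []       = []
  combos (suc k) (x ∷ xs) = map (x ∷_) (combos k xs) ++ combos (suc k) xs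

  ⊆⇒∈-combos : {xs ys : List A} → xs ⊆ ys → xs ∈ combos (length xs) ys
  ⊆⇒∈-combos                    []         = here refl
  ⊆⇒∈-combos {xs = []}          (y ∷ʳ p)   = here refl
  ⊆⇒∈-combos {xs = _ ∷ xs} {y ∷ ys} (.y ∷ʳ p) =
    ∈-++⁺ʳ (map (y ∷_) (combos (length xs) ys)) (⊆⇒∈-combos p)
  ⊆⇒∈-combos                    (refl ∷ p) = ∈-++⁺ˡ (∈-map⁺ _ (⊆⇒∈-combos p))

  []⊆_ : (ys : List A) → [] ⊆ ys
  []⊆ []       = []
  []⊆ (y ∷ ys) = y ∷ʳ ([]⊆ ys)

  ∈-combos⇒⊆ : ∀ k {xs : List A} (ys : List A) → xs ∈ combos k ys → xs ⊆ ys × length xs ≡ k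
  ∈-combos⇒⊆ zero    ys (here refl) = []⊆ ys , refl
  ∈-combos⇒⊆ (suc k) (y ∷ ys) p with ∈-++⁻ (map (y ∷_) (combos k ys)) p
  ... | inj₁ q with ∈-map⁻ (y ∷_) q
  ...   | zs , zs∈ , refl = let (s , e) = ∈-combos⇒⊆ k ys zs∈ in refl ∷ s , cong suc e
  ∈-combos⇒⊆ (suc k) (y ∷ ys) p | inj₂ q =
    let (s , e) = ∈-combos⇒⊆ (suc k) ys q in y ∷ʳ s , e

  -- The two leading terms of the binomial expansion of the right side.
  pow-suc-≥ : ∀ m k → m ^ suc k + suc k * m ^ k ≤ suc m ^ suc k
  pow-suc-≥ m zero    = ≤-reflexive (h m)
    where
    h : ∀ m → m * 1 + 1 * 1 ≡ suc m * 1
    h = solve-∀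
  pow-suc-≥ m (suc k) = begin
    m * (m * p) + suc (suc k) * (m * p)  ≡⟨ h₁ m k p ⟩
    m * (m * p + suc k * p) + m * p      ≤⟨ +-monoʳ-≤ _ (≤-trans (m≤m+n (m * p) (suc k * p)) ≤-refl) ⟩
    m * (m * p + suc k * p) + (m * p + suc k * p)
      ≡⟨ h₂ m (m * p + suc k * p) ⟩
    suc m * (m * p + suc k * p)          ≤⟨ *-monoʳ-≤ (suc m) (pow-suc-≥ m k) ⟩
    suc m * suc m ^ suc k                ∎
    where
    open ≤-Reasoning
    p = m ^ k
    h₁ : ∀ m k p → m * (m * p) + suc (suc k) * (m * p) ≡ m * (m * p + suc k * p) + m * p
    h₁ = solve-∀
    h₂ : ∀ m x → m * x + x ≡ suc m * x
    h₂ = solve-∀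

  -- Pascal's rule reduces the induction step to m^(k+1) + (k+1) m^k ≤ (m+1)^(k+1), which is
  -- `pow-suc-≥`.
  combos-bound : ∀ k (xs : List A) → length (combos k xs) * k ! ≤ length xs ^ k
  combos-bound zero    xs       = ≤-refl
  combos-bound (suc k) []       = z≤n
  combos-bound (suc k) (x ∷ xs) = begin
    length (map (x ∷_) (combos k xs) ++ combos (suc k) xs) * (suc k * k !)
      ≡⟨ cong (_* (suc k * k !)) (trans (length-++ (map (x ∷_) (combos k xs)))
           (cong (_+ length (combos (suc k) xs)) (length-map (x ∷_) (combos k xs)))) ⟩
    (length (combos k xs) + length (combos (suc k) xs)) * (suc k * k !)
      ≡⟨ h (length (combos k xs)) (length (combos (suc k) xs)) (suc k) (k !) ⟩
    length (combos (suc k) xs) * (suc k) ! + suc k * (length (combos k xs) * k !)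
      ≤⟨ +-mono-≤ (combos-bound (suc k) xs) (*-monoʳ-≤ (suc k) (combos-bound k xs)) ⟩
    length xs ^ suc k + suc k * length xs ^ k
      ≤⟨ pow-suc-≥ (length xs) k ⟩
    suc (length xs) ^ suc k ∎
    where
    open ≤-Reasoning
    h : ∀ a b s f → (a + b) * (s * f) ≡ b * (s * f) + s * (a * f)
    h = solve-∀

  -- The central binomial coefficient is at most 4^s: each step multiplies the left side by
  -- (2s+2)(2s+1) and the right side by (2s+2)².
  [2s]!≤4^s*s!² : ∀ s → (s + s) ! ≤ 4 ^ s * (s ! * s !)
  [2s]!≤4^s*s!² zero    = ≤-refl
  [2s]!≤4^s*s!² (suc s) = begin
    (suc s + suc s) !                    ≡⟨ cong (_!) (cong suc (+-suc s s)) ⟩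
    (2 + (s + s)) * ((1 + (s + s)) * (s + s) !)
      ≤⟨ *-monoʳ-≤ (2 + (s + s)) (*-mono-≤ (n≤1+n (1 + (s + s))) ([2s]!≤4^s*s!² s)) ⟩
    (2 + (s + s)) * ((2 + (s + s)) * (4 ^ s * (s ! * s !)))
      ≡⟨ h s (4 ^ s) (s !) ⟩
    4 ^ suc s * (suc s ! * suc s !)      ∎
    where
    open ≤-Reasoning
    h : ∀ s p f → (2 + (s + s)) * ((2 + (s + s)) * (p * (f * f)))
                  ≡ 4 * p * ((suc s * f) * (suc s * f))
    h = solve-∀

  s^k*s!≤[k+s]! : ∀ s k → s ^ k * s ! ≤ (k + s) !
  s^k*s!≤[k+s]! s zero    = ≤-reflexive (*-identityˡ _)
  s^k*s!≤[k+s]! s (suc k) = begin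
    s * s ^ k * s !            ≡⟨ *-assoc s (s ^ k) (s !) ⟩
    s * (s ^ k * s !)          ≤⟨ *-mono-≤ (m≤n⇒m≤1+n (m≤n+m s k)) (s^k*s!≤[k+s]! s k) ⟩
    suc (k + s) * (k + s) !    ∎
    where open ≤-Reasoning

  -- Stands in for Stirling's formula, with 4 in place of e: s^s s! ≤ (2s)! ≤ 4^s s!².
  s^s≤4^s*s! : ∀ s → s ^ s ≤ 4 ^ s * s !
  s^s≤4^s*s! s = *-cancelʳ-≤ (s ^ s) (4 ^ s * s !) (s !) {{s !≢0}} (begin
    s ^ s * s !             ≤⟨ s^k*s!≤[k+s]! s s ⟩
    (s + s) !               ≤⟨ [2s]!≤4^s*s!² s ⟩
    4 ^ s * (s ! * s !)     ≡⟨ *-assoc (4 ^ s) (s !) (s !) ⟨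
    4 ^ s * s ! * s !       ∎)
    where
    open ≤-Reasoning

-- Switchings of two edges and their inverses.

module Switching where

  open Counting
  open import Data.Fin using (Fin; zero; suc; _≟_)
  open import Data.Fin.Subset using (Subset; inside; outside; ∣_∣) renaming (_∈_ to _∈ˢ_; _∉_ to _∉ˢ_)
  open import Data.List using (List; []; _∷_; map; length)
  open import Data.List.Properties using (length-map)
  open import Data.List.Membership.Propositional using (_∈_; _∉_)
  open import Data.List.Membership.Propositional.Properties using (∈-map⁺; ∈-map⁻)
  import Data.List.Relation.Unary.All as All
  open import Data.List.Relation.Unary.Any using (here; there)
  open import Data.List.Relation.Unary.AllPairs using ([]; _∷_)
  open import Data.List.Relation.Unary.Unique.Propositional using (Unique)
  import Data.List.Relation.Unary.Unique.Propositional.Properties as Unique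
  open import Data.Nat using (ℕ; zero; suc)
  open import Data.Product using (_×_; _,_; proj₁; proj₂)
  open import Data.Sum using (_⊎_; inj₁; inj₂; [_,_]′)
  open import Data.Vec using (_∷_; []; lookup; tabulate; _[_]≔_; here; there)
  open import Data.Vec.Properties
  open import Function using (_∘_; Equivalence)
  open import Relation.Binary.PropositionalEquality
  open import Relation.Nullary using (¬_; yes; no; Dec; contradiction)
  open import Relation.Nullary.Decidable using (_×-dec_; _⊎-dec_)

  elems : ∀ {n} → Subset n → List (Fin n)
  elems []            = []
  elems (inside ∷ S)  = zero ∷ map suc (elems S)
  elems (outside ∷ S) = map suc (elems S)

  length-elems : ∀ {n} (S : Subset n) → length (elems S) ≡ ∣ S ∣
  length-elems []            = refl
  length-elems (inside ∷ S)  = cong suc (trans (length-map suc (elems S)) (length-elems S))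
  length-elems (outside ∷ S) = trans (length-map suc (elems S)) (length-elems S)

  ∈-elems⁺ : ∀ {n} {S : Subset n} {x} → x ∈ˢ S → x ∈ elems S
  ∈-elems⁺ {S = inside ∷ S}  here      = here refl
  ∈-elems⁺ {S = inside ∷ S}  (there p) = there (∈-map⁺ suc (∈-elems⁺ p))
  ∈-elems⁺ {S = outside ∷ S} (there p) = ∈-map⁺ suc (∈-elems⁺ p)

  ∈-elems⁻ : ∀ {n} (S : Subset n) {x} → x ∈ elems S → x ∈ˢ S
  ∈-elems⁻ (inside ∷ S) (here refl) = here
  ∈-elems⁻ (inside ∷ S) (there p) with ∈-map⁻ suc p
  ... | _ , q , refl = there (∈-elems⁻ S q)
  ∈-elems⁻ (outside ∷ S) p with ∈-map⁻ suc p
  ... | _ , q , refl = there (∈-elems⁻ S q)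

  unique-elems : ∀ {n} (S : Subset n) → Unique (elems S)
  unique-elems []            = []
  unique-elems (inside ∷ S)  =
    All.tabulate (λ p → λ { refl → zero∉ p })
    ∷ Unique.map⁺ (λ { refl → refl }) (unique-elems S)
    where
    zero∉ : zero ∉ map suc (elems S)
    zero∉ p with ∈-map⁻ suc p
    ... | _ , _ , ()
  unique-elems (outside ∷ S) = Unique.map⁺ (λ { refl → refl }) (unique-elems S)

  swapRow : ∀ {n} → Subset n → Fin n → Fin n → Subset n
  swapRow S p q = (S [ p ]≔ outside) [ q ]≔ inside

  private
    ∣∣-outside : ∀ {n} {S : Subset n} {p} → p ∈ˢ S → suc ∣ S [ p ]≔ outside ∣ ≡ ∣ S ∣
    ∣∣-outside here                              = refl
    ∣∣-outside {S = inside ∷ S}  (there p) = cong suc (∣∣-outside p)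
    ∣∣-outside {S = outside ∷ S} (there p) = ∣∣-outside p

    ∣∣-inside : ∀ {n} {S : Subset n} (p : Fin n) → p ∉ˢ S → ∣ S [ p ]≔ inside ∣ ≡ suc ∣ S ∣
    ∣∣-inside {S = inside ∷ S}  zero    p∉ = contradiction here p∉
    ∣∣-inside {S = outside ∷ S} zero    p∉ = refl
    ∣∣-inside {S = inside ∷ S}  (suc p) p∉ = cong suc (∣∣-inside p (p∉ ∘ there))
    ∣∣-inside {S = outside ∷ S} (suc p) p∉ = ∣∣-inside p (p∉ ∘ there)

    ∈-≔⁻ : ∀ {n} (S : Subset n) p {s x} → x ≢ p → x ∈ˢ S [ p ]≔ s → x ∈ˢ S
    ∈-≔⁻ S p {s} {x} x≢p x∈ = lookup⇒[]= x S
      (trans (sym (lookup∘updateAt′ x p x≢p S)) ([]=⇒lookup x∈))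

    ∈-≔⁺ : ∀ {n} (S : Subset n) p {s x} → x ≢ p → x ∈ˢ S → x ∈ˢ S [ p ]≔ s
    ∈-≔⁺ S p {s} {x} x≢p x∈ = lookup⇒[]= x (S [ p ]≔ s)
      (trans (lookup∘updateAt′ x p x≢p S) ([]=⇒lookup x∈))

    ∉-outside : ∀ {n} (S : Subset n) p → p ∉ˢ S [ p ]≔ outside
    ∉-outside S p p∈ with trans (sym ([]=⇒lookup p∈)) (lookup∘update p S outside)
    ... | ()

    ∈⇒≢ : ∀ {n} {S : Subset n} {p q} → p ∈ˢ S → q ∉ˢ S → p ≢ q
    ∈⇒≢ p∈ q∉ refl = q∉ p∈

  module _ {n} (S : Subset n) {p q : Fin n} (p∈ : p ∈ˢ S) (q∉ : q ∉ˢ S) where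

    ∣swapRow∣ : ∣ swapRow S p q ∣ ≡ ∣ S ∣
    ∣swapRow∣ = trans
      (∣∣-inside q (q∉ ∘ ∈-≔⁻ S p (∈⇒≢ p∈ q∉ ∘ sym)))
      (∣∣-outside p∈)

    swapRow-inverse : swapRow (swapRow S p q) q p ≡ S
    swapRow-inverse = begin
      (((S [ p ]≔ outside) [ q ]≔ inside) [ q ]≔ outside) [ p ]≔ inside
        ≡⟨ cong (_[ p ]≔ inside) ([]≔-idempotent (S [ p ]≔ outside) q) ⟩
      ((S [ p ]≔ outside) [ q ]≔ outside) [ p ]≔ inside
        ≡⟨ []≔-commutes (S [ p ]≔ outside) q p (∈⇒≢ p∈ q∉ ∘ sym) ⟩
      ((S [ p ]≔ outside) [ p ]≔ inside) [ q ]≔ outside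
        ≡⟨ cong (_[ q ]≔ outside) ([]≔-idempotent S p) ⟩
      (S [ p ]≔ inside) [ q ]≔ outside
        ≡⟨ cong (λ s → (S [ p ]≔ s) [ q ]≔ outside) ([]=⇒lookup p∈) ⟨
      (S [ p ]≔ lookup S p) [ q ]≔ outside
        ≡⟨ cong (_[ q ]≔ outside) ([]≔-lookup S p) ⟩
      S [ q ]≔ outside
        ≡⟨ cong (S [ q ]≔_) lookup-q ⟨
      S [ q ]≔ lookup S q
        ≡⟨ []≔-lookup S q ⟩
      S ∎
      where
      open ≡-Reasoning
      lookup-q : lookup S q ≡ outside
      lookup-q with lookup S q in eq
      ... | outside = refl
      ... | inside  = contradiction (lookup⇒[]= q S eq) q∉

  ∈-swapRow⁻ : ∀ {n} (S : Subset n) p q {x} → x ∈ˢ swapRow S p q → x ≡ q ⊎ (x ∈ˢ S × x ≢ p)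
  ∈-swapRow⁻ S p q {x} x∈ with x ≟ q
  ... | yes x≡q = inj₁ x≡q
  ... | no  x≢q = inj₂ (∈-≔⁻ S p x≢p x∈′ , x≢p)
    where
    x∈′ : x ∈ˢ S [ p ]≔ outside
    x∈′ = ∈-≔⁻ (S [ p ]≔ outside) q x≢q x∈
    x≢p : x ≢ p
    x≢p refl = ∉-outside S p x∈′

  ∈-swapRow-new : ∀ {n} (S : Subset n) p q → q ∈ˢ swapRow S p q
  ∈-swapRow-new S p q = lookup⇒[]= q (swapRow S p q) (lookup∘update q (S [ p ]≔ outside) inside)

  ∈-swapRow-old : ∀ {n} (S : Subset n) p q {x} → x ∈ˢ S → x ≢ p → x ∈ˢ swapRow S p q
  ∈-swapRow-old S p q {x} x∈ x≢p with x ≟ q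
  ... | yes refl = ∈-swapRow-new S p q
  ... | no  x≢q  = ∈-≔⁺ (S [ p ]≔ outside) q x≢q (∈-≔⁺ S p x≢p x∈)

  -- Replaces the edges uv and xy by ux and vy.
  switchRow : ∀ {n} → Graph n → (u v x y : Fin n) → Fin n → Subset n
  switchRow G u v x y a with a ≟ u | a ≟ v | a ≟ x | a ≟ y
  ... | yes _ | _     | _     | _     = swapRow (lookup G a) v x
  ... | no _  | yes _ | _     | _     = swapRow (lookup G a) u y
  ... | no _  | no _  | yes _ | _     = swapRow (lookup G a) y u
  ... | no _  | no _  | no _  | yes _ = swapRow (lookup G a) x v
  ... | no _  | no _  | no _  | no _  = lookup G a

  switch : ∀ {n} → Graph n → (u v x y : Fin n) → Graph n
  switch G u v x y = tabulate (switchRow G u v x y)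

  -- Equality of unordered pairs.
  Pair : ∀ {n} → (p q a b : Fin n) → Set
  Pair p q a b = (a ≡ p × b ≡ q) ⊎ (a ≡ q × b ≡ p)

  Pair-sym : ∀ {n} {p q a b : Fin n} → Pair p q a b → Pair p q b a
  Pair-sym (inj₁ (e , f)) = inj₂ (f , e)
  Pair-sym (inj₂ (e , f)) = inj₁ (f , e)

  Pair? : ∀ {n} (p q a b : Fin n) → Dec (Pair p q a b)
  Pair? p q a b = ((a ≟ p) ×-dec (b ≟ q)) ⊎-dec ((a ≟ q) ×-dec (b ≟ p))

  -- Together with loop-freeness, which separates u from v and x from y, these conditions make the
  -- four vertices distinct and the edges ux and vy new.
  record Switchable {n} (G : Graph n) (u v x y : Fin n) : Set where
    field
      uv : Adj G u v
      xy : Adj G x y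
      u≢x : u ≢ x
      v≢x : v ≢ x
      u≢y : u ≢ y
      v≢y : v ≢ y
      ¬ux : ¬ Adj G u x
      ¬vy : ¬ Adj G v y

  module _ {n} {G : Graph n} (simple : Simple G) {u v x y : Fin n}
           (s : Switchable G u v x y) where

    open Switchable s

    private
      G′ = switch G u v x y

      u≢v : u ≢ v
      u≢v refl = proj₁ simple u uv

      x≢y : x ≢ y
      x≢y refl = proj₁ simple x xy

      symG : ∀ {a b} → Adj G a b → Adj G b a
      symG = proj₂ simple _ _

    private
      row : ∀ a → lookup G′ a ≡ switchRow G u v x y a
      row = lookup∘tabulate _

    row-u : lookup G′ u ≡ swapRow (lookup G u) v x
    row-u rewrite row u with u ≟ u
    ... | yes _ = refl
    ... | no ne = contradiction refl ne

    row-v : lookup G′ v ≡ swapRow (lookup G v) u y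
    row-v rewrite row v with v ≟ u | v ≟ v
    ... | yes e | _     = contradiction (sym e) u≢v
    ... | no _  | yes _ = refl
    ... | no _  | no ne = contradiction refl ne

    row-x : lookup G′ x ≡ swapRow (lookup G x) y u
    row-x rewrite row x with x ≟ u | x ≟ v | x ≟ x
    ... | yes e | _     | _     = contradiction (sym e) u≢x
    ... | no _  | yes e | _     = contradiction (sym e) v≢x
    ... | no _  | no _  | yes _ = refl
    ... | no _  | no _  | no ne = contradiction refl ne

    row-y : lookup G′ y ≡ swapRow (lookup G y) x v
    row-y rewrite row y with y ≟ u | y ≟ v | y ≟ x | y ≟ y
    ... | yes e | _     | _     | _     = contradiction (sym e) u≢y
    ... | no _  | yes e | _     | _     = contradiction (sym e) v≢y
    ... | no _  | no _  | yes e | _     = contradiction (sym e) x≢y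
    ... | no _  | no _  | no _  | yes _ = refl
    ... | no _  | no _  | no _  | no ne = contradiction refl ne

    row-other : ∀ {a} → a ≢ u → a ≢ v → a ≢ x → a ≢ y → lookup G′ a ≡ lookup G a
    row-other {a} a≢u a≢v a≢x a≢y rewrite row a with a ≟ u | a ≟ v | a ≟ x | a ≟ y
    ... | yes e | _     | _     | _     = contradiction e a≢u
    ... | no _  | yes e | _     | _     = contradiction e a≢v
    ... | no _  | no _  | yes e | _     = contradiction e a≢x
    ... | no _  | no _  | no _  | yes e = contradiction e a≢y
    ... | no _  | no _  | no _  | no _  = refl

    -- With its converses below, this replaces the inspection of rows wherever only adjacency in the
    -- switched graph matters.
    Adj-switch⁻ : ∀ {a b} → Adj G′ a b →
      Pair u x a b ⊎ Pair v y a b ⊎ (Adj G a b × ¬ Pair u v a b × ¬ Pair x y a b)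
    Adj-switch⁻ {a} {b} e with a ≟ u | a ≟ v | a ≟ x | a ≟ y
    ... | yes refl | _ | _ | _ = Data.Sum.map (λ { refl → inj₁ (refl , refl) })
      (λ { (b∈ , b≢) → inj₂ (b∈ ,
        [ b≢ ∘ proj₂ , u≢v ∘ proj₁ ]′ , [ u≢x ∘ proj₁ , u≢y ∘ proj₁ ]′) })
      (∈-swapRow⁻ (lookup G u) v x (subst (b ∈ˢ_) row-u e))
    ... | no _ | yes refl | _ | _ = [ (λ { refl → inj₂ (inj₁ (inj₁ (refl , refl))) }) ,
      (λ { (b∈ , b≢) → inj₂ (inj₂ (b∈ ,
        [ u≢v ∘ sym ∘ proj₁ , b≢ ∘ proj₂ ]′ , [ v≢x ∘ proj₁ , v≢y ∘ proj₁ ]′)) }) ]′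
      (∈-swapRow⁻ (lookup G v) u y (subst (b ∈ˢ_) row-v e))
    ... | no _ | no _ | yes refl | _ = Data.Sum.map (λ { refl → inj₂ (refl , refl) })
      (λ { (b∈ , b≢) → inj₂ (b∈ ,
        [ u≢x ∘ sym ∘ proj₁ , v≢x ∘ sym ∘ proj₁ ]′ , [ b≢ ∘ proj₂ , x≢y ∘ proj₁ ]′) })
      (∈-swapRow⁻ (lookup G x) y u (subst (b ∈ˢ_) row-x e))
    ... | no _ | no _ | no _ | yes refl = [ (λ { refl → inj₂ (inj₁ (inj₂ (refl , refl))) }) ,
      (λ { (b∈ , b≢) → inj₂ (inj₂ (b∈ ,
        [ u≢y ∘ sym ∘ proj₁ , v≢y ∘ sym ∘ proj₁ ]′ , [ x≢y ∘ sym ∘ proj₁ , b≢ ∘ proj₂ ]′)) }) ]′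
      (∈-swapRow⁻ (lookup G y) x v (subst (b ∈ˢ_) row-y e))
    ... | no a≢u | no a≢v | no a≢x | no a≢y =
      inj₂ (inj₂ (subst (b ∈ˢ_) (row-other a≢u a≢v a≢x a≢y) e ,
        [ a≢u ∘ proj₁ , a≢v ∘ proj₁ ]′ , [ a≢x ∘ proj₁ , a≢y ∘ proj₁ ]′))

    Adj-switch-old : ∀ {a b} → Adj G a b → ¬ Pair u v a b → ¬ Pair x y a b → Adj G′ a b
    Adj-switch-old {a} {b} e ¬uv ¬xy with a ≟ u | a ≟ v | a ≟ x | a ≟ y
    ... | yes refl | _ | _ | _ = subst (b ∈ˢ_) (sym row-u)
      (∈-swapRow-old _ _ _ e (λ { refl → ¬uv (inj₁ (refl , refl)) }))
    ... | no _ | yes refl | _ | _ = subst (b ∈ˢ_) (sym row-v)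
      (∈-swapRow-old _ _ _ e (λ { refl → ¬uv (inj₂ (refl , refl)) }))
    ... | no _ | no _ | yes refl | _ = subst (b ∈ˢ_) (sym row-x)
      (∈-swapRow-old _ _ _ e (λ { refl → ¬xy (inj₁ (refl , refl)) }))
    ... | no _ | no _ | no _ | yes refl = subst (b ∈ˢ_) (sym row-y)
      (∈-swapRow-old _ _ _ e (λ { refl → ¬xy (inj₂ (refl , refl)) }))
    ... | no a≢u | no a≢v | no a≢x | no a≢y =
      subst (b ∈ˢ_) (sym (row-other a≢u a≢v a≢x a≢y)) e

    Adj-switch-ux : ∀ {a b} → Pair u x a b → Adj G′ a b
    Adj-switch-ux (inj₁ (refl , refl)) = subst (x ∈ˢ_) (sym row-u) (∈-swapRow-new _ _ _)
    Adj-switch-ux (inj₂ (refl , refl)) = subst (u ∈ˢ_) (sym row-x) (∈-swapRow-new _ _ _)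

    Adj-switch-vy : ∀ {a b} → Pair v y a b → Adj G′ a b
    Adj-switch-vy (inj₁ (refl , refl)) = subst (y ∈ˢ_) (sym row-v) (∈-swapRow-new _ _ _)
    Adj-switch-vy (inj₂ (refl , refl)) = subst (v ∈ˢ_) (sym row-y) (∈-swapRow-new _ _ _)

    switch-simple : Simple G′
    switch-simple = irr , λ a b → sym′
      where
      irr : ∀ a → ¬ Adj G′ a a
      irr a e with Adj-switch⁻ e
      ... | inj₁ (inj₁ (refl , eq)) = u≢x eq
      ... | inj₁ (inj₂ (refl , eq)) = u≢x (sym eq)
      ... | inj₂ (inj₁ (inj₁ (refl , eq))) = v≢y eq
      ... | inj₂ (inj₁ (inj₂ (refl , eq))) = v≢y (sym eq)
      ... | inj₂ (inj₂ (e′ , _)) = proj₁ simple a e′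
      sym′ : ∀ {a b} → Adj G′ a b → Adj G′ b a
      sym′ e with Adj-switch⁻ e
      ... | inj₁ p = Adj-switch-ux (Pair-sym p)
      ... | inj₂ (inj₁ p) = Adj-switch-vy (Pair-sym p)
      ... | inj₂ (inj₂ (e′ , ¬p , ¬q)) =
        Adj-switch-old (symG e′) (¬p ∘ Pair-sym) (¬q ∘ Pair-sym)

    switch-regular : ∀ {r} → Regular G r → Regular G′ r
    switch-regular reg a = trans same (reg a)
      where
      same : ∣ lookup G′ a ∣ ≡ ∣ lookup G a ∣
      same with a ≟ u | a ≟ v | a ≟ x | a ≟ y
      ... | yes refl | _ | _ | _ = trans (cong ∣_∣ row-u) (∣swapRow∣ _ uv ¬ux)
      ... | no _ | yes refl | _ | _ = trans (cong ∣_∣ row-v) (∣swapRow∣ _ (symG uv) ¬vy)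
      ... | no _ | no _ | yes refl | _ = trans (cong ∣_∣ row-x) (∣swapRow∣ _ xy (¬ux ∘ symG))
      ... | no _ | no _ | no _ | yes refl =
        trans (cong ∣_∣ row-y) (∣swapRow∣ _ (symG xy) (¬vy ∘ symG))
      ... | no a≢u | no a≢v | no a≢x | no a≢y = cong ∣_∣ (row-other a≢u a≢v a≢x a≢y)

    -- The reverse switching has the same form with v and x exchanged: it replaces ux and vy by uv
    -- and xy.
    switch-switchable : Switchable G′ u x v y
    switch-switchable = record
      { uv = Adj-switch-ux (inj₁ (refl , refl)) ; xy = Adj-switch-vy (inj₁ (refl , refl))
      ; u≢x = u≢v ; v≢x = v≢x ∘ sym ; u≢y = u≢y ; v≢y = x≢y
      ; ¬ux = λ e → removed (inj₁ (inj₁ (refl , refl))) (Adj-switch⁻ e)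
      ; ¬vy = λ e → removed (inj₂ (inj₁ (refl , refl))) (Adj-switch⁻ e) }
      where
      removed : ∀ {a b} → Pair u v a b ⊎ Pair x y a b →
        ¬ (Pair u x a b ⊎ Pair v y a b ⊎ (Adj G a b × ¬ Pair u v a b × ¬ Pair x y a b))
      removed p (inj₂ (inj₂ (_ , ¬p , ¬q))) = [ ¬p , ¬q ]′ p
      removed (inj₁ (inj₁ (refl , refl))) (inj₁ (inj₁ (_ , e))) = v≢x e
      removed (inj₁ (inj₁ (refl , refl))) (inj₁ (inj₂ (e , _))) = u≢x e
      removed (inj₁ (inj₁ (refl , refl))) (inj₂ (inj₁ (inj₁ (e , _)))) = u≢v e
      removed (inj₁ (inj₁ (refl , refl))) (inj₂ (inj₁ (inj₂ (e , _)))) = u≢y e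
      removed (inj₁ (inj₂ (refl , refl))) (inj₁ (inj₁ (e , _))) = u≢v (sym e)
      removed (inj₁ (inj₂ (refl , refl))) (inj₁ (inj₂ (e , _))) = v≢x e
      removed (inj₁ (inj₂ (refl , refl))) (inj₂ (inj₁ (inj₁ (_ , e)))) = u≢y e
      removed (inj₁ (inj₂ (refl , refl))) (inj₂ (inj₁ (inj₂ (e , _)))) = v≢y e
      removed (inj₂ (inj₁ (refl , refl))) (inj₁ (inj₁ (e , _))) = u≢x (sym e)
      removed (inj₂ (inj₁ (refl , refl))) (inj₁ (inj₂ (_ , e))) = u≢y (sym e)
      removed (inj₂ (inj₁ (refl , refl))) (inj₂ (inj₁ (inj₁ (e , _)))) = v≢x (sym e)
      removed (inj₂ (inj₁ (refl , refl))) (inj₂ (inj₁ (inj₂ (e , _)))) = x≢y e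
      removed (inj₂ (inj₂ (refl , refl))) (inj₁ (inj₁ (e , _))) = u≢y (sym e)
      removed (inj₂ (inj₂ (refl , refl))) (inj₁ (inj₂ (e , _))) = x≢y (sym e)
      removed (inj₂ (inj₂ (refl , refl))) (inj₂ (inj₁ (inj₁ (e , _)))) = v≢y (sym e)
      removed (inj₂ (inj₂ (refl , refl))) (inj₂ (inj₁ (inj₂ (_ , e)))) = v≢x (sym e)

  module _ {n} {G : Graph n} (simple : Simple G) {u v x y : Fin n}
           (s : Switchable G u v x y) where

    open Switchable s

    private
      G′ = switch G u v x y
      simple′ = switch-simple simple s
      s′ = switch-switchable simple s
      symG : ∀ {a b} → Adj G a b → Adj G b a
      symG = proj₂ simple _ _

    -- Makes switchings injective: the switched graph and the four vertices determine the old graph.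
    -- Because v and x change roles, row v is restored by the lemma on row x, and conversely.
    switch-inverse : switch G′ u x v y ≡ G
    switch-inverse = lookup-ext λ a → rows a
      where
      lookup-ext : ∀ {A : Set} {n} {xs ys : Data.Vec.Vec A n} →
                   (∀ i → lookup xs i ≡ lookup ys i) → xs ≡ ys
      lookup-ext {xs = xs} {ys} h =
        trans (sym (tabulate∘lookup xs)) (trans (tabulate-cong h) (tabulate∘lookup ys))
      rows : ∀ a → lookup (switch G′ u x v y) a ≡ lookup G a
      rows a with a ≟ u | a ≟ v | a ≟ x | a ≟ y
      ... | yes refl | _ | _ | _ = trans (row-u simple′ s′)
        (trans (cong (λ R → swapRow R x v) (row-u simple s)) (swapRow-inverse _ uv ¬ux))
      ... | no _ | yes refl | _ | _ = trans (row-x simple′ s′)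
        (trans (cong (λ R → swapRow R y u) (row-v simple s)) (swapRow-inverse _ (symG uv) ¬vy))
      ... | no _ | no _ | yes refl | _ = trans (row-v simple′ s′)
        (trans (cong (λ R → swapRow R u y) (row-x simple s)) (swapRow-inverse _ xy (¬ux ∘ symG)))
      ... | no _ | no _ | no _ | yes refl = trans (row-y simple′ s′)
        (trans (cong (λ R → swapRow R v x) (row-y simple s))
          (swapRow-inverse _ (symG xy) (¬vy ∘ symG)))
      ... | no a≢u | no a≢v | no a≢x | no a≢y =
        trans (row-other simple′ s′ a≢u a≢x a≢v a≢y) (row-other simple s a≢u a≢v a≢x a≢y)

  module _ {r n : ℕ} {G : Graph n} where

    ∈-regular⁻ : G ∈ regularGraphs r n → Simple G × Regular G r
    ∈-regular⁻ = Equivalence.to (∈-regularGraphs r G)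

    switch-∈ : G ∈ regularGraphs r n → ∀ {u v x y} → Switchable G u v x y →
               switch G u v x y ∈ regularGraphs r n
    switch-∈ G∈ s = let (simple , regular) = ∈-regular⁻ G∈ in
      Equivalence.from (∈-regularGraphs r _)
        (switch-simple simple s , switch-regular simple s regular)

  nbrs : ∀ {n} → Graph n → Fin n → List (Fin n)
  nbrs G u = elems (lookup G u)

  length-nbrs : ∀ {r n} {G : Graph n} → Regular G r → ∀ u → length (nbrs G u) ≡ r
  length-nbrs {G = G} reg u = trans (length-elems (lookup G u)) (reg u)

-- The probability of containing given edges.

module FirstMoment where

  open Counting
  open Switching
  open import Data.Fin using (Fin; _≟_)
  open import Data.Fin.Subset.Properties using (_∈?_)
  open import Data.List using (List; []; _∷_; _++_; map; length; filter; concatMap; allFin; take)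
  open import Data.List.Properties using (length-map; length-++; length-tabulate; length-take)
  open import Data.List.Membership.Propositional using (_∈_; _∉_; find)
  open import Data.List.Membership.Propositional.Properties
  open import Data.List.Membership.DecPropositional using () renaming (_∈?_ to member?)
  import Data.List.Relation.Binary.Sublist.Propositional.Properties as Sub
  open import Data.List.Relation.Binary.Sublist.Propositional using (_⊆_; []; _∷_; _∷ʳ_; ⊆-trans)
    renaming (lookup to ⊆-lookup)
  open import Data.List.Relation.Unary.All as All using (All; []; _∷_)
  import Data.List.Relation.Unary.All.Properties as All
  open import Data.List.Relation.Unary.Any using (Any; here; there; any?)
  open import Data.List.Relation.Unary.AllPairs as AllPairs using (AllPairs; []; _∷_)
  import Data.List.Relation.Unary.AllPairs.Properties as AllPairs
  open import Data.List.Relation.Unary.Unique.Propositional using (Unique)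
  import Data.List.Relation.Unary.Unique.Propositional.Properties as Unique
  open import Data.Nat hiding (_≟_)
  open import Data.Nat.DivMod using (_/_; _%_; m≡m%n+[m/n]*n; m%n<n; m/n*n≤m)
  open import Data.Nat.Properties hiding (_≟_)
  open import Data.Nat.Tactic.RingSolver using (solve-∀)
  open import Data.Product using (_×_; _,_; proj₁; proj₂; swap)
  open import Data.Sum using (_⊎_; inj₁; inj₂; [_,_]′)
  open import Data.Vec using (lookup)
  open import Function using (_∘_)
  open import Relation.Binary.PropositionalEquality
  open import Relation.Nullary using (¬_; yes; no; contradiction)
  open import Relation.Nullary.Decidable using (¬?; _×-dec_)
  open import Relation.Unary using (Decidable)

  module _ {n} (G : Graph n) where

    -- Edges appear as ordered pairs, so an edge with both ends in the list is counted twice.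
    adjPairsAt : List (Fin n) → List (Fin n × Fin n)
    adjPairsAt = concatMap λ x → map (x ,_) (nbrs G x)

    adjPairs : List (Fin n × Fin n)
    adjPairs = adjPairsAt (allFin n)

    ∈-adjPairsAt⁺ : ∀ {S x y} → x ∈ S → Adj G x y → (x , y) ∈ adjPairsAt S
    ∈-adjPairsAt⁺ x∈ e = ∈-concatMap _ x∈ (∈-map⁺ _ (∈-elems⁺ e))

    ∈-adjPairsAt⁻ : ∀ S {x y} → (x , y) ∈ adjPairsAt S → x ∈ S × Adj G x y
    ∈-adjPairsAt⁻ S p with concatMap-∈ _ S p
    ... | x , x∈ , q with ∈-map⁻ (x ,_) q
    ...   | y , y∈ , refl = x∈ , ∈-elems⁻ _ y∈

    unique-adjPairsAt : ∀ {S} → Unique S → Unique (adjPairsAt S)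
    unique-adjPairsAt u = unique-concatMap _ u
      (λ {x} _ → Unique.map⁺ (cong proj₂) (unique-elems (lookup G x)))
      λ {x} {y} _ _ p q → let (_ , _ , e) = ∈-map⁻ (x ,_) p
                              (_ , _ , e′) = ∈-map⁻ (y ,_) q in
        trans (sym (cong proj₁ e)) (cong proj₁ e′)

    length-adjPairsAt-≤ : ∀ {r} → Regular G r → ∀ S → length (adjPairsAt S) ≤ length S * r
    length-adjPairsAt-≤ reg S = length-concatMap-≤ _ _ S λ {x} _ →
      ≤-reflexive (trans (length-map (x ,_) (nbrs G x)) (length-nbrs {G = G} reg x))

    length-adjPairsAt-≥ : ∀ {r} → Regular G r → ∀ S → length S * r ≤ length (adjPairsAt S)
    length-adjPairsAt-≥ {r} reg S = subst (length S * r ≤_) (*-identityˡ _) (length-concatMap-≥ _ 1 _ S λ {x} _ →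
      ≤-reflexive (sym (trans (*-identityˡ _) (trans (length-map (x ,_) (nbrs G x)) (length-nbrs {G = G} reg x)))))

  AllEdges : ∀ {n} → List (Fin n × Fin n) → Graph n → Set
  AllEdges F G = All (λ e → Adj G (proj₁ e) (proj₂ e)) F

  allEdges? : ∀ {n} (F : List (Fin n × Fin n)) → Decidable (AllEdges F)
  allEdges? F G = All.all? (λ _ → _ ∈? _) F

  containing : ∀ r {n} → List (Fin n × Fin n) → List (Graph n)
  containing r {n} F = filter (allEdges? F) (regularGraphs r n)

  DistinctPairs : ∀ {n} → Fin n × Fin n → Fin n × Fin n → Set
  DistinctPairs (a , b) (c , d) = ¬ Pair a b c d

  -- `room` counts the free choices of (x , y): of the r n ordered edges at most 2 |F| belong to F
  -- in one of the two directions, at most (1 + r) r start in the closed neighbourhood of u, and at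
  -- most as many end in that of v, so n remain.
  module _ {r n : ℕ} {u v : Fin n} (u≢v : u ≢ v) (F : List (Fin n × Fin n))
           (distinct : All (DistinctPairs (u , v)) F)
           (room : n + (2 * length F + 2 * ((1 + r) * r)) ≤ r * n) where

    private
      _∈ˡ?_ = member? (_≟_ {n})

      -- Excluding closed neighbourhoods does double duty: since v is a neighbour of u, and u one of
      -- v, it also yields v ≠ x and u ≠ y.
      Avoids : Graph n → Fin n × Fin n → Set
      Avoids G (x , y) = x ∉ u ∷ nbrs G u × y ∉ v ∷ nbrs G v × All (DistinctPairs (x , y)) F

      avoids? : ∀ G → Decidable (Avoids G)
      avoids? G (x , y) = ¬? (x ∈ˡ? (u ∷ nbrs G u)) ×-dec ¬? (y ∈ˡ? (v ∷ nbrs G v))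
        ×-dec All.all? (λ _ → ¬? (Pair? x y _ _)) F

      moves : Graph n → List (Fin n × Fin n)
      moves G = filter (avoids? G) (adjPairs G)

      move : Graph n → Fin n × Fin n → Graph n × Fin n × Fin n
      move G (x , y) = switch G u v x y , x , y

      excluded : Graph n → List (Fin n × Fin n)
      excluded G = (F ++ map swap F) ++
        (adjPairsAt G (u ∷ nbrs G u) ++ map swap (adjPairsAt G (v ∷ nbrs G v)))

      target : List (Graph n × Fin n × Fin n)
      target = concatMap (λ G → concatMap (λ x → map (λ y → G , x , y) (nbrs G v)) (nbrs G u))
                         (containing r F)

      edge∈⁺ : ∀ {G′} → G′ ∈ containing r ((u , v) ∷ F) →
               G′ ∈ regularGraphs r n × Adj G′ u v × AllEdges F G′
      edge∈⁺ p with ∈-filter⁻ (allEdges? ((u , v) ∷ F)) p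
      ... | G∈ , (e ∷ es) = G∈ , e , es

      adj-or-eq : ∀ {G : Graph n} {a b} → b ∉ a ∷ nbrs G a → a ≢ b × ¬ Adj G a b
      adj-or-eq b∉ = (λ { refl → b∉ (here refl) }) , λ e → b∉ (there (∈-elems⁺ e))

      switchable : ∀ {G x y} → Simple G → Adj G u v → (x , y) ∈ moves G → Switchable G u v x y
      switchable {G} {x} {y} simple uv p with ∈-filter⁻ (avoids? G) {xs = adjPairs G} p
      ... | xy∈ , x∉ , y∉ , _ = record
        { uv = uv ; xy = proj₂ (∈-adjPairsAt⁻ G (allFin n) xy∈)
        ; u≢x = proj₁ (adj-or-eq {G} x∉) ; v≢x = λ { refl → proj₂ (adj-or-eq {G} x∉) uv }
        ; u≢y = λ { refl → proj₂ (adj-or-eq {G} y∉) (proj₂ simple _ _ uv) }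
        ; v≢y = proj₁ (adj-or-eq {G} y∉)
        ; ¬ux = proj₂ (adj-or-eq {G} x∉) ; ¬vy = proj₂ (adj-or-eq {G} y∉) }

      length-moves : ∀ {G} → Simple G → Regular G r → n ≤ length (moves G)
      length-moves {G} simple reg = +-cancelʳ-≤ rest n (length (moves G)) (begin
        n + rest                     ≤⟨ room ⟩
        r * n                        ≡⟨ *-comm r n ⟩
        n * r                        ≡⟨ cong (_* r) (length-tabulate {n = n} (λ i → i)) ⟨
        length (allFin n) * r        ≤⟨ length-adjPairsAt-≥ G reg (allFin n) ⟩
        length (adjPairs G)          ≤⟨ unique-length-≤ (unique-adjPairsAt G (Unique.allFin⁺ n)) cover ⟩
        length (moves G ++ excluded G) ≡⟨ length-++ (moves G) ⟩
        length (moves G) + length (excluded G) ≤⟨ +-monoʳ-≤ (length (moves G)) excluded-≤ ⟩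
        length (moves G) + rest ∎)
        where
        open ≤-Reasoning
        rest = 2 * length F + 2 * ((1 + r) * r)
        cover : ∀ {e} → e ∈ adjPairs G → e ∈ moves G ++ excluded G
        cover {x , y} e∈ with x ∈ˡ? (u ∷ nbrs G u) | y ∈ˡ? (v ∷ nbrs G v)
                            | All.all? (λ e → ¬? (Pair? x y (proj₁ e) (proj₂ e))) F
        ... | yes x∈ | _ | _ = ∈-++⁺ʳ (moves G) (∈-++⁺ʳ (F ++ map swap F)
                (∈-++⁺ˡ (∈-adjPairsAt⁺ G x∈ (proj₂ (∈-adjPairsAt⁻ G (allFin n) e∈)))))
        ... | no _ | yes y∈ | _ = ∈-++⁺ʳ (moves G) (∈-++⁺ʳ (F ++ map swap F)
                (∈-++⁺ʳ (adjPairsAt G (u ∷ nbrs G u)) (∈-map⁺ swap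
                  (∈-adjPairsAt⁺ G y∈ (proj₂ simple _ _ (proj₂ (∈-adjPairsAt⁻ G (allFin n) e∈)))))))
        ... | no x∉ | no y∉ | yes d = ∈-++⁺ˡ (∈-filter⁺ (avoids? G) e∈ (x∉ , y∉ , d))
        ... | no _ | no _ | no ¬d with find (All.¬All⇒Any¬ (λ _ → ¬? (Pair? x y _ _)) F ¬d)
        ...   | (a , b) , ab∈ , ¬¬p with Pair? x y a b
        ...     | no ¬p = contradiction ¬p ¬¬p
        ...     | yes (inj₁ (refl , refl)) = ∈-++⁺ʳ (moves G) (∈-++⁺ˡ (∈-++⁺ˡ ab∈))
        ...     | yes (inj₂ (refl , refl)) =
                    ∈-++⁺ʳ (moves G) (∈-++⁺ˡ (∈-++⁺ʳ F (∈-map⁺ swap ab∈)))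
        ball-≤ : ∀ w → length (adjPairsAt G (w ∷ nbrs G w)) ≤ (1 + r) * r
        ball-≤ w = ≤-trans (length-adjPairsAt-≤ G reg (w ∷ nbrs G w))
          (*-monoˡ-≤ r (s≤s (≤-reflexive (length-nbrs {G = G} reg w))))
        excluded-≤ : length (excluded G) ≤ rest
        excluded-≤ = begin
          length (excluded G)  ≡⟨ length-++ (F ++ map swap F) ⟩
          length (F ++ map swap F) + _
            ≡⟨ cong₂ _+_ (length-++ F) (length-++ (adjPairsAt G (u ∷ nbrs G u))) ⟩
          (length F + length (map swap F)) + (length (adjPairsAt G (u ∷ nbrs G u)) + length (map swap (adjPairsAt G (v ∷ nbrs G v))))
            ≡⟨ cong₂ (λ a b → (length F + a) + (length (adjPairsAt G (u ∷ nbrs G u)) + b)) (length-map swap F) (length-map swap (adjPairsAt G (v ∷ nbrs G v))) ⟩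
          (length F + length F) + (length (adjPairsAt G (u ∷ nbrs G u)) + length (adjPairsAt G (v ∷ nbrs G v)))
            ≤⟨ +-monoʳ-≤ (length F + length F) (+-mono-≤ (ball-≤ u) (ball-≤ v)) ⟩
          (length F + length F) + ((1 + r) * r + (1 + r) * r)
            ≡⟨ h (length F) ((1 + r) * r) ⟩
          rest ∎
          where
          h : ∀ a b → (a + a) + (b + b) ≡ 2 * a + 2 * b
          h = solve-∀

      move∈ : ∀ {G e} → G ∈ containing r ((u , v) ∷ F) → e ∈ moves G → move G e ∈ target
      move∈ {G} {x , y} G∈ e∈ = ∈-concatMap _
        (∈-filter⁺ (allEdges? F) (switch-∈ G∈r s) (All.tabulate edge))
        (∈-concatMap _ (∈-elems⁺ (Adj-switch-ux simple s (inj₁ (refl , refl))))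
          (∈-map⁺ _ (∈-elems⁺ (Adj-switch-vy simple s (inj₁ (refl , refl))))))
        where
        G∈r = proj₁ (edge∈⁺ G∈)
        simple = proj₁ (∈-regular⁻ G∈r)
        s = switchable simple (proj₁ (proj₂ (edge∈⁺ G∈))) e∈
        edge : ∀ {f} → f ∈ F → Adj (switch G u v x y) (proj₁ f) (proj₂ f)
        edge f∈ = Adj-switch-old simple s (All.lookup (proj₂ (proj₂ (edge∈⁺ G∈))) f∈)
          (All.lookup distinct f∈)
          (All.lookup (proj₂ (proj₂ (proj₂ (∈-filter⁻ (avoids? G) {xs = adjPairs G} e∈)))) f∈)

      move-injective : ∀ {G e G₂ e₂} → G ∈ containing r ((u , v) ∷ F) → e ∈ moves G →
        G₂ ∈ containing r ((u , v) ∷ F) → e₂ ∈ moves G₂ → move G e ≡ move G₂ e₂ →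
        G ≡ G₂ × e ≡ e₂
      move-injective {G} {x , y} {G₂} {x₂ , y₂} G∈ e∈ G₂∈ e₂∈ eq with cong proj₂ eq
      ... | refl = trans (sym (back G∈ e∈))
                     (trans (cong (λ H → switch H u x v y) (cong proj₁ eq)) (back G₂∈ e₂∈)) , refl
        where
        back : ∀ {H} → H ∈ containing r ((u , v) ∷ F) → (x , y) ∈ moves H →
               switch (switch H u v x y) u x v y ≡ H
        back H∈ p = let (H∈r , uv , _) = edge∈⁺ H∈ ; simple = proj₁ (∈-regular⁻ H∈r) in
          switch-inverse simple (switchable simple uv p)

      length-target : length target ≤ length (containing r F) * (r * r)
      length-target = length-concatMap-≤ _ (r * r) (containing r F) λ {G} G∈ →
        let reg = proj₂ (∈-regular⁻ (proj₁ (∈-filter⁻ (allEdges? F) {xs = regularGraphs r n} G∈))) in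
        ≤-trans (length-concatMap-≤ _ r (nbrs G u) λ {x} _ → ≤-reflexive
                  (trans (length-map (λ y → G , x , y) (nbrs G v)) (length-nbrs {G = G} reg v)))
                (≤-reflexive (cong (_* r) (length-nbrs {G = G} reg u)))

    -- The switching uv, xy ↦ ux, vy keeps the edges of F.  It has at least n
    -- choices of (x , y), and at most r² choices undo it.
    containing-∷ : length (containing r ((u , v) ∷ F)) * n ≤ length (containing r F) * (r * r)
    containing-∷ = ≤-trans
      (subst (length (containing r ((u , v) ∷ F)) * n ≤_) (*-identityˡ _) (moves-bound moves move 1 n
        (Unique.filter⁺ (allEdges? ((u , v) ∷ F)) (regularGraphs-unique r n))
        (λ {G} _ → Unique.filter⁺ (avoids? G) (unique-adjPairsAt G (Unique.allFin⁺ n)))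
        (λ {G} G∈ → let (simple , reg) = ∈-regular⁻ (proj₁ (edge∈⁺ G∈)) in
          subst (n ≤_) (sym (*-identityˡ _)) (length-moves {G} simple reg))
        move∈ move-injective))
      length-target

  -- The edges of F are added one at a time, each at the cost of a factor r²/n. Here r ≥ 3 provides
  -- the room for every step: n + 2 (|F| + (1 + r) r) ≤ 3 n ≤ r n.
  containing-bound : ∀ {r n} → 3 ≤ r → (F : List (Fin n × Fin n)) →
    All (λ e → proj₁ e ≢ proj₂ e) F → AllPairs DistinctPairs F →
    length F + (1 + r) * r ≤ n →
    length (containing r F) * n ^ length F ≤ length (regularGraphs r n) * (r * r) ^ length F
  containing-bound {r} {n} 3≤r [] _ _ _ = *-monoˡ-≤ 1 (unique-length-≤
    (Unique.filter⁺ (allEdges? []) (regularGraphs-unique r n))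
    λ p → proj₁ (∈-filter⁻ (allEdges? []) {xs = regularGraphs r n} p))
  containing-bound {r} {n} 3≤r (e ∷ F) (ne ∷ nes) (d ∷ ds) room = begin
    c₁ * (n * n ^ k)        ≡⟨ *-assoc c₁ n (n ^ k) ⟨
    c₁ * n * n ^ k          ≤⟨ *-monoˡ-≤ (n ^ k) (containing-∷ {r} {n} ne F d room′) ⟩
    c₀ * (r * r) * n ^ k    ≡⟨ h c₀ (r * r) (n ^ k) ⟩
    c₀ * n ^ k * (r * r)
      ≤⟨ *-monoˡ-≤ (r * r) (containing-bound 3≤r F nes ds (≤-trans (n≤1+n _) room)) ⟩
    N * (r * r) ^ k * (r * r)   ≡⟨ h′ N ((r * r) ^ k) (r * r) ⟩
    N * (r * r * (r * r) ^ k) ∎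
    where
    open ≤-Reasoning
    k = length F
    c₁ = length (containing r (e ∷ F))
    c₀ = length (containing r F)
    N = length (regularGraphs r n)
    h : ∀ a b c → a * b * c ≡ a * c * b
    h = solve-∀
    h′ : ∀ a b c → a * b * c ≡ a * (c * b)
    h′ = solve-∀
    h″ : ∀ n a b → n + (2 * a + 2 * b) ≡ n + 2 * (a + b)
    h″ = solve-∀
    h‴ : ∀ n → n + 2 * n ≡ 3 * n
    h‴ = solve-∀
    room′ : n + (2 * k + 2 * ((1 + r) * r)) ≤ r * n
    room′ = begin
      n + (2 * k + 2 * ((1 + r) * r))  ≡⟨ h″ n k ((1 + r) * r) ⟩
      n + 2 * (k + (1 + r) * r)
        ≤⟨ +-monoʳ-≤ n (*-monoʳ-≤ 2 (≤-trans (n≤1+n _) room)) ⟩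
      n + 2 * n                        ≡⟨ h‴ n ⟩
      3 * n                            ≤⟨ *-monoˡ-≤ n 3≤r ⟩
      r * n ∎

  -- Union bound for vertex sets that span too many edges.

  upairs : {A : Set} → List A → List (A × A)
  upairs []       = []
  upairs (x ∷ xs) = map (x ,_) xs ++ upairs xs

  length-upairs : {A : Set} (xs : List A) → length (upairs xs) ≤ length xs * length xs
  length-upairs []       = z≤n
  length-upairs (x ∷ xs) = begin
    length (map (x ,_) xs ++ upairs xs)    ≡⟨ length-++ (map (x ,_) xs) ⟩
    length (map (x ,_) xs) + length (upairs xs)
      ≤⟨ +-mono-≤ (≤-reflexive (length-map (x ,_) xs)) (length-upairs xs) ⟩
    k + k * k                              ≤⟨ m≤n+m (k + k * k) (suc k) ⟩
    suc k + (k + k * k)                    ≡⟨ h k ⟩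
    suc k * suc k                          ∎
    where
    open ≤-Reasoning
    k = length xs
    h : ∀ k → suc k + (k + k * k) ≡ suc k * suc k
    h = solve-∀

  ∈-upairs⁻ : {A : Set} {xs : List A} → Unique xs → ∀ {a b} → (a , b) ∈ upairs xs →
              a ∈ xs × b ∈ xs × a ≢ b
  ∈-upairs⁻ {xs = x ∷ xs} (x∉ ∷ u) p with ∈-++⁻ (map (x ,_) xs) p
  ... | inj₁ q with ∈-map⁻ (x ,_) q
  ...   | y , y∈ , refl = here refl , there y∈ , All.lookup x∉ y∈
  ∈-upairs⁻ {xs = x ∷ xs} (x∉ ∷ u) p | inj₂ q =
    let (a∈ , b∈ , ne) = ∈-upairs⁻ u q in there a∈ , there b∈ , ne

  ∈-upairs⁺ : {A : Set} {xs : List A} {a b : A} → a ∈ xs → b ∈ xs → a ≢ b →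
              (a , b) ∈ upairs xs ⊎ (b , a) ∈ upairs xs
  ∈-upairs⁺ (here refl) (here refl) ne = contradiction refl ne
  ∈-upairs⁺ (here refl) (there b∈)  ne = inj₁ (∈-++⁺ˡ (∈-map⁺ _ b∈))
  ∈-upairs⁺ (there a∈)  (here refl) ne = inj₂ (∈-++⁺ˡ (∈-map⁺ _ a∈))
  ∈-upairs⁺ {xs = x ∷ xs} (there a∈)  (there b∈)  ne =
    [ inj₁ ∘ ∈-++⁺ʳ (map (x ,_) xs) , inj₂ ∘ ∈-++⁺ʳ (map (x ,_) xs) ]′ (∈-upairs⁺ a∈ b∈ ne)

  distinct-upairs : ∀ {n} {xs : List (Fin n)} → Unique xs → AllPairs DistinctPairs (upairs xs)
  distinct-upairs {xs = []}     _        = []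
  distinct-upairs {xs = x ∷ xs} (x∉ ∷ u) = AllPairs.++⁺
    (AllPairs.map⁺ (pairs x∉ u))
    (distinct-upairs u)
    (All.map⁺ (All.tabulate λ {y} y∈ → All.tabulate λ {cd} q →
      let (c∈ , d∈ , _) = ∈-upairs⁻ u q in
      λ { (inj₁ (refl , _)) → All.lookup x∉ c∈ refl ; (inj₂ (_ , refl)) → All.lookup x∉ d∈ refl }))
    where
    pairs : ∀ {ys} → All (x ≢_) ys → Unique ys → AllPairs (λ y z → DistinctPairs (x , y) (x , z)) ys
    pairs []         []       = []
    pairs (x≢y ∷ a) (y∉ ∷ u′) =
      All.map (λ y≢z → λ { (inj₁ (_ , e)) → y≢z (sym e) ; (inj₂ (e , _)) → x≢y e }) y∉ ∷ pairs a u′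

  allPairs-⊆ : {A : Set} {R : A → A → Set} {xs ys : List A} → xs ⊆ ys → AllPairs R ys → AllPairs R xs
  allPairs-⊆ []         []       = []
  allPairs-⊆ (_ ∷ʳ s)   (_ ∷ rs) = allPairs-⊆ s rs
  allPairs-⊆ (refl ∷ s) (a ∷ rs) = Sub.All-resp-⊆ s a ∷ allPairs-⊆ s rs

  internal : ∀ {n} → Graph n → List (Fin n) → List (Fin n × Fin n)
  internal G T = filter (λ (a , b) → b ∈? lookup G a) (upairs T)

  length-concatMap-* : {A B : Set} (f : A → List B) (w c : ℕ) (xs : List A) →
    (∀ {x} → x ∈ xs → length (f x) * w ≤ c) → length (concatMap f xs) * w ≤ length xs * c
  length-concatMap-* f w c []       _ = z≤n
  length-concatMap-* f w c (x ∷ xs) h = begin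
    length (f x ++ concatMap f xs) * w            ≡⟨ cong (_* w) (length-++ (f x)) ⟩
    (length (f x) + length (concatMap f xs)) * w  ≡⟨ *-distribʳ-+ w (length (f x)) _ ⟩
    length (f x) * w + length (concatMap f xs) * w
      ≤⟨ +-mono-≤ (h (here refl)) (length-concatMap-* f w c xs (h ∘ there)) ⟩
    c + length xs * c                             ∎
    where open ≤-Reasoning

  TooDense : ∀ {n} → ℕ → Graph n → Set
  TooDense {n} s G = Any (λ T → 5 * s ≤ 4 * length (internal G T)) (combos s (allFin n))

  tooDense? : ∀ {n} s → Decidable (TooDense {n} s)
  tooDense? {n} s G = any? (λ T → 5 * s ≤? 4 * length (internal G T)) (combos s (allFin n))

  -- s / 4 rounded up, so that s + quarter s is the least integer not below 5 s / 4.
  quarter : ℕ → ℕ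
  quarter s = (s + 3) / 4

  s≤4*quarter : ∀ s → s ≤ 4 * quarter s
  s≤4*quarter s = +-cancelʳ-≤ 3 s (4 * quarter s) (begin
    s + 3                            ≡⟨ m≡m%n+[m/n]*n (s + 3) 4 ⟩
    (s + 3) % 4 + quarter s * 4      ≤⟨ +-monoˡ-≤ _ (≤-pred (m%n<n (s + 3) 4)) ⟩
    3 + quarter s * 4                ≡⟨ h (quarter s) ⟩
    4 * quarter s + 3                ∎)
    where
    open ≤-Reasoning
    h : ∀ q → 3 + q * 4 ≡ 4 * q + 3
    h = solve-∀

  4*quarter≤s+3 : ∀ s → 4 * quarter s ≤ s + 3
  4*quarter≤s+3 s = subst (_≤ s + 3) (*-comm (quarter s) 4) (m/n*n≤m (s + 3) 4)

  module _ {r n : ℕ} (3≤r : 3 ≤ r) (s : ℕ) (room : s + quarter s + (1 + r) * r ≤ n) where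

    private
      K = s + quarter s
      N = length (regularGraphs r n)

      dense : List (Graph n)
      dense = filter (tooDense? s) (regularGraphs r n)

      witnesses : List (Fin n) → List (Graph n)
      witnesses T = concatMap (containing r) (combos K (upairs T))

      dense⊆ : ∀ {G} → G ∈ dense → G ∈ concatMap witnesses (combos s (allFin n))
      dense⊆ {G} G∈ with ∈-filter⁻ (tooDense? s) {xs = regularGraphs r n} G∈
      ... | G∈r , td with find td
      ...   | T , T∈ , 5s≤4i = ∈-concatMap witnesses T∈ (∈-concatMap (containing r) F∈
                (∈-filter⁺ (allEdges? F) G∈r
                  (All.take⁺ K (All.all-filter _ (upairs T)))))
        where
        open ≤-Reasoning
        i = length (internal G T)
        -- Only K of the spanned edges are kept, so that the union runs over edge sets of a single
        -- size.
        F = take K (internal G T)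
        -- Rounding 5 s / 4 up to K cannot overtake the integer i, because 4 K ≤ 5 s + 3 < 4 (i +
        -- 1).
        K≤i : K ≤ i
        K≤i = ≤-pred (*-cancelˡ-< 4 K (suc i) (begin-strict
          4 * (s + quarter s)        ≡⟨ *-distribˡ-+ 4 s (quarter s) ⟩
          4 * s + 4 * quarter s      ≤⟨ +-monoʳ-≤ (4 * s) (4*quarter≤s+3 s) ⟩
          4 * s + (s + 3)            ≡⟨ h s ⟩
          5 * s + 3                  ≤⟨ +-monoˡ-≤ 3 5s≤4i ⟩
          4 * i + 3                  <⟨ ≤-reflexive (h′ i) ⟩
          4 * suc i                  ∎))
          where
          h : ∀ s → 4 * s + (s + 3) ≡ 5 * s + 3
          h = solve-∀
          h′ : ∀ i → suc (4 * i + 3) ≡ 4 * suc i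
          h′ = solve-∀
        F∈ : F ∈ combos K (upairs T)
        F∈ = subst (λ k → F ∈ combos k (upairs T)) (trans (length-take K (internal G T)) (m≤n⇒m⊓n≡m K≤i))
          (⊆⇒∈-combos (⊆-trans (Sub.take-⊆ K _) (Sub.filter-⊆ _ (upairs T))))

      bound-F : ∀ {T F} → T ∈ combos s (allFin n) → F ∈ combos K (upairs T) →
                length (containing r F) * n ^ K ≤ N * (r * r) ^ K
      bound-F {T} {F} T∈ F∈ = subst (λ k → length (containing r F) * n ^ k ≤ N * (r * r) ^ k) lenF
        (containing-bound 3≤r F
          (All.tabulate λ e∈ → proj₂ (proj₂ (∈-upairs⁻ uT (⊆-lookup F⊆ e∈))))
          (allPairs-⊆ F⊆ (distinct-upairs uT))
          (subst (λ k → k + (1 + r) * r ≤ n) (sym lenF) room))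
        where
        F⊆ = proj₁ (∈-combos⇒⊆ K (upairs T) F∈)
        lenF = proj₂ (∈-combos⇒⊆ K (upairs T) F∈)
        uT : Unique T
        uT = allPairs-⊆ (proj₁ (∈-combos⇒⊆ s (allFin n) T∈)) (Unique.allFin⁺ n)

      bound-T : ∀ {T} → T ∈ combos s (allFin n) →
                length (witnesses T) * (n ^ K * K !) ≤ (s * s) ^ K * (N * (r * r) ^ K)
      bound-T {T} T∈ = begin
        length (witnesses T) * (n ^ K * K !)        ≡⟨ *-assoc (length (witnesses T)) _ _ ⟨
        length (witnesses T) * n ^ K * K !
          ≤⟨ *-monoˡ-≤ (K !) (length-concatMap-* (containing r) (n ^ K) c (combos K (upairs T)) (bound-F T∈)) ⟩
        length (combos K (upairs T)) * c * K !      ≡⟨ h (length (combos K (upairs T))) c (K !) ⟩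
        length (combos K (upairs T)) * K ! * c      ≤⟨ *-monoˡ-≤ c (combos-bound K (upairs T)) ⟩
        length (upairs T) ^ K * c
          ≤⟨ *-monoˡ-≤ c (^-monoˡ-≤ K (subst (λ t → length (upairs T) ≤ t * t) lenT (length-upairs T))) ⟩
        (s * s) ^ K * c                             ∎
        where
        open ≤-Reasoning
        c = N * (r * r) ^ K
        lenT = proj₂ (∈-combos⇒⊆ s (allFin n) T∈)
        h : ∀ a b c → a * b * c ≡ a * c * b
        h = solve-∀

    -- Union bound over the vertex set T, with at most n^s / s! choices, and over K of its pairs,
    -- with at most s^(2K) / K! choices; each has probability at most (r²/n)^K.
    tooDense-raw : length dense * (n ^ K * K !) * s ! ≤ n ^ s * ((s * s) ^ K * (N * (r * r) ^ K))
    tooDense-raw = begin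
      length dense * (n ^ K * K !) * s !
        ≤⟨ *-monoˡ-≤ (s !) (*-monoˡ-≤ (n ^ K * K !)
             (unique-length-≤ (Unique.filter⁺ (tooDense? s) (regularGraphs-unique r n)) dense⊆)) ⟩
      length (concatMap witnesses (combos s (allFin n))) * (n ^ K * K !) * s !
        ≤⟨ *-monoˡ-≤ (s !) (length-concatMap-* witnesses _ c (combos s (allFin n)) bound-T) ⟩
      length (combos s (allFin n)) * c * s !      ≡⟨ h (length (combos s (allFin n))) c (s !) ⟩
      length (combos s (allFin n)) * s ! * c      ≤⟨ *-monoˡ-≤ c (combos-bound s (allFin n)) ⟩
      length (allFin n) ^ s * c                   ≡⟨ cong (λ k → k ^ s * c) (length-tabulate {n = n} (λ i → i)) ⟩
      n ^ s * c                                   ∎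
      where
      open ≤-Reasoning
      c = (s * s) ^ K * (N * (r * r) ^ K)
      h : ∀ a b c → a * b * c ≡ a * c * b
      h = solve-∀

-- Random regular graphs have no small dense sets.

module Density where

  open Counting
  open Switching
  open FirstMoment
  open import Data.List using (List; []; _∷_; _++_; length; filter; concatMap; allFin)
  open import Data.List.Properties using (length-++)
  open import Data.List.Membership.Propositional using (_∈_; find; lose)
  open import Data.List.Membership.Propositional.Properties using (∈-filter⁺; ∈-filter⁻)
  open import Data.List.Relation.Unary.Any using (Any; here; there; any?)
  open import Data.List.Relation.Unary.Unique.Propositional using (Unique)
  import Data.List.Relation.Unary.Unique.Propositional.Properties as Unique
  open import Data.Nat
  open import Data.Nat.DivMod using (_/_; m/n*n≤m; m*n/n≡m; /-monoˡ-≤)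
  open import Data.Nat.Properties
  open import Data.Nat.Tactic.RingSolver using (solve-∀)
  open import Data.Product using (_,_)
  open import Data.Sum using (inj₁; inj₂)
  open import Relation.Binary.PropositionalEquality
  open import Relation.Nullary using (¬_)
  open import Relation.Unary using (Decidable)

  n≤2^n : ∀ n → n ≤ 2 ^ n
  n≤2^n zero    = z≤n
  n≤2^n (suc n) = begin
    1 + n              ≤⟨ +-mono-≤ (m^n>0 2 n) (n≤2^n n) ⟩
    2 ^ n + 2 ^ n      ≡⟨ cong (2 ^ n +_) (+-identityʳ (2 ^ n)) ⟨
    2 ^ suc n          ∎
    where open ≤-Reasoning

  ^-distribʳ-* : ∀ k m n → (m * n) ^ k ≡ m ^ k * n ^ k
  ^-distribʳ-* zero    m n = refl
  ^-distribʳ-* (suc k) m n = trans (cong (m * n *_) (^-distribʳ-* k m n)) (h m n (m ^ k) (n ^ k))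
    where
    h : ∀ m n a b → m * n * (a * b) ≡ m * a * (n * b)
    h = solve-∀

  -- The constants of base come from s ^ s ≤ 4 ^ s * s !, s + K ≤ 9 q and
  -- 2 K ≤ 10 q, where K = s + q and s ≤ 4 q.  They are abstract because
  -- multiplication by a large literal would be unfolded in unary.
  abstract

    4⁹ 2⁸ : ℕ
    4⁹ = 4 ^ 9
    2⁸ = 2 ^ 8

    4⁹-^ : ∀ q → 4 ^ (9 * q) ≡ 4⁹ ^ q
    4⁹-^ q = sym (^-*-assoc 4 9 q)

    2⁸-^ : ∀ q → 2 ^ (8 * q) ≡ 2⁸ ^ q
    2⁸-^ q = sym (^-*-assoc 2 8 q)

    4⁹≢0 : NonZero 4⁹
    4⁹≢0 = _

    2⁸≢0 : NonZero 2⁸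
    2⁸≢0 = _

    5≤2⁸*4⁹ : 5 ≤ 2⁸ * 4⁹
    5≤2⁸*4⁹ = ≤ᵇ⇒≤ 5 (2⁸ * 4⁹) _

  base : ℕ → ℕ
  base r = 4⁹ * r ^ 10

  -- For s ≤ n / threshold r the ratio base r * s / n is at most 2^(-8). As 8 q ≥ 2 s, its q-th
  -- power pays for two factors 2^s: one makes the sum over s converge, the other absorbs a linear
  -- factor s.
  threshold : ℕ → ℕ
  threshold r = 2⁸ * base r

  module _ (r n s q N f : ℕ) .{{_ : NonZero r}} .{{_ : NonZero n}} .{{_ : NonZero s}} (s≤4q : s ≤ 4 * q) where

    private
      K = s + q

      s+K≤9q : s + K ≤ 9 * q
      s+K≤9q = begin
        s + (s + q)          ≤⟨ +-mono-≤ s≤4q (+-monoˡ-≤ q s≤4q) ⟩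
        4 * q + (4 * q + q)  ≡⟨ h q ⟩
        9 * q                ∎
        where
        open ≤-Reasoning
        h : ∀ q → 4 * q + (4 * q + q) ≡ 9 * q
        h = solve-∀

      2K≤10q : 2 * K ≤ 10 * q
      2K≤10q = begin
        2 * (s + q)          ≤⟨ *-monoʳ-≤ 2 (+-monoˡ-≤ q s≤4q) ⟩
        2 * (4 * q + q)      ≡⟨ h q ⟩
        10 * q               ∎
        where
        open ≤-Reasoning
        h : ∀ q → 2 * (4 * q + q) ≡ 10 * q
        h = solve-∀

      [r*r]^K : (r * r) ^ K ≤ (r ^ 10) ^ q
      [r*r]^K = begin
        (r * r) ^ K      ≡⟨ cong (_^ K) (cong (r *_) (*-identityʳ r)) ⟨
        (r ^ 2) ^ K      ≡⟨ ^-*-assoc r 2 K ⟩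
        r ^ (2 * K)      ≤⟨ ^-monoʳ-≤ r 2K≤10q ⟩
        r ^ (10 * q)     ≡⟨ ^-*-assoc r 10 q ⟨
        (r ^ 10) ^ q     ∎
        where open ≤-Reasoning

      4^[s+K] : 4 ^ s * 4 ^ K ≤ 4⁹ ^ q
      4^[s+K] = begin
        4 ^ s * 4 ^ K    ≡⟨ ^-distribˡ-+-* 4 s K ⟨
        4 ^ (s + K)      ≤⟨ ^-monoʳ-≤ 4 s+K≤9q ⟩
        4 ^ (9 * q)      ≡⟨ 4⁹-^ q ⟩
        4⁹ ^ q      ∎
        where open ≤-Reasoning

    -- In the union bound n^s / n^K leaves n^(-q), and s^(2K) / (K! s!) leaves s^q up to a factor
    -- 4^(s+K), by the lower bounds on s! and K!.
    cancel-powers : f * (n ^ K * K !) * s ! ≤ n ^ s * ((s * s) ^ K * (N * (r * r) ^ K)) →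
                    f * n ^ q ≤ (base r * s) ^ q * N
    cancel-powers raw = *-cancelˡ-≤ (n ^ s * (s ^ K * s ^ s))
      {{m*n≢0 _ _ {{m^n≢0 n s}} {{m*n≢0 _ _ {{m^n≢0 s K}} {{m^n≢0 s s}}}}}} (begin
      n ^ s * (s ^ K * s ^ s) * (f * n ^ q)
        ≡⟨ h₁ (n ^ s) (s ^ K) (s ^ s) f (n ^ q) ⟩
      f * (n ^ s * n ^ q) * s ^ K * s ^ s
        ≡⟨ cong (λ z → f * z * s ^ K * s ^ s) (^-distribˡ-+-* n s q) ⟨
      f * n ^ K * s ^ K * s ^ s
        ≤⟨ *-mono-≤ (*-monoʳ-≤ (f * n ^ K) (≤-trans (^-monoˡ-≤ K (m≤m+n s q)) (s^s≤4^s*s! K)))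
                    (s^s≤4^s*s! s) ⟩
      f * n ^ K * (4 ^ K * K !) * (4 ^ s * s !)
        ≡⟨ h₂ f (n ^ K) (4 ^ K) (K !) (4 ^ s) (s !) ⟩
      4 ^ s * 4 ^ K * (f * (n ^ K * K !) * s !)
        ≤⟨ *-mono-≤ 4^[s+K] raw ⟩
      4⁹ ^ q * (n ^ s * ((s * s) ^ K * (N * (r * r) ^ K)))
        ≤⟨ *-monoʳ-≤ (4⁹ ^ q) (*-monoʳ-≤ (n ^ s) (*-monoʳ-≤ ((s * s) ^ K) (*-monoʳ-≤ N [r*r]^K))) ⟩
      4⁹ ^ q * (n ^ s * ((s * s) ^ K * (N * (r ^ 10) ^ q)))
        ≡⟨ cong (λ z → 4⁹ ^ q * (n ^ s * (z * (N * (r ^ 10) ^ q)))) [s*s]^K ⟩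
      4⁹ ^ q * (n ^ s * (s ^ K * (s ^ s * s ^ q) * (N * (r ^ 10) ^ q)))
        ≡⟨ h₃ (4⁹ ^ q) (n ^ s) (s ^ K) (s ^ s) (s ^ q) N ((r ^ 10) ^ q) ⟩
      n ^ s * (s ^ K * s ^ s) * (4⁹ ^ q * (r ^ 10) ^ q * s ^ q * N)
        ≡⟨ cong (λ z → n ^ s * (s ^ K * s ^ s) * (z * s ^ q * N)) (^-distribʳ-* q 4⁹ (r ^ 10)) ⟨
      n ^ s * (s ^ K * s ^ s) * (base r ^ q * s ^ q * N)
        ≡⟨ cong (λ z → n ^ s * (s ^ K * s ^ s) * (z * N)) (^-distribʳ-* q (base r) s) ⟨
      n ^ s * (s ^ K * s ^ s) * ((base r * s) ^ q * N) ∎)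
      where
      open ≤-Reasoning
      [s*s]^K : (s * s) ^ K ≡ s ^ K * (s ^ s * s ^ q)
      [s*s]^K = trans (^-distribʳ-* K s s) (cong (s ^ K *_) (^-distribˡ-+-* s s q))
      h₁ : ∀ a b c f d → a * (b * c) * (f * d) ≡ f * (a * d) * b * c
      h₁ = solve-∀
      h₂ : ∀ f a b c d e → f * a * (b * c) * (d * e) ≡ d * b * (f * (a * c) * e)
      h₂ = solve-∀
      h₃ : ∀ a b c d e N g → a * (b * (c * (d * e) * (N * g))) ≡ b * (c * d) * (a * g * e * N)
      h₃ = solve-∀

    -- Of the q ≥ 1 factors threshold r * s / n one is kept as the decay in n, and the others are
    -- bounded by 1.
    geometric : threshold r * s ≤ n → f * n ^ q ≤ (base r * s) ^ q * N →
                f * n * 2 ^ s ≤ threshold r * N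
    geometric Ms≤n bound = *-cancelʳ-≤ _ _ s (begin
      f * n * 2 ^ s * s              ≤⟨ *-monoʳ-≤ (f * n * 2 ^ s) (n≤2^n s) ⟩
      f * n * 2 ^ s * 2 ^ s          ≡⟨ *-assoc (f * n) _ _ ⟩
      f * n * (2 ^ s * 2 ^ s)        ≡⟨ cong (f * n *_) (^-distribˡ-+-* 2 s s) ⟨
      f * n * 2 ^ (s + s)            ≤⟨ *-monoʳ-≤ (f * n) (^-monoʳ-≤ 2 s+s≤8q) ⟩
      f * n * 2 ^ (8 * q)            ≡⟨ cong (f * n *_) (2⁸-^ q) ⟩
      f * n * 2⁸ ^ q            ≤⟨ step q s≤4q bound ⟩
      threshold r * s * N            ≡⟨ h (threshold r) s N ⟩
      threshold r * N * s            ∎)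
      where
      open ≤-Reasoning
      h : ∀ a b c → a * b * c ≡ a * c * b
      h = solve-∀
      s+s≤8q : s + s ≤ 8 * q
      s+s≤8q = ≤-trans (+-mono-≤ s≤4q s≤4q) (≤-reflexive (h′ q))
        where
        h′ : ∀ q → 4 * q + 4 * q ≡ 8 * q
        h′ = solve-∀
      step : ∀ q → s ≤ 4 * q → f * n ^ q ≤ (base r * s) ^ q * N →
             f * n * 2⁸ ^ q ≤ threshold r * s * N
      step zero    s≤0 _  with () ← n≮0 {0} (≤-trans (>-nonZero⁻¹ s) s≤0)
      step (suc p) _   bd = *-cancelˡ-≤ (n ^ p) {{m^n≢0 n p}} (begin
        n ^ p * (f * n * (2⁸ * 2⁸ ^ p))
          ≡⟨ g₁ (n ^ p) f n 2⁸ (2⁸ ^ p) ⟩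
        f * (n * n ^ p) * (2⁸ * 2⁸ ^ p)
          ≤⟨ *-monoˡ-≤ (2⁸ * 2⁸ ^ p) bd ⟩
        b * b ^ p * N * (2⁸ * 2⁸ ^ p)
          ≡⟨ g₂ b (b ^ p) N 2⁸ (2⁸ ^ p) ⟩
        2⁸ ^ p * b ^ p * (2⁸ * b * N)
          ≡⟨ cong₂ _*_ (^-distribʳ-* p 2⁸ b) (cong (_* N) (*-assoc 2⁸ (base r) s)) ⟨
        (2⁸ * b) ^ p * (threshold r * s * N)
          ≡⟨ cong (λ z → z ^ p * (threshold r * s * N)) (*-assoc 2⁸ (base r) s) ⟨
        (threshold r * s) ^ p * (threshold r * s * N)
          ≤⟨ *-monoˡ-≤ (threshold r * s * N) (^-monoˡ-≤ p Ms≤n) ⟩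
        n ^ p * (threshold r * s * N) ∎)
        where
        b = base r * s
        g₁ : ∀ a f n c d → a * (f * n * (c * d)) ≡ f * (n * a) * (c * d)
        g₁ = solve-∀
        g₂ : ∀ b a N c d → b * a * N * (c * d) ≡ d * a * (c * b * N)
        g₂ = solve-∀

  range : ℕ → List ℕ
  range zero    = []
  range (suc S) = suc S ∷ range S

  ∈-range⁺ : ∀ {S s} → 1 ≤ s → s ≤ S → s ∈ range S
  ∈-range⁺ {zero}  1≤s s≤0 with () ← ≤-trans 1≤s s≤0
  ∈-range⁺ {suc S} 1≤s s≤S with m≤n⇒m<n∨m≡n s≤S
  ... | inj₁ (s≤s s≤S′) = there (∈-range⁺ 1≤s s≤S′)
  ... | inj₂ refl       = here refl

  -- The sum is at most (1 - 2^(-S)) X / n; the term X on the left is what lets the induction close.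
  geometric-sum : {A : Set} (f : ℕ → List A) (n X S : ℕ) →
    (∀ s → 1 ≤ s → s ≤ S → length (f s) * n * 2 ^ s ≤ X) →
    length (concatMap f (range S)) * n * 2 ^ S + X ≤ X * 2 ^ S
  geometric-sum f n X zero    _ = ≤-reflexive (sym (*-identityʳ X))
  geometric-sum f n X (suc S) h = begin
    length (f (suc S) ++ rest) * n * (2 * 2 ^ S) + X
      ≡⟨ cong (λ z → z * n * (2 * 2 ^ S) + X) (length-++ (f (suc S))) ⟩
    (length (f (suc S)) + length rest) * n * (2 * 2 ^ S) + X
      ≡⟨ g (length (f (suc S))) (length rest) n (2 ^ S) X ⟩
    length (f (suc S)) * n * 2 ^ suc S + (2 * (length rest * n * 2 ^ S) + X)
      ≤⟨ +-monoˡ-≤ _ (h (suc S) (s≤s z≤n) ≤-refl) ⟩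
    X + (2 * (length rest * n * 2 ^ S) + X)
      ≡⟨ g′ X (length rest * n * 2 ^ S) ⟩
    2 * (length rest * n * 2 ^ S + X)
      ≤⟨ *-monoʳ-≤ 2 (geometric-sum f n X S (λ s p q → h s p (m≤n⇒m≤1+n q))) ⟩
    2 * (X * 2 ^ S)
      ≡⟨ g″ X (2 ^ S) ⟩
    X * (2 * 2 ^ S) ∎
    where
    open ≤-Reasoning
    rest = concatMap f (range S)
    g : ∀ a b n p X → (a + b) * n * (2 * p) + X ≡ a * n * (2 * p) + (2 * (b * n * p) + X)
    g = solve-∀
    g′ : ∀ X a → X + (2 * a + X) ≡ 2 * (a + X)
    g′ = solve-∀
    g″ : ∀ X p → 2 * (X * p) ≡ X * (2 * p)
    g″ = solve-∀

  threshold≢0 : ∀ r → .{{NonZero r}} → NonZero (threshold r)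
  threshold≢0 r = m*n≢0 2⁸ (base r) {{2⁸≢0}} {{m*n≢0 4⁹ (r ^ 10) {{4⁹≢0}} {{m^n≢0 r 10}}}}

  Dense : ∀ r → .{{NonZero r}} → ∀ {n} → Graph n → Set
  Dense r {n} G = Any (λ s → TooDense s G) (range ((n / threshold r) {{threshold≢0 r}}))

  dense? : ∀ r → .{{_ : NonZero r}} → ∀ {n} → Decidable (Dense r {n})
  dense? r {n} G = any? (λ s → tooDense? s G) (range ((n / threshold r) {{threshold≢0 r}}))

  -- The form in which sparseness enters the later arguments, with the quotient n / threshold r
  -- traded for a product.
  ¬dense : ∀ r .{{_ : NonZero r}} {n} {G : Graph n} → ¬ Dense r G →
           ∀ {T} → T ∈ combos (length T) (allFin n) → 1 ≤ length T → threshold r * length T ≤ n →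
           4 * length (internal G T) < 5 * length T
  ¬dense r {n} {G} nd {T} T∈ 1≤s Ms≤n = ≰⇒> λ 5s≤4i → nd (lose
    (∈-range⁺ 1≤s s≤n/M) (lose T∈ 5s≤4i))
    where
    instance threshold-nonZero = threshold≢0 r
    s≤n/M : length T ≤ n / threshold r
    s≤n/M = begin
      length T                            ≡⟨ m*n/n≡m (length T) (threshold r) ⟨
      length T * threshold r / threshold r
        ≤⟨ /-monoˡ-≤ (threshold r) (subst (_≤ n) (*-comm (threshold r) (length T)) Ms≤n) ⟩
      n / threshold r ∎
      where open ≤-Reasoning

  module _ {r n : ℕ} .{{_ : NonZero r}} .{{_ : NonZero n}} (3≤r : 3 ≤ r) where

    private
      N = length (regularGraphs r n)
      instance threshold-nonZero = threshold≢0 r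
      S = n / threshold r

      dense : ℕ → List (Graph n)
      dense s = filter (tooDense? s) (regularGraphs r n)

      room : ∀ s → 1 ≤ s → threshold r * s ≤ n → s + quarter s + (1 + r) * r ≤ n
      room s 1≤s Ms≤n = begin
        s + quarter s + (1 + r) * r
          ≤⟨ +-monoˡ-≤ _ (+-monoʳ-≤ s q≤s+s) ⟩
        s + (s + s) + (1 + r) * r
          ≡⟨ cong (s + (s + s) +_) (h r) ⟩
        s + (s + s) + (r + r * r)
          ≤⟨ +-monoʳ-≤ (s + (s + s)) (+-mono-≤ (≤-trans (≤-reflexive (sym (*-identityʳ r))) (r≤ 0 9))
               (≤-trans (≤-reflexive (cong (r *_) (sym (*-identityʳ r)))) (r≤ 1 8))) ⟩
        s + (s + s) + (P + P)
          ≤⟨ +-mono-≤ (≤-reflexive (h′ s)) (≤-reflexive (h″ P)) ⟩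
        3 * s + 2 * P
          ≤⟨ +-mono-≤ (*-monoʳ-≤ 3 (m≤n*m s P {{P≢0}})) (*-monoʳ-≤ 2 (m≤m*n P s {{>-nonZero 1≤s}})) ⟩
        3 * (P * s) + 2 * (P * s)
          ≡⟨ *-distribʳ-+ (P * s) 3 2 ⟨
        5 * (P * s)
          ≤⟨ *-monoˡ-≤ (P * s) 5≤2⁸*4⁹ ⟩
        2⁸ * 4⁹ * (P * s)
          ≡⟨ h‴ 2⁸ 4⁹ P s ⟩
        threshold r * s
          ≤⟨ Ms≤n ⟩
        n ∎
        where
        open ≤-Reasoning
        P = r ^ 10
        P≢0 = m^n≢0 r 10
        r≤ : ∀ i j → r ^ suc i ≤ r ^ (suc i + j)
        r≤ i j = ^-monoʳ-≤ r (m≤m+n (suc i) j)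
        q≤s+s : quarter s ≤ s + s
        q≤s+s = *-cancelˡ-≤ 4 (begin
          4 * quarter s  ≤⟨ 4*quarter≤s+3 s ⟩
          s + 3          ≤⟨ +-monoʳ-≤ s (*-monoʳ-≤ 3 1≤s) ⟩
          s + 3 * s      ≤⟨ m≤m+n _ (4 * s) ⟩
          s + 3 * s + 4 * s ≡⟨ g s ⟩
          4 * (s + s)    ∎)
          where
          g : ∀ s → s + 3 * s + 4 * s ≡ 4 * (s + s)
          g = solve-∀
        h : ∀ r → (1 + r) * r ≡ r + r * r
        h = solve-∀
        h′ : ∀ s → s + (s + s) ≡ 3 * s
        h′ = solve-∀
        h″ : ∀ s → s + s ≡ 2 * s
        h″ = solve-∀
        h‴ : ∀ a b P s → a * b * (P * s) ≡ a * (b * P) * s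
        h‴ = solve-∀

      each : ∀ s → 1 ≤ s → s ≤ S → length (dense s) * n * 2 ^ s ≤ threshold r * N
      each s 1≤s s≤S = geometric r n s (quarter s) N (length (dense s)) (s≤4*quarter s) Ms≤n
        (cancel-powers r n s (quarter s) N (length (dense s)) (s≤4*quarter s)
          (tooDense-raw 3≤r s (room s 1≤s Ms≤n)))
        where
        instance s≢0 = >-nonZero 1≤s
        Ms≤n : threshold r * s ≤ n
        Ms≤n = subst (_≤ n) (*-comm s (threshold r))
          (≤-trans (*-monoˡ-≤ (threshold r) s≤S) (m/n*n≤m n (threshold r)))

    -- Thanks to the factors 2^(-s) the sum over all sizes is still of order 1 / n.
    dense-rare : length (filter (dense? r) (regularGraphs r n)) * n ≤ threshold r * N
    dense-rare = *-cancelʳ-≤ _ _ (2 ^ S) {{m^n≢0 2 S}} (begin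
      length (filter (dense? r) (regularGraphs r n)) * n * 2 ^ S
        ≤⟨ *-monoˡ-≤ (2 ^ S) (*-monoˡ-≤ n (unique-length-≤
             (Unique.filter⁺ (dense? r) (regularGraphs-unique r n)) cover)) ⟩
      length (concatMap dense (range S)) * n * 2 ^ S
        ≤⟨ m≤m+n _ (threshold r * N) ⟩
      length (concatMap dense (range S)) * n * 2 ^ S + threshold r * N
        ≤⟨ geometric-sum dense n (threshold r * N) S each ⟩
      threshold r * N * 2 ^ S ∎)
      where
      open ≤-Reasoning
      cover : ∀ {G} → G ∈ filter (dense? r) (regularGraphs r n) → G ∈ concatMap dense (range S)
      cover G∈ with ∈-filter⁻ (dense? r) {xs = regularGraphs r n} G∈
      ... | G∈r , d with find d
      ...   | s , s∈ , td = ∈-concatMap dense s∈ (∈-filter⁺ (tooDense? s) G∈r td)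

-- Breadth-first search, growth of balls, radius of components.

module Growth where

  open Counting
  open Switching
  open FirstMoment
  open import Data.Fin using (Fin; _≟_)
  open import Data.Fin.Properties using (any?)
  open import Data.Fin.Subset.Properties using (_∈?_)
  open import Data.List using (List; _++_; map; length; filter; allFin)
  open import Data.List.Properties using (length-map; length-++; length-tabulate)
  open import Data.List.Membership.Propositional using (_∈_)
  open import Data.List.Membership.Propositional.Properties
  open import Data.List.Relation.Unary.Unique.Propositional using (Unique)
  import Data.List.Relation.Unary.Unique.Propositional.Properties as Unique
  import Data.List.Relation.Binary.Sublist.Propositional.Properties as Sub
  open import Data.Nat hiding (_≟_)
  open import Data.Nat.Properties hiding (_≟_)
  open import Data.Nat.Tactic.RingSolver using (solve-∀)
  open import Data.Product using (_×_; _,_; proj₁; proj₂; ∃-syntax; swap)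
  open import Data.Sum using (_⊎_; inj₁; inj₂; [_,_]′)
  open import Data.Vec using (lookup)
  open import Function using (_∘_)
  open import Relation.Binary.PropositionalEquality
  open import Relation.Nullary using (¬_; yes; no; Dec; contradiction)
  open import Relation.Nullary.Decidable using (¬?; _×-dec_; _⊎-dec_; map′)
  open import Relation.Unary using (Decidable)

  vertexList : ∀ {n} {P : Fin n → Set} → Decidable P → List (Fin n)
  vertexList {n} P? = filter P? (allFin n)

  module _ {n} {P : Fin n → Set} (P? : Decidable P) where

    ∈-vertexList⁺ : ∀ {v} → P v → v ∈ vertexList P?
    ∈-vertexList⁺ {v} p = ∈-filter⁺ P? (∈-allFin v) p

    ∈-vertexList⁻ : ∀ {v} → v ∈ vertexList P? → P v
    ∈-vertexList⁻ p = proj₂ (∈-filter⁻ P? {xs = allFin n} p)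

    unique-vertexList : Unique (vertexList P?)
    unique-vertexList = Unique.filter⁺ P? (Unique.allFin⁺ n)

    vertexList∈combos : vertexList P? ∈ combos (length (vertexList P?)) (allFin n)
    vertexList∈combos = ⊆⇒∈-combos (Sub.filter-⊆ P? (allFin n))

  unique-length-≤n : ∀ {n} {xs : List (Fin n)} → Unique xs → length xs ≤ n
  unique-length-≤n {n} {xs} u = subst (length xs ≤_) (length-tabulate {n = n} (λ i → i))
    (unique-length-≤ u λ _ → ∈-allFin _)

  -- `internal` lists each edge in one direction, and E contains it in at most two.
  internal-bound : ∀ {n} (G : Graph n) → Simple G → ∀ {T E} → Unique E →
    (∀ {a b} → (a , b) ∈ E → a ∈ T × b ∈ T × Adj G a b) →
    length E ≤ 2 * length (internal G T)
  internal-bound G simple {T} {E} u h = begin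
    length E                                ≤⟨ unique-length-≤ u cover ⟩
    length (I ++ map swap I)                ≡⟨ length-++ I ⟩
    length I + length (map swap I)          ≡⟨ cong (length I +_) (length-map swap I) ⟩
    length I + length I                     ≡⟨ cong (length I +_) (+-identityʳ (length I)) ⟨
    2 * length I                            ∎
    where
    open ≤-Reasoning
    I = internal G T
    inner? : ∀ e → Dec (Adj G (proj₁ e) (proj₂ e))
    inner? (a , b) = b ∈? lookup G a
    cover : ∀ {e} → e ∈ E → e ∈ I ++ map swap I
    cover {a , b} e∈ with h e∈
    ... | a∈ , b∈ , ab with ∈-upairs⁺ a∈ b∈ (λ { refl → proj₁ simple a ab })
    ...   | inj₁ p = ∈-++⁺ˡ (∈-filter⁺ inner? p ab)
    ...   | inj₂ p = ∈-++⁺ʳ I (∈-map⁺ swap (∈-filter⁺ inner? p (proj₂ simple a b ab)))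

  module _ {n} (G : Graph n) where

    data Within (u : Fin n) : ℕ → Fin n → Set where
      start : Within u zero u
      stay  : ∀ {k v} → Within u k v → Within u (suc k) v
      step  : ∀ {k w v} → Within u k w → Adj G w v → Within u (suc k) v

    within? : ∀ u k → Decidable (Within u k)
    within? u zero    v = map′ (λ { refl → start }) (λ { start → refl }) (u ≟ v)
    within? u (suc k) v = map′
      [ stay , (λ (w , p , e) → step p e) ]′
      (λ { (stay p) → inj₁ p ; (step p e) → inj₂ (_ , p , e) })
      (within? u k v ⊎-dec any? λ w → within? u k w ×-dec (v ∈? lookup G w))

    within-≤ : ∀ {u j k v} → j ≤ k → Within u j v → Within u k v
    within-≤ j≤k p = go (≤⇒≤′ j≤k) p
      where
      go : ∀ {u j k v} → j ≤′ k → Within u j v → Within u k v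
      go ≤′-refl     p = p
      go (≤′-step q) p = stay (go q p)

    within-trans : ∀ {u v w j k} → Within u j v → Within v k w → Within u (k + j) w
    within-trans p start      = p
    within-trans p (stay q)   = stay (within-trans p q)
    within-trans p (step q e) = step (within-trans p q) e

    within-sym : Simple G → ∀ {u v k} → Within u k v → Within v k u
    within-sym simple start = start
    within-sym simple (stay p) = stay (within-sym simple p)
    within-sym simple {u} {v} (step {k} p e) = subst (λ j → Within v j u) (+-comm k 1)
      (within-trans (step start (proj₂ simple _ _ e)) (within-sym simple p))

    ball : ℕ → Fin n → List (Fin n)
    ball k u = vertexList (within? u k)

    ClosedAt : Fin n → ℕ → Set
    ClosedAt u i = ∀ v → Within u (suc i) v → Within u i v

    closedAt⇒within : ∀ {u i} → ClosedAt u i → ∀ {k v} → Within u k v → Within u i v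
    closedAt⇒within c start      = within-≤ z≤n start
    closedAt⇒within c (stay p)   = closedAt⇒within c p
    closedAt⇒within c (step p e) = c _ (step (closedAt⇒within c p) e)

    module BFS (root : Fin n) (L : ℕ) where

      -- Searches downwards from k: the result is the least j with v within distance j, and k if v
      -- is not within distance k.
      depth-upTo : ℕ → Fin n → ℕ
      depth-upTo zero    v = 0
      depth-upTo (suc k) v with within? root k v
      ... | yes _ = depth-upTo k v
      ... | no  _ = suc k

      depth-upTo-≤ : ∀ k v → depth-upTo k v ≤ k
      depth-upTo-≤ zero    v = z≤n
      depth-upTo-≤ (suc k) v with within? root k v
      ... | yes _ = m≤n⇒m≤1+n (depth-upTo-≤ k v)
      ... | no  _ = ≤-refl

      within-depth : ∀ k {v} → Within root k v → Within root (depth-upTo k v) v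
      within-depth zero    p = p
      within-depth (suc k) {v} p with within? root k v
      ... | yes q = within-depth k q
      ... | no  _ = p

      depth-least : ∀ k {j v} → j ≤ k → Within root j v → depth-upTo k v ≤ j
      depth-least zero    j≤k p = z≤n
      depth-least (suc k) {j} {v} j≤k p with within? root k v | m≤n⇒m<n∨m≡n j≤k
      ... | yes q | inj₁ (s≤s j≤k′) = depth-least k j≤k′ p
      ... | yes q | inj₂ refl       = m≤n⇒m≤1+n (depth-upTo-≤ k v)
      ... | no ¬q | inj₁ (s≤s j≤k′) = contradiction (within-≤ j≤k′ p) ¬q
      ... | no ¬q | inj₂ refl       = ≤-refl

      depth : Fin n → ℕ
      depth = depth-upTo L

      private
        last : ∀ {k v} → Within root k v → Fin n
        last start          = root
        last (stay p)       = last p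
        last (step {w = w} _ _) = w

        -- At the exact distance k the last constructor cannot be `stay`, so a nontrivial walk ends
        -- with an edge from a vertex of smaller depth.
        last-spec : ∀ {k v} (p : Within root k v) → k ≤ L → (∀ {j} → Within root j v → k ≤ j) →
          v ≡ root ⊎ (Adj G (last p) v × Within root L (last p) × depth (last p) < k)
        last-spec start      _    _     = inj₁ refl
        last-spec (stay p)   _    least = contradiction (least p) (n≮n _)
        last-spec (step p e) k≤L _     =
          inj₂ (e , within-≤ (<⇒≤ k≤L) p , s≤s (depth-least L (<⇒≤ k≤L) p))

      parent : Fin n → Fin n
      parent v with within? root L v
      ... | yes p = last (within-depth L p)
      ... | no  _ = v

      parent-spec : ∀ {v} → Within root L v → v ≢ root →
        Adj G (parent v) v × Within root L (parent v) × depth (parent v) < depth v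
      parent-spec {v} p v≢root with within? root L v
      ... | no ¬p = contradiction p ¬p
      ... | yes q with last-spec (within-depth L q) (depth-upTo-≤ L v) least
        where
        least : ∀ {j} → Within root j v → depth v ≤ j
        least {j} p with ≤-total j L
        ... | inj₁ j≤L = depth-least L j≤L p
        ... | inj₂ L≤j = ≤-trans (depth-upTo-≤ L v) L≤j
      ...   | inj₁ e = contradiction e v≢root
      ...   | inj₂ s = s

      depth≤L : ∀ v → depth v ≤ L
      depth≤L = depth-upTo-≤ L

  -- 2 R + 1, where R = 4 ℓ is a radius at which every ball has more than n / M vertices. Enlarging
  -- a ball by this width makes room for such an R-ball disjoint from it.
  width-of : ℕ → ℕ
  width-of ℓ = suc (4 * ℓ + 4 * ℓ)

  radius-of : ℕ → ℕ → ℕ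
  radius-of M ℓ = M * width-of ℓ

  module Expansion {r n M : ℕ} .{{_ : NonZero M}} (3≤r : 3 ≤ r) (G : Graph n)
    (simple : Simple G) (regular : Regular G r)
    (sparse : ∀ {T : List (Fin n)} → T ∈ combos (length T) (allFin n) → 1 ≤ length T →
              M * length T ≤ n → 4 * length (internal G T) < 5 * length T) where

    private
      B : ℕ → Fin n → List (Fin n)
      B = ball G

      ∈B⁺ : ∀ {k u v} → Within G u k v → v ∈ B k u
      ∈B⁺ {k} {u} = ∈-vertexList⁺ (within? G u k)

      ∈B⁻ : ∀ {k u v} → v ∈ B k u → Within G u k v
      ∈B⁻ {k} {u} = ∈-vertexList⁻ (within? G u k)

      uniqueB : ∀ k u → Unique (B k u)
      uniqueB k u = unique-vertexList (within? G u k)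

      B-suc-⊆ : ∀ k u → length (B k u) ≤ length (B (suc k) u)
      B-suc-⊆ k u = unique-length-≤ (uniqueB k u) (∈B⁺ ∘ stay ∘ ∈B⁻ {k} {u})

      B-nonempty : ∀ k u → 1 ≤ length (B k u)
      B-nonempty k u = ∈-length (∈B⁺ {k} (within-≤ G {j = 0} z≤n start))

      -- At least 3 s ordered edges start in the ball of radius k, and all of them lie inside the
      -- next ball; hence 3 s ≤ 2 i, while sparseness of the next ball bounds i from above.
      expand : ∀ k u → M * length (B (suc k) u) ≤ n → 6 * length (B k u) < 5 * length (B (suc k) u)
      expand k u small = begin-strict
        6 * s              ≡⟨ h s ⟩
        2 * (s * 3)        ≤⟨ *-monoʳ-≤ 2 (*-monoʳ-≤ s 3≤r) ⟩
        2 * (s * r)        ≤⟨ *-monoʳ-≤ 2 (length-adjPairsAt-≥ G regular (B k u)) ⟩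
        2 * length (adjPairsAt G (B k u))
          ≤⟨ *-monoʳ-≤ 2 (internal-bound G simple (unique-adjPairsAt G (uniqueB k u)) inside′) ⟩
        2 * (2 * i)        ≡⟨ *-assoc 2 2 i ⟨
        4 * i              <⟨ sparse (vertexList∈combos (within? G u (suc k))) (B-nonempty (suc k) u) small ⟩
        5 * length (B (suc k) u) ∎
        where
        open ≤-Reasoning
        s = length (B k u)
        i = length (internal G (B (suc k) u))
        h : ∀ s → 6 * s ≡ 2 * (s * 3)
        h = solve-∀
        inside′ : ∀ {a b} → (a , b) ∈ adjPairsAt G (B k u) →
                  a ∈ B (suc k) u × b ∈ B (suc k) u × Adj G a b
        inside′ p = let (a∈ , e) = ∈-adjPairsAt⁻ G (B k u) p ; w = ∈B⁻ {k} {u} a∈ in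
          ∈B⁺ (stay w) , ∈B⁺ (step w e) , e

      growth : ∀ k u → M * length (B k u) ≤ n → 6 ^ k ≤ 5 ^ k * length (B k u)
      growth zero    u small = ≤-trans (B-nonempty 0 u) (≤-reflexive (sym (*-identityˡ _)))
      growth (suc k) u small = begin
        6 * 6 ^ k                        ≤⟨ *-monoʳ-≤ 6 (growth k u (≤-trans (*-monoʳ-≤ M (B-suc-⊆ k u)) small)) ⟩
        6 * (5 ^ k * length (B k u))     ≡⟨ h (5 ^ k) (length (B k u)) ⟩
        5 ^ k * (6 * length (B k u))     ≤⟨ *-monoʳ-≤ (5 ^ k) (<⇒≤ (expand k u small)) ⟩
        5 ^ k * (5 * length (B (suc k) u)) ≡⟨ h′ (5 ^ k) (length (B (suc k) u)) ⟩
        5 * 5 ^ k * length (B (suc k) u) ∎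
        where
        open ≤-Reasoning
        h : ∀ p b → 6 * (p * b) ≡ p * (6 * b)
        h = solve-∀
        h′ : ∀ p b → p * (5 * b) ≡ 5 * p * b
        h′ = solve-∀

    module _ (ℓ : ℕ) (n<2^ℓ : n < 2 ^ ℓ) where

      R : ℕ
      R = 4 * ℓ

      -- (6/5)⁴ > 2, so ℓ rounds of four expansion steps would exceed n.
      ball-large : ∀ u → n < M * length (B R u)
      ball-large u = ≰⇒> λ small → <⇒≱ n<2^ℓ (*-cancelˡ-≤ (5 ^ R) {{m^n≢0 5 R}} (begin
        5 ^ R * 2 ^ ℓ                  ≡⟨ cong (_* 2 ^ ℓ) (^-*-assoc 5 4 ℓ) ⟨
        (5 ^ 4) ^ ℓ * 2 ^ ℓ            ≡⟨ pow-* ℓ (5 ^ 4) 2 ⟨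
        (5 ^ 4 * 2) ^ ℓ                ≤⟨ ^-monoˡ-≤ ℓ (≤ᵇ⇒≤ (5 ^ 4 * 2) (6 ^ 4) _) ⟩
        (6 ^ 4) ^ ℓ                    ≡⟨ ^-*-assoc 6 4 ℓ ⟩
        6 ^ R                          ≤⟨ growth R u small ⟩
        5 ^ R * length (B R u)         ≤⟨ *-monoʳ-≤ (5 ^ R) (unique-length-≤n (uniqueB R u)) ⟩
        5 ^ R * n                      ∎))
        where
        open ≤-Reasoning
        pow-* : ∀ k m n → (m * n) ^ k ≡ m ^ k * n ^ k
        pow-* zero    m n = refl
        pow-* (suc k) m n = trans (cong (m * n *_) (pow-* k m n)) (h m n (m ^ k) (n ^ k))
          where
          h : ∀ m n a b → m * n * (a * b) ≡ m * a * (n * b)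
          h = solve-∀

      private
        width = width-of ℓ
        radius = radius-of M ℓ

        -- A vertex at distance exactly j * width + R + 1 has an R-ball
        -- disjoint from the ball of radius j * width.
        layers : ∀ u j → (∃[ i ] (i ≤ j * width × ClosedAt G u i)) ⊎ j * n < M * length (B (j * width) u)
        layers u zero = inj₂ (≤-trans (B-nonempty 0 u) (m≤n*m _ M))
        layers u (suc j) with layers u j
        ... | inj₁ (i , i≤ , c) = inj₁ (i , ≤-trans i≤ (m≤n+m _ width) , c)
        ... | inj₂ big with any? (λ v → within? G u (suc (R + j * width)) v ×-dec
                                        ¬? (within? G u (R + j * width) v))
        ...   | no none = inj₁ (R + j * width ,
                  +-monoˡ-≤ (j * width) (≤-trans (m≤m+n R R) (n≤1+n _)) , closed)
          where
          closed : ClosedAt G u (R + j * width)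
          closed v p with within? G u (R + j * width) v
          ... | yes q = q
          ... | no ¬q = contradiction (v , p , ¬q) none
        ...   | yes (v , p , ¬q) = inj₂ (begin-strict
            n + j * n
              <⟨ +-mono-< (ball-large v) big ⟩
            M * length (B R v) + M * length (B (j * width) u)
              ≡⟨ *-distribˡ-+ M (length (B R v)) _ ⟨
            M * (length (B R v) + length (B (j * width) u))
              ≡⟨ cong (M *_) (length-++ (B R v)) ⟨
            M * length (B R v ++ B (j * width) u)
              ≤⟨ *-monoʳ-≤ M (unique-length-≤
                   (Unique.++⁺ (uniqueB R v) (uniqueB (j * width) u) disjoint) cover) ⟩
            M * length (B (suc j * width) u) ∎)
          where
          open ≤-Reasoning
          disjoint : ∀ {w} → ¬ (w ∈ B R v × w ∈ B (j * width) u)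
          disjoint (a , b) = ¬q (within-trans G (∈B⁻ {j * width} {u} b) (within-sym G simple (∈B⁻ {R} {v} a)))
          cover : ∀ {w} → w ∈ B R v ++ B (j * width) u → w ∈ B (suc j * width) u
          cover w∈ with ∈-++⁻ (B R v) w∈
          ... | inj₁ a = ∈B⁺ (within-≤ G (≤-reflexive (h R (j * width))) (within-trans G p (∈B⁻ {R} {v} a)))
            where
            h : ∀ R x → R + suc (R + x) ≡ suc (R + R) + x
            h = solve-∀
          ... | inj₂ b = ∈B⁺ (within-≤ G (m≤n+m _ width) (∈B⁻ {j * width} {u} b))

      -- At j = M the second alternative of `layers` asks for more than n vertices, so the ball must
      -- have stopped growing before.
      ball-closed : ∀ {u k v} → Within G u k v → Within G u radius v
      ball-closed {u} p with layers u M
      ... | inj₁ (i , i≤ , c) = within-≤ G i≤ (closedAt⇒within G c p)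
      ... | inj₂ big = contradiction
        (*-monoʳ-≤ M (unique-length-≤n (uniqueB radius u))) (<⇒≱ big)

      component-large : ∀ u → n < M * length (B radius u)
      component-large u = ≤-trans (ball-large u) (*-monoʳ-≤ M
        (unique-length-≤ (uniqueB R u) (∈B⁺ ∘ ball-closed ∘ ∈B⁻ {R} {u})))

-- Sparse disconnected graphs are rare.

module Components where

  open Counting
  open Switching
  open FirstMoment
  open Density
  open Growth
  open import Data.Fin using (Fin; _≟_)
  open import Data.Fin.Properties using (any?)
  open import Data.Fin.Subset.Properties using (_∈?_)
  open import Data.List using (List; []; _∷_; _++_; map; length; filter; concatMap; allFin; cartesianProduct)
  open import Data.List.Properties using (length-map; length-++; length-tabulate)
  open import Data.List.Membership.Propositional using (_∈_)
  open import Data.List.Membership.Propositional.Properties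
  open import Data.List.Relation.Unary.Any using (here; there)
  open import Data.List.Relation.Unary.Unique.Propositional using (Unique)
  import Data.List.Relation.Unary.Unique.Propositional.Properties as Unique
  open import Data.Nat hiding (_≟_)
  open import Data.Nat.Properties hiding (_≟_)
  open import Data.Nat.Tactic.RingSolver using (solve-∀)
  open import Data.Product using (_×_; _,_; proj₁; proj₂; ∃-syntax)
  open import Data.Sum using (_⊎_; inj₁; inj₂; [_,_]′)
  open import Data.Vec using (lookup)
  open import Function using (_∘_)
  open import Relation.Binary.PropositionalEquality
  open import Relation.Nullary using (¬_; yes; no; Dec; contradiction)
  open import Relation.Nullary.Decidable using (¬?; _×-dec_; _⊎-dec_; map′)
  open import Relation.Unary using (Decidable)

  -- The relation is arbitrary because walks are needed in the switched graph with the edge ux left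
  -- out.
  module _ {n} {H : Fin n → Fin n → Set} where

    data Reach : ℕ → Fin n → Fin n → Set where
      done : ∀ {k a} → Reach k a a
      _∷_  : ∀ {k a b c} → H a b → Reach k b c → Reach (suc k) a c

    reach? : (∀ a b → Dec (H a b)) → ∀ k a c → Dec (Reach k a c)
    reach? H? zero    a c = map′ (λ { refl → done }) (λ { done → refl }) (a ≟ c)
    reach? H? (suc k) a c = map′
      [ (λ { refl → done }) , (λ (_ , h , w) → h ∷ w) ]′
      (λ { done → inj₁ refl ; (h ∷ w) → inj₂ (_ , h , w) })
      ((a ≟ c) ⊎-dec any? λ b → H? a b ×-dec reach? H? k b c)

    reach-≤ : ∀ {j k a c} → j ≤ k → Reach j a c → Reach k a c
    reach-≤ j≤k       done    = done
    reach-≤ (s≤s j≤k) (h ∷ w) = h ∷ reach-≤ j≤k w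

    reach-trans : ∀ {j k a b c} → Reach j a b → Reach k b c → Reach (j + k) a c
    reach-trans {j} {k} done    w = reach-≤ (m≤n+m k j) w
    reach-trans         (h ∷ v) w = h ∷ reach-trans v w

    reach-sym : (∀ {a b} → H a b → H b a) → ∀ {k a c} → Reach k a c → Reach k c a
    reach-sym sy done = done
    reach-sym sy {suc k} {a} {c} (h ∷ w) = subst (λ j → Reach j c a) (+-comm k 1)
      (reach-trans (reach-sym sy w) (sy h ∷ done))

    steps : ∀ {k a c} → Reach k a c → List (Fin n × Fin n)
    steps done                      = []
    steps (_∷_ {a = a} {b = b} _ w) = (a , b) ∷ steps w

    length-steps : ∀ {k a c} (w : Reach k a c) → length (steps w) ≤ k
    length-steps done    = z≤n
    length-steps (_ ∷ w) = s≤s (length-steps w)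

    crossing : {P : Fin n → Set} → Decidable P → ∀ {k a c} (w : Reach k a c) → P a → ¬ P c →
               ∃[ p ] ∃[ q ] ((p , q) ∈ steps w × H p q × P p × ¬ P q)
    crossing P? done    pa ¬pc = contradiction pa ¬pc
    crossing P? (_∷_ {a = a} {b = b} h w) pa ¬pc with P? b
    ... | no ¬pb = a , b , here refl , h , pa , ¬pb
    ... | yes pb = let (p , q , pq∈ , rest) = crossing P? w pb ¬pc in p , q , there pq∈ , rest

  AdjMinus : ∀ {n} → Graph n → (u x a b : Fin n) → Set
  AdjMinus G u x a b = Adj G a b × ¬ Pair u x a b

  adjMinus? : ∀ {n} (G : Graph n) u x a b → Dec (AdjMinus G u x a b)
  adjMinus? G u x a b = (b ∈? lookup G a) ×-dec ¬? (Pair? u x a b)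

  module _ {n} (K : ℕ) (G : Graph n) (u x : Fin n) where

    -- The walk is chosen by a decision procedure from the given graph and ux alone. Applied to a
    -- switched graph, it lets vy be found among at most K steps, which is what makes the switching
    -- cheap to undo.
    route : List (Fin n × Fin n)
    route with reach? (adjMinus? G u x) K u x
    ... | yes w = steps w
    ... | no  _ = []

    length-route : length route ≤ K
    length-route with reach? (adjMinus? G u x) K u x
    ... | yes w = length-steps w
    ... | no  _ = z≤n

    route-crossing : {P : Fin n → Set} → Decidable P → Reach {H = AdjMinus G u x} K u x →
      P u → ¬ P x → ∃[ p ] ∃[ q ] ((p , q) ∈ route × AdjMinus G u x p q × P p × ¬ P q)
    route-crossing P? w′ with reach? (adjMinus? G u x) K u x
    ... | yes w = crossing P? w
    ... | no ¬w = contradiction w′ ¬w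

  length-cartesianProduct : {A B : Set} (xs : List A) (ys : List B) →
    length (cartesianProduct xs ys) ≡ length xs * length ys
  length-cartesianProduct []       ys = refl
  length-cartesianProduct (x ∷ xs) ys = trans (length-++ (map (x ,_) ys))
    (cong₂ _+_ (length-map (x ,_) ys) (length-cartesianProduct xs ys))

  module _ {n} (G : Graph n) (L : ℕ) where

    NonTree : Fin n → Fin n × Fin n → Set
    NonTree ρ (u , v) = v ≢ BFS.parent G ρ L u × u ≢ BFS.parent G ρ L v

    nonTree? : ∀ ρ → Decidable (NonTree ρ)
    nonTree? ρ (u , v) = ¬? (v ≟ BFS.parent G ρ L u) ×-dec ¬? (u ≟ BFS.parent G ρ L v)

    nonTreePairs : Fin n → List (Fin n × Fin n)
    nonTreePairs ρ = filter (nonTree? ρ) (adjPairsAt G (ball G L ρ))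

    module _ {ρ : Fin n} (closed : ∀ {k v} → Within G ρ k v → Within G ρ L v) where

      ∈-nonTreePairs⁻ : ∀ {u v} → (u , v) ∈ nonTreePairs ρ →
        Within G ρ L u × Within G ρ L v × Adj G u v × NonTree ρ (u , v)
      ∈-nonTreePairs⁻ p =
        let (q , nt) = ∈-filter⁻ (nonTree? ρ) {xs = adjPairsAt G (ball G L ρ)} p
            (u∈ , e) = ∈-adjPairsAt⁻ G (ball G L ρ) q
            w = ∈-vertexList⁻ (within? G ρ L) u∈
        in w , closed (step w e) , e , nt

      -- Of the at least 3 s ordered edges of the component, at most 2 s join a vertex to its parent
      -- in either direction.
      length-nonTreePairs : ∀ {r} → 3 ≤ r → Regular G r → length (ball G L ρ) ≤ length (nonTreePairs ρ)
      length-nonTreePairs {r} 3≤r regular = +-cancelʳ-≤ (s + s) s (length (nonTreePairs ρ)) (begin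
        s + (s + s)              ≡⟨ h s ⟩
        s * 3                    ≤⟨ *-monoʳ-≤ s 3≤r ⟩
        s * r                    ≤⟨ length-adjPairsAt-≥ G regular S ⟩
        length (adjPairsAt G S)
          ≤⟨ unique-length-≤ (unique-adjPairsAt G (unique-vertexList (within? G ρ L))) cover ⟩
        length (nonTreePairs ρ ++ (up ++ down))
          ≡⟨ length-++ (nonTreePairs ρ) ⟩
        length (nonTreePairs ρ) + length (up ++ down)
          ≡⟨ cong (length (nonTreePairs ρ) +_) (trans (length-++ up) (cong₂ _+_ (length-map _ S) (length-map _ S))) ⟩
        length (nonTreePairs ρ) + (s + s) ∎)
        where
        open ≤-Reasoning
        S = ball G L ρ
        s = length S
        π = BFS.parent G ρ L
        up = map (λ u → u , π u) S
        down = map (λ v → π v , v) S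
        h : ∀ s → s + (s + s) ≡ s * 3
        h = solve-∀
        cover : ∀ {e} → e ∈ adjPairsAt G S → e ∈ nonTreePairs ρ ++ (up ++ down)
        cover {u , v} e∈ with v ≟ π u | u ≟ π v | ∈-adjPairsAt⁻ G S e∈
        ... | yes refl | _ | u∈ , _ = ∈-++⁺ʳ (nonTreePairs ρ) (∈-++⁺ˡ (∈-map⁺ (λ u → u , π u) u∈))
        ... | no _ | yes refl | u∈ , e = ∈-++⁺ʳ (nonTreePairs ρ) (∈-++⁺ʳ up
                (∈-map⁺ (λ v → π v , v) (∈-vertexList⁺ (within? G ρ L)
                  (closed (step (∈-vertexList⁻ (within? G ρ L) u∈) e)))))
        ... | no p | no q | _ = ∈-++⁺ˡ (∈-filter⁺ (nonTree? ρ) e∈ (p , q))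

      tree-reach : {H : Fin n → Fin n → Set} →
        (∀ {w} → Within G ρ L w → w ≢ ρ → H w (BFS.parent G ρ L w)) →
        ∀ {w} → Within G ρ L w → Reach {H = H} L w ρ
      tree-reach {H} h {w} p = go L p (BFS.depth≤L G ρ L w)
        where
        go : ∀ k {w} → Within G ρ L w → BFS.depth G ρ L w ≤ k → Reach {H = H} k w ρ
        go k {w} p d≤k with w ≟ ρ
        ... | yes refl = done
        go zero    p d≤k | no w≢ρ = contradiction
          (≤-trans (proj₂ (proj₂ (BFS.parent-spec G ρ L p w≢ρ))) d≤k) n≮0
        go (suc k) p d≤k | no w≢ρ = let (_ , q , lt) = BFS.parent-spec G ρ L p w≢ρ in
          h p w≢ρ ∷ go k q (≤-pred (≤-trans lt d≤k))

  -- From u through ρ to v, across vy, and from y through σ to x: four tree paths of length at most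
  -- L and one edge.
  detour : ℕ → ℕ
  detour L = L + (L + suc (L + L))

  module Disconnected {n} (G : Graph n) (simple : Simple G) (L : ℕ)
    (closed : ∀ {u k v} → Within G u k v → Within G u L v)
    (ρ σ : Fin n) (¬ρσ : ¬ Within G ρ L σ) where

    private
      symG : ∀ {a b} → Adj G a b → Adj G b a
      symG = proj₂ simple _ _

      disjoint : ∀ {w} → Within G σ L w → ¬ Within G ρ L w
      disjoint p q = ¬ρσ (closed (within-trans G q (within-sym G simple p)))

      ≢-comp : ∀ {a b} → Within G ρ L a → Within G σ L b → a ≢ b
      ≢-comp p q refl = disjoint q p

      ¬adj : ∀ {a b} → Within G ρ L a → Within G σ L b → ¬ Adj G a b
      ¬adj p q e = disjoint q (closed (step p e))

    module _ {u v x y} (uv∈ : (u , v) ∈ nonTreePairs G L ρ) (xy∈ : (x , y) ∈ nonTreePairs G L σ) where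

      private
        uv = ∈-nonTreePairs⁻ G L closed uv∈
        xy = ∈-nonTreePairs⁻ G L closed xy∈
        u∈ = proj₁ uv
        v∈ = proj₁ (proj₂ uv)
        x∈ = proj₁ xy
        y∈ = proj₁ (proj₂ xy)

      switchable : Switchable G u v x y
      switchable = record
        { uv = proj₁ (proj₂ (proj₂ uv)) ; xy = proj₁ (proj₂ (proj₂ xy))
        ; u≢x = ≢-comp u∈ x∈ ; v≢x = ≢-comp v∈ x∈
        ; u≢y = ≢-comp u∈ y∈ ; v≢y = ≢-comp v∈ y∈
        ; ¬ux = ¬adj u∈ x∈ ; ¬vy = ¬adj v∈ y∈ }

      private
        G′ = switch G u v x y
        H = AdjMinus G′ u x

        H-sym : ∀ {a b} → H a b → H b a
        H-sym (e , ¬p) = proj₂ (switch-simple simple switchable) _ _ e , ¬p ∘ Pair-sym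

        -- The tree edges survive, since the switching removes only the non-tree edges uv and xy;
        -- and ux is not among them, as it joins different components of the old graph.
        ρ-tree : ∀ {w} → Within G ρ L w → w ≢ ρ → H w (BFS.parent G ρ L w)
        ρ-tree {w} p w≢ρ = let (e , q , _) = BFS.parent-spec G ρ L p w≢ρ
                               (_ , _ , _ , nt₁ , nt₂) = uv in
          Adj-switch-old simple switchable (symG e)
            [ (λ { (refl , e′) → nt₁ (sym e′) }) , (λ { (refl , e′) → nt₂ (sym e′) }) ]′
            [ (λ { (refl , _) → ≢-comp p x∈ refl }) , (λ { (refl , _) → ≢-comp p y∈ refl }) ]′
          , [ (λ (_ , e′) → ≢-comp q x∈ e′) , (λ (e′ , _) → ≢-comp p x∈ e′) ]′

        σ-tree : ∀ {w} → Within G σ L w → w ≢ σ → H w (BFS.parent G σ L w)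
        σ-tree {w} p w≢σ = let (e , q , _) = BFS.parent-spec G σ L p w≢σ
                               (_ , _ , _ , nt₁ , nt₂) = xy in
          Adj-switch-old simple switchable (symG e)
            [ (λ { (refl , _) → ≢-comp u∈ p refl }) , (λ { (refl , _) → ≢-comp v∈ p refl }) ]′
            [ (λ { (refl , e′) → nt₁ (sym e′) }) , (λ { (refl , e′) → nt₂ (sym e′) }) ]′
          , [ (λ (e′ , _) → ≢-comp u∈ p (sym e′)) , (λ (_ , e′) → ≢-comp u∈ q (sym e′)) ]′

        vy : H v y
        vy = Adj-switch-vy simple switchable (inj₁ (refl , refl)) ,
          [ (λ { (_ , refl) → proj₁ simple x (proj₁ (proj₂ (proj₂ xy))) }) ,
            (λ (e′ , _) → ≢-comp v∈ x∈ e′) ]′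

        u⇝x : Reach {H = H} (detour L) u x
        u⇝x = reach-trans (tree-reach G L closed ρ-tree u∈)
             (reach-trans (reach-sym H-sym (tree-reach G L closed ρ-tree v∈))
             (vy ∷ reach-trans (tree-reach G L closed σ-tree y∈)
                               (reach-sym H-sym (tree-reach G L closed σ-tree x∈))))

      -- In G′ the component of ρ is left only through ux and vy.
      vy∈route : (v , y) ∈ route (detour L) G′ u x
      vy∈route with route-crossing (detour L) G′ u x (within? G ρ L) u⇝x u∈ (disjoint x∈)
      ... | p , q , pq∈ , (e , ¬ux) , Pp , ¬Pq with Adj-switch⁻ simple switchable e
      ...   | inj₁ ux = contradiction ux ¬ux
      ...   | inj₂ (inj₁ (inj₁ (refl , refl))) = pq∈
      ...   | inj₂ (inj₁ (inj₂ (refl , refl))) = contradiction Pp (disjoint y∈)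
      ...   | inj₂ (inj₂ (e′ , _)) = contradiction (closed (step Pp e′)) ¬Pq

  module _ {r n : ℕ} .{{_ : NonZero r}} .{{_ : NonZero n}} (3≤r : 3 ≤ r) (ℓ : ℕ) (n<2^ℓ : n < 2 ^ ℓ) (ρ : Fin n) where

    private
      M = threshold r
      instance threshold-nonZero = threshold≢0 r
      L = radius-of M ℓ
      K = detour L
      N = length (regularGraphs r n)

    Unreached : Graph n → Set
    Unreached G = ∃[ v ] ¬ Within G ρ L v

    unreached? : Decidable Unreached
    unreached? G = any? λ v → ¬? (within? G ρ L v)

    Split : Graph n → Set
    Split G = ¬ Dense r G × Unreached G

    split? : Decidable Split
    split? G = ¬? (dense? r G) ×-dec unreached? G

    private
      bad : List (Graph n)
      bad = filter split? (regularGraphs r n)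

      -- A vertex outside the component of ρ; the default ρ is never taken on graphs in `bad`.
      second : Graph n → Fin n
      second G with unreached? G
      ... | yes (v , _) = v
      ... | no  _       = ρ

      second-unreached : ∀ G → Unreached G → ¬ Within G ρ L (second G)
      second-unreached G un with unreached? G
      ... | yes (_ , ¬p) = ¬p
      ... | no  ¬un      = contradiction un ¬un

      module Bad {G} (G∈ : G ∈ bad) where
        G∈r = proj₁ (∈-filter⁻ split? {xs = regularGraphs r n} G∈)
        split = proj₂ (∈-filter⁻ split? {xs = regularGraphs r n} G∈)
        simple = proj₁ (∈-regular⁻ G∈r)
        regular = proj₂ (∈-regular⁻ G∈r)
        open Expansion {r} {n} {M} 3≤r G simple regular (¬dense r {n} {G} (proj₁ split)) public
        open Disconnected G simple L (ball-closed ℓ n<2^ℓ) ρ (second G) (second-unreached G (proj₂ split)) public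

        nonTree-large : ∀ τ → n ≤ M * length (nonTreePairs G L τ)
        nonTree-large τ = ≤-trans (<⇒≤ (component-large ℓ n<2^ℓ τ)) (*-monoʳ-≤ M
          (length-nonTreePairs G L (ball-closed ℓ n<2^ℓ) 3≤r regular))

      moves : Graph n → List ((Fin n × Fin n) × (Fin n × Fin n))
      moves G = cartesianProduct (nonTreePairs G L ρ) (nonTreePairs G L (second G))

      Label : Set
      Label = Graph n × (Fin n × Fin n) × (Fin n × Fin n)

      move : Graph n → (Fin n × Fin n) × (Fin n × Fin n) → Label
      move G ((u , v) , (x , y)) = switch G u v x y , (u , x) , (v , y)

      target : List Label
      target = concatMap (λ G → concatMap
        (λ (u , x) → map (λ vy → G , (u , x) , vy) (route K G u x)) (adjPairs G)) (regularGraphs r n)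

      unique-moves : ∀ G → Unique (moves G)
      unique-moves G = Unique.cartesianProduct⁺ (uniq ρ) (uniq (second G))
        where
        uniq : ∀ τ → Unique (nonTreePairs G L τ)
        uniq τ = Unique.filter⁺ (nonTree? G L τ) (unique-adjPairsAt G (unique-vertexList (within? G τ L)))

      length-moves : ∀ {G} → G ∈ bad → n * n ≤ M * M * length (moves G)
      length-moves {G} G∈ = begin
        n * n                            ≤⟨ *-mono-≤ (nonTree-large ρ) (nonTree-large (second G)) ⟩
        (M * a) * (M * b)                ≡⟨ h M a b ⟩
        M * M * (a * b)
          ≡⟨ cong (M * M *_) (length-cartesianProduct (nonTreePairs G L ρ) (nonTreePairs G L (second G))) ⟨
        M * M * length (moves G)         ∎
        where
        open ≤-Reasoning
        open Bad G∈
        a = length (nonTreePairs G L ρ)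
        b = length (nonTreePairs G L (second G))
        h : ∀ M a b → (M * a) * (M * b) ≡ M * M * (a * b)
        h = solve-∀

      move∈ : ∀ {G m} → G ∈ bad → m ∈ moves G → move G m ∈ target
      move∈ {G} {(u , v) , (x , y)} G∈ m∈ =
        let (uv∈ , xy∈) = ∈-cartesianProduct⁻ (nonTreePairs G L ρ) (nonTreePairs G L (second G)) m∈
            s = Bad.switchable G∈ uv∈ xy∈
        in ∈-concatMap _ (switch-∈ (Bad.G∈r G∈) s)
            (∈-concatMap _ (∈-adjPairsAt⁺ (switch G u v x y) (∈-allFin u)
                              (Adj-switch-ux (Bad.simple G∈) s (inj₁ (refl , refl))))
              (∈-map⁺ _ (Bad.vy∈route G∈ uv∈ xy∈)))

      move-injective : ∀ {G m G₂ m₂} → G ∈ bad → m ∈ moves G → G₂ ∈ bad → m₂ ∈ moves G₂ →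
        move G m ≡ move G₂ m₂ → G ≡ G₂ × m ≡ m₂
      move-injective {G} {(u , v) , (x , y)} {G₂} {(u₂ , v₂) , (x₂ , y₂)} G∈ m∈ G₂∈ m₂∈ eq
        with cong proj₂ eq
      ... | refl = trans (sym (back G∈ m∈))
                     (trans (cong (λ H → switch H u x v y) (cong proj₁ eq)) (back G₂∈ m₂∈)) , refl
        where
        back : ∀ {H} → H ∈ bad → ((u , v) , (x , y)) ∈ moves H → switch (switch H u v x y) u x v y ≡ H
        back {H} H∈ p = let (uv∈ , xy∈) = ∈-cartesianProduct⁻ (nonTreePairs H L ρ) _ p in
          switch-inverse (Bad.simple H∈) (Bad.switchable H∈ uv∈ xy∈)

      length-target : length target ≤ N * (n * r * K)
      length-target = length-concatMap-≤ _ _ (regularGraphs r n) λ {G} G∈ →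
        ≤-trans (length-concatMap-≤ _ K (adjPairs G) λ {(u , x)} _ →
                  ≤-trans (≤-reflexive (length-map _ (route K G u x))) (length-route K G u x))
          (*-monoˡ-≤ K (≤-trans (length-adjPairsAt-≤ G (proj₂ (∈-regular⁻ G∈)) (allFin n))
            (≤-reflexive (cong (_* r) (length-tabulate {n = n} (λ i → i))))))

    -- The two components have at least n / M ordered non-tree edges each, so a split graph has at
    -- least (n/M)² switchings. Against n r K labels per regular graph this leaves probability at
    -- most M² r K / n.
    split-rare : length (filter split? (regularGraphs r n)) * n ≤ M * M * (N * (r * K))
    split-rare = *-cancelʳ-≤ _ _ n (begin
      length bad * n * n            ≡⟨ *-assoc (length bad) n n ⟩
      length bad * (n * n)
        ≤⟨ moves-bound moves move (M * M) (n * n)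
             (Unique.filter⁺ split? (regularGraphs-unique r n))
             (λ {G} _ → unique-moves G) length-moves move∈ move-injective ⟩
      M * M * length target         ≤⟨ *-monoʳ-≤ (M * M) length-target ⟩
      M * M * (N * (n * r * K))     ≡⟨ h (M * M) N n r K ⟩
      M * M * (N * (r * K)) * n     ∎)
      where
      open ≤-Reasoning
      h : ∀ a N n r K → a * (N * (n * r * K)) ≡ a * (N * (r * K)) * n
      h = solve-∀

-- Rainbow colouring in stages along a breadth-first tree.

module Rainbow where

  open Counting
  open Growth
  open import Data.Bool using (Bool; true; false; not)
  open import Data.Bool.Properties using (not-involutive) renaming (_≟_ to _≟ᵇ_)
  open import Data.Empty using (⊥)
  open import Data.Fin using (Fin; zero; suc; _≟_; toℕ; fromℕ<; join; splitAt)
  open import Data.Fin.Properties using (any?; nonZeroIndex; toℕ-fromℕ<; splitAt-join)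
  open import Data.Fin.Subset.Properties using (_∈?_)
  open import Data.List using (List; []; _∷_; _++_; map; length; concatMap; allFin)
  open import Data.List.Membership.Propositional using (_∈_; _∉_)
  open import Data.List.Membership.Propositional.Properties
  open import Data.List.Relation.Unary.All as All using (All; []; _∷_)
  import Data.List.Relation.Unary.All.Properties as All
  open import Data.List.Relation.Unary.AllPairs using ([]; _∷_)
  open import Data.List.Relation.Unary.Any using (here; there)
  open import Data.List.Relation.Unary.Unique.Propositional using (Unique)
  import Data.List.Relation.Unary.Unique.Propositional.Properties as Unique
  open import Data.Maybe using (Maybe; just; nothing; fromMaybe)
  open import Data.Maybe.Properties using (just-injective)
  open import Data.Nat hiding (_≟_)
  open import Data.Nat.Properties hiding (_≟_)
  open import Data.Product using (_×_; _,_; proj₁; proj₂; ∃-syntax)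
  open import Data.Sum using (_⊎_; inj₁; inj₂; [_,_]′)
  open import Data.Sum.Properties using (inj₁-injective; inj₂-injective)
  open import Data.Unit using (⊤)
  open import Data.Vec using (lookup)
  open import Function using (_∘_; id)
  open import Relation.Binary.PropositionalEquality
  open import Relation.Nullary using (¬_; yes; no; Dec; contradiction)
  open import Relation.Nullary.Decidable using (¬?; _×-dec_; _⊎-dec_; map′; toSum)
  open import Relation.Unary using (Decidable)

  module _ {n} {R : Fin n → Fin n → Set} (R? : ∀ x y → Dec (R x y))
           (R-sym : ∀ {x y} → R x y → R y x) (R-irr : ∀ {x} → ¬ R x x) where

    private
      Balanced : (Fin n → Maybe Bool) → Set
      Balanced T = ∀ {x b} → T x ≡ just b → ∃[ y ] (R x y × T y ≡ just (not b))

      Defined : (Fin n → Maybe Bool) → Fin n → Set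
      Defined T x = ∃[ b ] T x ≡ just b

      _[_↦_] : (Fin n → Maybe Bool) → Fin n → Bool → Fin n → Maybe Bool
      (T [ x ↦ b ]) y with y ≟ x
      ... | yes _ = just b
      ... | no  _ = T y

      at : ∀ T x b → (T [ x ↦ b ]) x ≡ just b
      at T x b with x ≟ x
      ... | yes _ = refl
      ... | no ne = contradiction refl ne

      keep : ∀ T x b {y c} → T x ≡ nothing → T y ≡ just c → (T [ x ↦ b ]) y ≡ just c
      keep T x b {y} Tx Ty with y ≟ x
      ... | no _ = Ty
      ... | yes refl with () ← trans (sym Tx) Ty

      other : ∀ T x b {y} → y ≢ x → (T [ x ↦ b ]) y ≡ T y
      other T x b {y} ne with y ≟ x
      ... | yes e = contradiction e ne
      ... | no _ = refl

      extend : ∀ T x b {y} → Balanced T → T x ≡ nothing → R x y → T y ≡ just (not b) →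
               Balanced (T [ x ↦ b ])
      extend T x b {y} bal Tx xy Ty {z} eq with z ≟ x
      ... | yes refl = y , xy , trans (keep T x b Tx Ty) (cong (just ∘ not) (just-injective eq))
      ... | no _     = let (w , zw , Tw) = bal eq in w , zw , keep T x b Tx Tw

      extend₂ : ∀ T x {y} → Balanced T → T x ≡ nothing → T y ≡ nothing → R x y →
                Balanced ((T [ x ↦ true ]) [ y ↦ false ])
      extend₂ T x {y} bal Tx Ty xy {z} eq with z ≟ y
      ... | yes refl = x , R-sym xy ,
              trans (keep (T [ x ↦ true ]) y false {x} Ty′ (at T x true)) (cong (just ∘ not) (just-injective eq))
        where
        y≢x : y ≢ x
        y≢x refl = R-irr xy
        Ty′ = trans (other T x true y≢x) Ty
      ... | no _ with z ≟ x
      ...   | yes refl = y , xy , trans (at (T [ x ↦ true ]) y false) (cong (just ∘ not) (just-injective eq))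
      ...   | no _     = let (w , zw , Tw) = bal eq in
                w , zw , keep (T [ x ↦ true ]) y false {w} (trans (other T x true (λ { refl → R-irr xy })) Ty)
                           (keep T x true {w} Tx Tw)

      -- A greedy colouring that never changes a colour, so an opposite neighbour, once present,
      -- stays. An uncoloured x takes the colour opposite to that of some neighbour; if that
      -- neighbour is uncoloured too, both are coloured together.
      process : (xs : List (Fin n)) →
        ∃[ T ] (Balanced T × (∀ {x y} → x ∈ xs → R x y → Defined T x))
      process [] = (λ _ → nothing) , (λ ()) , λ ()
      process (x ∷ xs) with process xs
      ... | T , bal , def with T x in Tx | any? (R? x)
      ...   | just b  | _ = T , bal , λ { (here refl) _ → b , Tx ; (there p) r → def p r }
      ...   | nothing | no none = T , bal ,
                λ { (here refl) r → contradiction (_ , r) none ; (there p) r → def p r }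
      ...   | nothing | yes (y , xy) with T y in Ty
      ...     | just b = T [ x ↦ not b ] ,
                  extend T x (not b) bal Tx xy (trans Ty (cong just (sym (not-involutive b)))) ,
                  λ { (here refl) _ → not b , at T x (not b)
                    ; (there p) r → let (c , e) = def p r in c , keep T x (not b) Tx e }
      ...     | nothing = (T [ x ↦ true ]) [ y ↦ false ] , extend₂ T x bal Tx Ty xy ,
                  λ { (here refl) _ → true , keep (T [ x ↦ true ]) y false {x} Ty′ (at T x true)
                    ; {z} (there p) r → let (c , e) = def p r in
                        c , keep (T [ x ↦ true ]) y false {z} Ty′ (keep T x true Tx e) }
        where
        Ty′ : (T [ x ↦ true ]) y ≡ nothing
        Ty′ = trans (other T x true (λ { refl → R-irr xy })) Ty

    balanced-colouring : ∃[ τ ] (∀ {x y : Fin n} → R x y → ∃[ z ] (R x z × τ z ≡ not (τ x)))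
    balanced-colouring with process (allFin n)
    -- The default `true` goes to vertices left uncoloured, which have no neighbour.
    ... | T , bal , def = (λ x → fromMaybe true (T x)) , λ {x} r →
      let (b , e) = def (∈-allFin x) r
          (z , xz , e′) = bal e
      in z , xz , trans (cong (fromMaybe true) e′) (cong (not ∘ fromMaybe true) (sym e))

  module _ {n} (G : Graph n) {C : Set} (In : Fin n → Set) (col : Fin n → Fin n → C) where

    -- `In` keeps the walk inside the current set; this is what lets old colours be carried over to
    -- the next stage.
    data RWalk : Fin n → Fin n → List C → Set where
      stop : ∀ {v} → RWalk v v []
      go   : ∀ {u v w cs} → Adj G u v → In u → In v → RWalk v w cs → RWalk u w (col u v ∷ cs)

    -- The predicate `P` confines the colours, so that walks are joined by checking two predicates
    -- for disjointness instead of comparing colour lists.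
    Rainbow : (C → Set) → Fin n → Fin n → Set
    Rainbow P u w = ∃[ cs ] (RWalk u w cs × Unique cs × All P cs)

    walk-++ : ∀ {u v w cs ds} → RWalk u v cs → RWalk v w ds → RWalk u w (cs ++ ds)
    walk-++ stop         w = w
    walk-++ (go e p q v) w = go e p q (walk-++ v w)

    rb-refl : ∀ {P v} → Rainbow P v v
    rb-refl = [] , stop , [] , []

    rb-edge : ∀ {P : C → Set} {u v} → Adj G u v → In u → In v → P (col u v) → Rainbow P u v
    rb-edge e p q c = _ , go e p q stop , [] ∷ [] , c ∷ []

    rb-mono : ∀ {P Q : C → Set} {u v} → (∀ {c} → P c → Q c) → Rainbow P u v → Rainbow Q u v
    rb-mono f (cs , w , un , all) = cs , w , un , All.map f all

    rb-trans : ∀ {P Q : C → Set} {u v w} → (∀ {c} → P c → ¬ Q c) →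
               Rainbow P u v → Rainbow Q v w → Rainbow (λ c → P c ⊎ Q c) u w
    rb-trans dis (cs , v , un , all) (ds , w , un′ , all′) =
      cs ++ ds , walk-++ v w ,
      Unique.++⁺ un un′ (λ (p , q) → dis (All.lookup all p) (All.lookup all′ q)) ,
      All.++⁺ (All.map inj₁ all) (All.map inj₂ all′)

    module _ (simple : Simple G) (col-sym : ∀ u v → col u v ≡ col v u) where

      private
        reverse : ∀ {u v cs} → RWalk u v cs → Unique cs →
                  ∃[ ds ] (RWalk v u ds × Unique ds × (∀ {c} → c ∈ ds → c ∈ cs))
        reverse stop _ = [] , stop , [] , λ ()
        reverse (go {u} {v} e p q w) (c∉ ∷ un) with reverse w un
        ... | ds , w′ , un′ , sub =
          ds ++ col u v ∷ [] ,
          walk-++ w′ (subst (λ c → RWalk v u (c ∷ [])) (col-sym v u) (go (proj₂ simple _ _ e) q p stop)) ,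
          Unique.++⁺ un′ ([] ∷ []) (λ { (a , here refl) → All.lookup c∉ (sub a) refl }) ,
          λ c∈ → [ there ∘ sub , (λ { (here refl) → here refl }) ]′ (∈-++⁻ ds c∈)

      rb-sym : ∀ {P : C → Set} {u v} → Rainbow P u v → Rainbow P v u
      rb-sym (cs , w , un , all) with reverse w un
      ... | ds , w′ , un′ , sub = ds , w′ , un′ , All.tabulate (λ c∈ → All.lookup all (sub c∈))

  data New (C : Set) (L M : ℕ) : Set where
    old     : C → New C L M
    tree    : Bool → Fin (suc L) → New C L M
    cross   : New C L M
    special : Fin (suc M) → New C L M

  tree-injectiveˡ : ∀ {C L M b b′ i i′} → tree {C} {L} {M} b i ≡ tree b′ i′ → b ≡ b′
  tree-injectiveˡ refl = refl

  tree-injectiveʳ : ∀ {C L M b b′ i i′} → tree {C} {L} {M} b i ≡ tree b′ i′ → i ≡ i′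
  tree-injectiveʳ refl = refl

  special-injective : ∀ {C L M i i′} → special {C} {L} {M} i ≡ special i′ → i ≡ i′
  special-injective refl = refl

  clamp : ∀ K → ℕ → Fin (suc K)
  clamp K i = fromℕ< (s≤s (m⊓n≤n i K))

  toℕ-clamp : ∀ {K i} → i ≤ K → toℕ (clamp K i) ≡ i
  toℕ-clamp {K} {i} i≤K = trans (toℕ-fromℕ< (s≤s (m⊓n≤n i K))) (m≤n⇒m⊓n≡m i≤K)

  clamp-injective : ∀ {K i j} → i ≤ K → j ≤ K → clamp K i ≡ clamp K j → i ≡ j
  clamp-injective p q e = trans (sym (toℕ-clamp p)) (trans (cong toℕ e) (toℕ-clamp q))

  position : ∀ {n} → List (Fin n) → Fin n → ℕ
  position []       y = 0
  position (x ∷ xs) y with x ≟ y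
  ... | yes _ = 0
  ... | no  _ = suc (position xs y)

  position-≤ : ∀ {n} (xs : List (Fin n)) y → position xs y ≤ length xs
  position-≤ []       y = z≤n
  position-≤ (x ∷ xs) y with x ≟ y
  ... | yes _ = z≤n
  ... | no  _ = s≤s (position-≤ xs y)

  position-injective : ∀ {n} {xs : List (Fin n)} {y z} → y ∈ xs → z ∈ xs →
                       position xs y ≡ position xs z → y ≡ z
  position-injective {xs = x ∷ xs} {y} {z} y∈ z∈ eq with x ≟ y | x ≟ z
  ... | yes refl | yes refl = refl
  ... | no ne | no ne′ = position-injective (tail ne y∈) (tail ne′ z∈) (suc-injective eq)
    where
    tail : ∀ {w} → x ≢ w → w ∈ x ∷ xs → w ∈ xs
    tail ne (here refl) = contradiction refl ne
    tail ne (there p)   = p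
  position-injective _ _ () | yes _ | no _
  position-injective _ _ () | no _ | yes _

  -- One stage: branches, types, exits and the new colouring.

  module RainbowColouring {n} (G : Graph n) (simple : Simple G) (ρ : Fin n) (π : Fin n → Fin n)
    (d : Fin n → ℕ) (L M : ℕ) (d≤L : ∀ v → d v ≤ L)
    (π-spec : ∀ {v} → v ≢ ρ → Adj G (π v) v × d (π v) < d v)
    (one-exit-large : ∀ {P : Fin n → Set} (P? : Decidable P) {y z} → P y →
       (∀ {a b} → P a → Adj G a b → ¬ P b → a ≡ y × b ≡ z) → n < M * length (vertexList P?)) where

    symG : ∀ {a b} → Adj G a b → Adj G b a
    symG = proj₂ simple _ _

    -- `covers` measures progress: as all depths are at most L, stage L contains every vertex.
    -- `rainbow` asks for walks rather than paths; loops are erased at the very end.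
    record Stage (C : Set) (j : ℕ) : Set₁ where
      field
        D        : Fin n → Set
        D?       : Decidable D
        ρ∈D      : D ρ
        π-closed : ∀ {v} → v ≢ ρ → D v → D (π v)
        covers   : ∀ {v} → d v ≤ j → D v
        col      : Fin n → Fin n → C
        col-sym  : ∀ u v → col u v ≡ col v u
        rainbow  : ∀ {u v} → D u → D v → ∃[ cs ] (RWalk G D col u v cs × Unique cs)

    module Next {C : Set} {j : ℕ} (S : Stage C j) where

      open Stage S

      ∉D⇒≢ρ : ∀ {v} → ¬ D v → v ≢ ρ
      ∉D⇒≢ρ ¬Dv refl = ¬Dv ρ∈D

      parent-adj : ∀ {v} → ¬ D v → Adj G v (π v)
      parent-adj ¬Dv = symG (proj₁ (π-spec (∉D⇒≢ρ ¬Dv)))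

      parent-< : ∀ {v} → ¬ D v → d (π v) < d v
      parent-< ¬Dv = proj₂ (π-spec (∉D⇒≢ρ ¬Dv))

      -- z lies on the tree path from w towards the root, before this path enters D.
      data Anc : Fin n → Fin n → Set where
        self : ∀ {w} → ¬ D w → Anc w w
        up   : ∀ {w z} → ¬ D w → Anc (π w) z → Anc w z

      anc-∉ : ∀ {w z} → Anc w z → ¬ D w
      anc-∉ (self p) = p
      anc-∉ (up p _) = p

      anc-∉′ : ∀ {w z} → Anc w z → ¬ D z
      anc-∉′ (self p) = p
      anc-∉′ (up _ a) = anc-∉′ a

      anc-trans : ∀ {w z x} → Anc w z → Anc z x → Anc w x
      anc-trans (self _) b = b
      anc-trans (up p a) b = up p (anc-trans a b)

      private
        anc-fuel : ∀ k w → d w ≤ k → ∀ z → Dec (Anc w z)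
        anc-fuel k w d≤k z with D? w | w ≟ z
        ... | yes Dw | _ = no λ a → anc-∉ a Dw
        ... | no ¬Dw | yes refl = yes (self ¬Dw)
        anc-fuel zero    w d≤k z | no ¬Dw | no _ =
          contradiction (≤-trans (parent-< ¬Dw) d≤k) n≮0
        anc-fuel (suc k) w d≤k z | no ¬Dw | no w≢z = map′ (up ¬Dw)
          (λ { (self _) → contradiction refl w≢z ; (up _ a) → a })
          (anc-fuel k (π w) (≤-pred (≤-trans (parent-< ¬Dw) d≤k)) z)

      anc? : ∀ w z → Dec (Anc w z)
      anc? w = anc-fuel L w (d≤L w)

      -- y is the top of the branch of v, the first vertex on the way up whose parent lies in D, and
      -- i is the number of steps to it. That the relation is functional gives the recursion
      -- equations of `height` and `branch`.
      data Up : Fin n → ℕ → Fin n → Set where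
        base : ∀ {v} → ¬ D v → D (π v) → Up v 0 v
        step : ∀ {v i y} → ¬ D v → Up (π v) i y → Up v (suc i) y

      up-∉ : ∀ {v i y} → Up v i y → ¬ D v
      up-∉ (base p _) = p
      up-∉ (step p _) = p

      up-functional : ∀ {v i y i′ y′} → Up v i y → Up v i′ y′ → i ≡ i′ × y ≡ y′
      up-functional (base _ _) (base _ _)  = refl , refl
      up-functional (base _ p) (step _ u)  = contradiction p (up-∉ u)
      up-functional (step _ u) (base _ p)  = contradiction p (up-∉ u)
      up-functional (step _ u) (step _ u′) = let (e , f) = up-functional u u′ in cong suc e , f

      private
        up-total : ∀ k v → d v ≤ k → ¬ D v → ∃[ i ] ∃[ y ] Up v i y
        up-total k v d≤k ¬Dv with D? (π v)
        ... | yes p = 0 , v , base ¬Dv p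
        up-total zero    v d≤k ¬Dv | no _ = contradiction (≤-trans (parent-< ¬Dv) d≤k) n≮0
        up-total (suc k) v d≤k ¬Dv | no ¬p =
          let (i , y , u) = up-total k (π v) (≤-pred (≤-trans (parent-< ¬Dv) d≤k)) ¬p
          in suc i , y , step ¬Dv u

      height : Fin n → ℕ
      height v with D? v
      ... | yes _ = 0
      ... | no ¬p = proj₁ (up-total L v (d≤L v) ¬p)

      branch : Fin n → Fin n
      branch v with D? v
      ... | yes _ = v
      ... | no ¬p = proj₁ (proj₂ (up-total L v (d≤L v) ¬p))

      up-spec : ∀ {v} → ¬ D v → Up v (height v) (branch v)
      up-spec {v} ¬Dv with D? v
      ... | yes p = contradiction p ¬Dv
      ... | no ¬p = proj₂ (proj₂ (up-total L v (d≤L v) ¬p))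

      height-< : ∀ {v i y} → Up v i y → i < d v
      height-< (base p _) = ≤-trans (s≤s z≤n) (parent-< p)
      height-< (step p u) = ≤-trans (s≤s (height-< u)) (parent-< p)

      height-≤ : ∀ {v} → ¬ D v → height v ≤ L
      height-≤ {v} p = ≤-trans (<⇒≤ (height-< (up-spec p))) (d≤L v)

      height-suc : ∀ {v} → ¬ D v → ¬ D (π v) → height v ≡ suc (height (π v))
      height-suc p q = proj₁ (up-functional (up-spec p) (step p (up-spec q)))

      branch-suc : ∀ {v} → ¬ D v → ¬ D (π v) → branch v ≡ branch (π v)
      branch-suc p q = proj₂ (up-functional (up-spec p) (step p (up-spec q)))

      height-base : ∀ {v} → ¬ D v → D (π v) → height v ≡ 0
      height-base p q = proj₁ (up-functional (up-spec p) (base p q))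

      branch-base : ∀ {v} → ¬ D v → D (π v) → branch v ≡ v
      branch-base p q = proj₂ (up-functional (up-spec p) (base p q))

      branch-root : ∀ {v} → ¬ D v → Anc v (branch v) × D (π (branch v))
      branch-root p = go′ (up-spec p)
        where
        go′ : ∀ {v i y} → Up v i y → Anc v y × D (π y)
        go′ (base p q) = self p , q
        go′ (step p u) = let (a , q) = go′ u in up p a , q

      anc-branch : ∀ {w z} → Anc w z → branch w ≡ branch z
      anc-branch (self _) = refl
      anc-branch (up p a) = trans (branch-suc p (anc-∉ a)) (anc-branch a)

      -- The quotient graph in which every branch shrinks to its top. Types are a colouring of this
      -- graph.
      Link : Fin n → Fin n → Set
      Link y y′ = y ≢ y′ × ∃[ w ] ∃[ w′ ]
        (¬ D w × ¬ D w′ × Adj G w w′ × branch w ≡ y × branch w′ ≡ y′)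

      link? : ∀ y y′ → Dec (Link y y′)
      link? y y′ = ¬? (y ≟ y′) ×-dec any? λ w → any? λ w′ →
        ¬? (D? w) ×-dec ¬? (D? w′) ×-dec (w′ ∈? lookup G w) ×-dec (branch w ≟ y) ×-dec (branch w′ ≟ y′)

      private
        colouring = balanced-colouring link?
          (λ (ne , w , w′ , p , q , e , b , b′) → ne ∘ sym , w′ , w , q , p , symG e , b′ , b)
          (λ (ne , _) → ne refl)

      type : Fin n → Bool
      type v = proj₁ colouring (branch v)

      anc-type : ∀ {w z} → Anc w z → type w ≡ type z
      anc-type a = cong (proj₁ colouring) (anc-branch a)

      -- The edges of a branch that serve as a second way to D. An edge to a branch of the same type
      -- is left out because the tree colours beyond it could repeat.
      Crosses : Fin n → Fin n → Set
      Crosses w w′ = (D w′ × w′ ≢ π w) ⊎ (¬ D w′ × type w′ ≡ not (type w))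

      Exit : Fin n → Set
      Exit w = ¬ D w × ∃[ w′ ] (Adj G w w′ × Crosses w w′)

      exit? : Decidable Exit
      exit? w = ¬? (D? w) ×-dec any? λ w′ → (w′ ∈? lookup G w) ×-dec
        ((D? w′ ×-dec ¬? (w′ ≟ π w)) ⊎-dec (¬? (D? w′) ×-dec (type w′ ≟ᵇ not (type w))))

      -- An exit at or below z gives z a route to D that avoids the tree path above z.
      Good : Fin n → Set
      Good z = ∃[ w ] (Exit w × Anc w z)

      good? : Decidable Good
      good? z = any? λ w → exit? w ×-dec anc? w z

      good-anc : ∀ {z x} → Good z → Anc z x → Good x
      good-anc (w , ex , a) b = w , ex , anc-trans a b

      Iso : Fin n → Set
      Iso y = ¬ D y × D (π y) × ¬ Good y

      iso? : Decidable Iso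
      iso? y = ¬? (D? y) ×-dec D? (π y) ×-dec ¬? (good? y)

      InBranch : Fin n → Fin n → Set
      InBranch y v = ¬ D v × branch v ≡ y

      inBranch? : ∀ y → Decidable (InBranch y)
      inBranch? y v = ¬? (D? v) ×-dec (branch v ≟ y)

      -- A branch without exit is left only by the edge at its top: any other edge to D would be an
      -- exit, and a link to any branch forces, by the choice of types, a link to a branch of the
      -- other type.
      iso-branch-large : ∀ {y} → Iso y → n < M * length (vertexList (inBranch? y))
      iso-branch-large {y} (¬Dy , Dπy , ¬good) = one-exit-large (inBranch? y) {y} {π y}
        (¬Dy , branch-base ¬Dy Dπy) leaving
        where
        exit⇒⊥ : ∀ {a} → branch a ≡ y → ¬ Exit a
        exit⇒⊥ refl ex@(¬Da , _) = ¬good (_ , ex , proj₁ (branch-root ¬Da))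
        leaving : ∀ {a b} → InBranch y a → Adj G a b → ¬ InBranch y b → a ≡ y × b ≡ π y
        leaving {a} {b} (¬Da , ba) e ¬in with toSum (D? b) | b ≟ π a
        ... | inj₁ Db | yes refl = a≡y , cong π a≡y
          where
          a≡y : a ≡ y
          a≡y = trans (sym (branch-base ¬Da Db)) ba
        ... | inj₁ Db | no b≢πa = contradiction (¬Da , b , e , inj₁ (Db , b≢πa)) (exit⇒⊥ ba)
        -- The edge ab may join branches of equal type. The balanced colouring then supplies an edge
        -- from a vertex w of the same branch to a branch of the other type, and w is the exit.
        ... | inj₂ ¬Db | _ with proj₂ colouring {y} {branch b}
                ((λ y≡ → ¬in (¬Db , sym y≡)) , a , b , ¬Da , ¬Db , e , ba , refl)
        ...   | z , (_ , w , w′ , ¬Dw , ¬Dw′ , e′ , bw , bw′) , τz =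
                contradiction (¬Dw , w′ , e′ , inj₂ (¬Dw′ ,
                  trans (cong (proj₁ colouring) bw′) (trans τz (cong (not ∘ proj₁ colouring) (sym bw)))))
                  (exit⇒⊥ bw)

      isoList : List (Fin n)
      isoList = vertexList iso?

      -- Branches are disjoint, and these have more than n / M vertices each.
      length-isoList : length isoList ≤ M
      length-isoList = *-cancelʳ-≤ (length isoList) M n {{nonZeroIndex ρ}} (begin
        length isoList * n
          ≤⟨ length-concatMap-≥ members M n isoList (λ y∈ → <⇒≤ (iso-branch-large (∈-vertexList⁻ iso? y∈))) ⟩
        M * length (concatMap members isoList)
          ≤⟨ *-monoʳ-≤ M (unique-length-≤n (unique-concatMap members (unique-vertexList iso?)
               (λ {y} _ → unique-vertexList (inBranch? y))
               λ {y} {y′} _ _ p q → trans (sym (proj₂ (∈-vertexList⁻ (inBranch? y) p)))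
                                          (proj₂ (∈-vertexList⁻ (inBranch? y′) q)))) ⟩
        M * n ∎)
        where
        open ≤-Reasoning
        members : Fin n → List (Fin n)
        members y = vertexList (inBranch? y)

      private
        C′ = New C L M

      TreeEdge : Fin n → Fin n → Set
      TreeEdge u v = ¬ D u × v ≡ π u

      treeEdge? : ∀ u v → Dec (TreeEdge u v)
      treeEdge? u v = ¬? (D? u) ×-dec (v ≟ π u)

      treeColour : Fin n → C′
      treeColour u with good? u
      ... | yes _ = tree (type u) (clamp L (height u))
      ... | no  _ = special (clamp M (position isoList u))

      col′ : Fin n → Fin n → C′
      col′ u v with D? u ×-dec D? v | treeEdge? u v | treeEdge? v u
      ... | yes _ | _     | _     = old (col u v)
      ... | no _  | yes _ | _     = treeColour u
      ... | no _  | no _  | yes _ = treeColour v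
      ... | no _  | no _  | no _  = cross

      col′-old : ∀ {u v} → D u → D v → col′ u v ≡ old (col u v)
      col′-old {u} {v} p q with D? u ×-dec D? v
      ... | yes _ = refl
      ... | no ¬pq = contradiction (p , q) ¬pq

      col′-tree : ∀ {u} → ¬ D u → col′ u (π u) ≡ treeColour u
      col′-tree {u} p with D? u ×-dec D? (π u) | treeEdge? u (π u)
      ... | yes (q , _) | _ = contradiction q p
      ... | no _ | yes _ = refl
      ... | no _ | no ¬t = contradiction (p , refl) ¬t

      col′-cross : ∀ {u v} → ¬ D u → ¬ TreeEdge u v → ¬ TreeEdge v u → col′ u v ≡ cross
      col′-cross {u} {v} p q r with D? u ×-dec D? v | treeEdge? u v | treeEdge? v u
      ... | yes (p′ , _) | _ | _ = contradiction p′ p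
      ... | no _ | yes t | _ = contradiction t q
      ... | no _ | no _ | yes t = contradiction t r
      ... | no _ | no _ | no _ = refl

      -- Two vertices cannot be each other's parent, since depth drops strictly; the order of the
      -- tree tests is therefore immaterial.
      col′-sym : ∀ u v → col′ u v ≡ col′ v u
      col′-sym u v with D? u | D? v | treeEdge? u v | treeEdge? v u
      ... | yes _ | yes _ | _ | _ = cong old (col-sym u v)
      ... | yes _ | no _ | yes _ | no _ = refl
      ... | yes _ | no _ | no _ | yes _ = refl
      ... | yes _ | no _ | no _ | no _ = refl
      ... | no _ | yes _ | yes _ | no _ = refl
      ... | no _ | yes _ | no _ | yes _ = refl
      ... | no _ | yes _ | no _ | no _ = refl
      ... | no _ | no _ | yes _ | no _ = refl
      ... | no _ | no _ | no _ | yes _ = refl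
      ... | no _ | no _ | no _ | no _ = refl
      ... | yes _ | no _ | yes (p , refl) | yes (q , e) = contradiction (parent-< p)
              (<-asym (subst (λ z → d z < d (π u)) (sym e) (parent-< q)))
      ... | no _ | yes _ | yes (p , refl) | yes (q , e) = contradiction (parent-< p)
              (<-asym (subst (λ z → d z < d (π u)) (sym e) (parent-< q)))
      ... | no _ | no _ | yes (p , refl) | yes (q , e) = contradiction (parent-< p)
              (<-asym (subst (λ z → d z < d (π u)) (sym e) (parent-< q)))

      -- Children of D join even without an exit below, which gains one level of depth. Deeper
      -- vertices without an exit at or below them wait for a later stage.
      D′ : Fin n → Set
      D′ z = D z ⊎ (¬ D z × (Good z ⊎ D (π z)))

      D′? : Decidable D′
      D′? z = D? z ⊎-dec (¬? (D? z) ×-dec (good? z ⊎-dec D? (π z)))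

      good∈D′ : ∀ {z} → Good z → D′ z
      good∈D′ g@(_ , _ , a) = inj₂ (anc-∉′ a , inj₁ g)

      private
        Rb : (C′ → Set) → Fin n → Fin n → Set
        Rb = Rainbow G D′ col′

        -- The edge from a good vertex to its parent carries the type and height of that vertex.
        -- Hence Mid covers a tree path between two heights, Low a tree path up into D, and High all
        -- that a route through an exit below may use.
        Mid : Bool → ℕ → ℕ → C′ → Set
        Mid τ lo hi c = ∃[ i ] (c ≡ tree τ i × lo < toℕ i × toℕ i ≤ hi)

        Low : Bool → ℕ → C′ → Set
        Low τ hi c = ∃[ i ] (c ≡ tree τ i × toℕ i ≤ hi)

        High : Bool → ℕ → C′ → Set
        High τ lo c = (∃[ i ] (c ≡ tree τ i × lo < toℕ i)) ⊎ (c ≡ cross ⊎ ∃[ i ] c ≡ tree (not τ) i)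

        treeColour-good : ∀ {u} → Good u → treeColour u ≡ tree (type u) (clamp L (height u))
        treeColour-good {u} g with good? u
        ... | yes _ = refl
        ... | no ¬g = contradiction g ¬g

        treeColour-¬good : ∀ {u} → ¬ Good u → treeColour u ≡ special (clamp M (position isoList u))
        treeColour-¬good {u} ¬g with good? u
        ... | yes g = contradiction g ¬g
        ... | no _  = refl

        climb : ∀ {w z} → Good w → Anc w z → Rb (Mid (type z) (height z) (height w)) w z
        climb g (self _) = rb-refl G D′ col′
        climb {w} {z} g (up p a) = rb-mono G D′ col′
          (λ { (inj₁ (refl)) → _ , cong (λ τ → tree τ (clamp L (height w))) (anc-type (up p a)) ,
                   subst (height z <_) (sym (toℕ-clamp (height-≤ p)))
                     (subst (height z <_) (sym hw) (s≤s (climb-≤ a))) ,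
                   ≤-reflexive (toℕ-clamp (height-≤ p))
             ; (inj₂ (i , e , lo , hi)) → i , e , lo , ≤-trans hi (≤-trans (n≤1+n _) (≤-reflexive (sym hw))) })
          (rb-trans G D′ col′ {P = λ c → c ≡ tree (type w) (clamp L (height w))}
            (λ { refl (i , eq , _ , hi) → <⇒≱ (≤-reflexive (sym hw))
                   (subst (_≤ height (π w)) (trans (cong toℕ (sym (tree-injectiveʳ eq))) (toℕ-clamp (height-≤ p))) hi) })
            (rb-edge G D′ col′ (parent-adj p) (good∈D′ g) (good∈D′ g′)
              (trans (col′-tree p) (treeColour-good g)))
            (climb g′ a))
          where
          hw = height-suc p (anc-∉ a)
          g′ : Good (π w)
          g′ = good-anc g (up p (self (anc-∉ a)))
          climb-≤ : ∀ {w z} → Anc w z → height z ≤ height w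
          climb-≤ (self _) = ≤-refl
          climb-≤ (up p a) = ≤-trans (climb-≤ a) (≤-trans (n≤1+n _) (≤-reflexive (sym (height-suc p (anc-∉ a)))))

        own : ∀ {z} → Good z → ∃[ x ] (D x × Rb (Low (type z) (height z)) z x)
        own {z} g@(_ , _ , a₀) = π y , Dπy , rb-mono G D′ col′
          (λ { (inj₁ (i , e , _ , hi)) → i , trans e (cong (λ τ → tree τ i) (sym (anc-type a))) , hi
             ; (inj₂ refl) → _ , cong (λ τ → tree τ (clamp L (height y))) (sym (anc-type a)) ,
                 subst (_≤ height z) (sym (trans (toℕ-clamp (height-≤ ¬Dy)) hy)) z≤n })
          (rb-trans G D′ col′ {Q = λ c → c ≡ tree (type y) (clamp L (height y))}
            (λ { (i , refl , lo , _) eq → <-irrefl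
                   (sym (trans (cong toℕ (tree-injectiveʳ eq)) (toℕ-clamp (height-≤ ¬Dy)))) lo })
            (climb g a)
            (rb-edge G D′ col′ (parent-adj ¬Dy) (good∈D′ gy) (inj₁ Dπy)
              (trans (col′-tree ¬Dy) (treeColour-good gy))))
          where
          y = branch z
          a = proj₁ (branch-root (anc-∉′ a₀))
          Dπy = proj₂ (branch-root (anc-∉′ a₀))
          ¬Dy = anc-∉′ a
          gy = good-anc g a
          hy = height-base ¬Dy Dπy

        not≢ : ∀ b → not b ≢ b
        not≢ true  ()
        not≢ false ()

        -- Down to an exit, through it and, unless D is reached already, up the own route of its far
        -- end. In the type of z only heights above that of z occur, so the colours are disjoint
        -- from those of the own route of z.
        opposite : ∀ {z} → Good z → ∃[ x ] (D x × Rb (High (type z) (height z)) z x)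
        opposite {z} g@(w , ex@(¬Dw , w′ , e , cr) , a) = finish cr
          where
          good-w : Good w
          good-w = w , ex , self ¬Dw
          down : Rb (Mid (type z) (height z) (height w)) z w
          down = rb-sym G D′ col′ simple col′-sym (climb good-w a)
          cross-edge : D′ w′ → ¬ TreeEdge w w′ → ¬ TreeEdge w′ w → Rb (_≡ cross) w w′
          cross-edge in′ ¬t ¬t′ = rb-edge G D′ col′ e (good∈D′ good-w) in′ (col′-cross ¬Dw ¬t ¬t′)
          via : D′ w′ → ¬ TreeEdge w w′ → ¬ TreeEdge w′ w →
                Rb (λ c → Mid (type z) (height z) (height w) c ⊎ c ≡ cross) z w′
          via in′ ¬t ¬t′ = rb-trans G D′ col′ (λ { (_ , refl , _) () }) down (cross-edge in′ ¬t ¬t′)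
          mid⇒high : ∀ {c} → Mid (type z) (height z) (height w) c ⊎ c ≡ cross → High (type z) (height z) c
          mid⇒high (inj₁ (i , eq , lo , _)) = inj₁ (i , eq , lo)
          mid⇒high (inj₂ eq) = inj₂ (inj₁ eq)
          finish : Crosses w w′ → ∃[ x ] (D x × Rb (High (type z) (height z)) z x)
          finish (inj₁ (Dw′ , ne)) = w′ , Dw′ ,
            rb-mono G D′ col′ mid⇒high (via (inj₁ Dw′) (ne ∘ proj₂) (λ (p , _) → p Dw′))
          finish (inj₂ (¬Dw′ , τ)) =
            let (x , Dx , r) = own good-w′
            in x , Dx , rb-mono G D′ col′
                 (λ { (inj₁ m) → mid⇒high m
                    ; (inj₂ (i , eq , _)) → inj₂ (inj₂ (i , trans eq (cong (λ b → tree b i) τ′))) })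
                 (rb-trans G D′ col′ sep (via (good∈D′ good-w′) (¬same ∘ to) (¬same ∘ from)) r)
            where
            -- The same edge read backwards is an exit of w′, which gives w′ an own route.
            good-w′ : Good w′
            good-w′ = w′ , (¬Dw′ , w , symG e , inj₂ (¬Dw ,
              trans (sym (not-involutive (type w))) (cong not (sym τ)))) , self ¬Dw′
            τ′ : type w′ ≡ not (type z)
            τ′ = trans τ (cong not (anc-type a))
            ¬same : type w′ ≢ type w
            ¬same eq = not≢ (type w) (trans (sym τ) eq)
            to : TreeEdge w w′ → type w′ ≡ type w
            to (p , refl) = sym (anc-type (up p (self ¬Dw′)))
            from : TreeEdge w′ w → type w′ ≡ type w
            from (p , refl) = anc-type (up p (self ¬Dw))
            sep : ∀ {c} → Mid (type z) (height z) (height w) c ⊎ c ≡ cross → ¬ Low (type w′) (height w′) c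
            sep (inj₁ (_ , refl , _)) (_ , eq , _) = not≢ (type z) (trans (sym τ′) (tree-injectiveˡ (sym eq)))
            sep (inj₂ refl) (_ , () , _)

        Old : C′ → Set
        Old c = ∃[ c₀ ] c ≡ old c₀

        Special : Fin n → C′ → Set
        Special y c = c ≡ special (clamp M (position isoList y))

        iso-route : ∀ {y} → Iso y → Rb (Special y) y (π y)
        iso-route {y} (¬Dy , Dπy , ¬g) = rb-edge G D′ col′ (parent-adj ¬Dy) (inj₂ (¬Dy , inj₂ Dπy)) (inj₁ Dπy)
          (trans (col′-tree ¬Dy) (treeColour-¬good ¬g))

        old-route : ∀ {u v} → D u → D v → Rb Old u v
        old-route p q = let (cs , w , un) = rainbow p q in
          map old cs , lift w , Unique.map⁺ (λ { refl → refl }) un ,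
          All.map⁺ (All.tabulate λ {c} _ → c , refl)
          where
          lift : ∀ {u v cs} → RWalk G D col u v cs → RWalk G D′ col′ u v (map old cs)
          lift stop = stop
          lift (go {u} {v} {w} {cs} e p q r) = subst (λ c → RWalk G D′ col′ u w (c ∷ map old cs))
            (col′-old p q) (go e (inj₁ p) (inj₁ q) (lift r))

        Rainbow′ : Fin n → Fin n → Set
        Rainbow′ u v = ∃[ cs ] (RWalk G D′ col′ u v cs × Unique cs)

        -- The ends x₁ and x₂ are arbitrary in D: an old rainbow walk joins them, and its colours
        -- are disjoint from all colours of the new routes.
        combine : ∀ {P Q : C′ → Set} {z₁ z₂ x₁ x₂} → (∀ {c} → P c → ¬ Q c) →
          (∀ {c} → P c → ¬ Old c) → (∀ {c} → Q c → ¬ Old c) →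
          D x₁ → D x₂ → Rb P z₁ x₁ → Rb Q z₂ x₂ → Rainbow′ z₁ z₂
        combine PQ PO QO p q r₁ r₂ =
          let (cs , w , un , _) = rb-trans G D′ col′
                (λ { (inj₁ a) b → PQ a b ; (inj₂ o) b → QO b o })
                (rb-trans G D′ col′ PO r₁ (old-route p q))
                (rb-sym G D′ col′ simple col′-sym r₂)
          in cs , w , un

        flip : ∀ {u v} → Rainbow′ u v → Rainbow′ v u
        flip (cs , w , un) = let (ds , w′ , un′ , _) = rb-sym G D′ col′ simple col′-sym
                                   {P = λ _ → ⊤} (cs , w , un , All.tabulate (λ _ → _)) in
          ds , w′ , un′

        low-old : ∀ {τ i c} → Low τ i c → ¬ Old c
        low-old (_ , refl , _) (_ , ())

        high-old : ∀ {τ i c} → High τ i c → ¬ Old c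
        high-old (inj₁ (_ , refl , _)) (_ , ())
        high-old (inj₂ (inj₁ refl)) (_ , ())
        high-old (inj₂ (inj₂ (_ , refl))) (_ , ())

        special-old : ∀ {y c} → Special y c → ¬ Old c
        special-old refl (_ , ())

        low-special : ∀ {τ i y c} → Low τ i c → ¬ Special y c
        low-special (_ , refl , _) ()

        low-low : ∀ {τ τ′ i j c} → τ ≢ τ′ → Low τ i c → ¬ Low τ′ j c
        low-low ne (_ , refl , _) (_ , refl , _) = ne refl

        low-high : ∀ {τ i j c} → i ≤ j → Low τ i c → ¬ High τ j c
        low-high i≤j (_ , refl , p) (inj₁ (_ , refl , q)) = <⇒≱ q (≤-trans p i≤j)
        low-high i≤j (_ , refl , p) (inj₂ (inj₂ (_ , eq))) = not-eq eq
          where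
          not-eq : ∀ {τ i j} → tree {C} {L} {M} τ i ≢ tree (not τ) j
          not-eq {true}  ()
          not-eq {false} ()

        -- Of two vertices of the same type the lower one takes its own route
        -- and the higher one the opposite route.
        same-type : ∀ {z₁ z₂} → Good z₁ → Good z₂ → type z₁ ≡ type z₂ → height z₁ ≤ height z₂ →
                    Rainbow′ z₁ z₂
        same-type {z₁} {z₂} g₁ g₂ τ≡ le =
          let (x₁ , p , r₁) = own g₁
              (x₂ , q , r₂) = opposite g₂
          in combine (λ l h → low-high le l (subst (λ τ → High τ (height z₂) _) (sym τ≡) h))
               low-old high-old p q r₁ r₂

        good-good : ∀ {z₁ z₂} → Good z₁ → Good z₂ → Rainbow′ z₁ z₂
        good-good {z₁} {z₂} g₁ g₂ with type z₁ ≟ᵇ type z₂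
        ... | no ne =
          let (x₁ , p , r₁) = own g₁
              (x₂ , q , r₂) = own g₂
          in combine (low-low ne) low-old low-old p q r₁ r₂
        ... | yes τ≡ with ≤-total (height z₁) (height z₂)
        ...   | inj₁ le = same-type g₁ g₂ τ≡ le
        ...   | inj₂ ge = flip (same-type g₂ g₁ (sym τ≡) ge)

        Kind : Fin n → Set
        Kind z = D z ⊎ Good z ⊎ Iso z

        kind : ∀ {z} → D′ z → Kind z
        kind (inj₁ p) = inj₁ p
        kind (inj₂ (_ , inj₁ g)) = inj₂ (inj₁ g)
        kind {z} (inj₂ (¬p , inj₂ q)) with good? z
        ... | yes g = inj₂ (inj₁ g)
        ... | no ¬g = inj₂ (inj₂ (¬p , q , ¬g))

        inside-route : ∀ {z} → Rb (λ _ → ⊥) z z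
        inside-route = rb-refl G D′ col′

        iso-iso : ∀ {u v} → Iso u → Iso v → Rainbow′ u v
        iso-iso {u} {v} i@(_ , p , _) j@(_ , q , _) with u ≟ v
        ... | yes refl = [] , stop , []
        ... | no u≢v = combine {P = Special u} {Q = Special v}
                (λ { refl eq → u≢v (position-injective (∈-vertexList⁺ iso? i) (∈-vertexList⁺ iso? j)
                    (clamp-injective (pos u) (pos v) (special-injective eq))) })
                (special-old {u}) (special-old {v}) p q (iso-route i) (iso-route j)
          where
          pos : ∀ w → position isoList w ≤ M
          pos w = ≤-trans (position-≤ isoList w) length-isoList

        good-iso : ∀ {u v} → Good u → Iso v → Rainbow′ u v
        good-iso {u} {v} g i@(_ , q , _) =
          let (x , p , r) = own g in
          combine {Q = Special v} (low-special {y = v}) low-old (special-old {v}) p q r (iso-route i)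

        inside-good : ∀ {u v} → D u → Good v → Rainbow′ u v
        inside-good p g = let (x , q , r) = own g in
          combine {P = λ _ → ⊥} (λ ()) (λ ()) low-old p q inside-route r

        inside-iso : ∀ {u v} → D u → Iso v → Rainbow′ u v
        inside-iso {v = v} p i@(_ , q , _) =
          combine {P = λ _ → ⊥} {Q = Special v} (λ ()) (λ ()) (special-old {v}) p q inside-route (iso-route i)

        connect : ∀ {u v} → Kind u → Kind v → Rainbow′ u v
        connect (inj₁ p) (inj₁ q) = let (cs , w , un , _) = old-route p q in cs , w , un
        connect (inj₁ p)        (inj₂ (inj₁ g)) = inside-good p g
        connect (inj₂ (inj₁ g)) (inj₁ q)        = flip (inside-good q g)
        connect (inj₁ p)        (inj₂ (inj₂ i)) = inside-iso p i
        connect (inj₂ (inj₂ i)) (inj₁ q)        = flip (inside-iso q i)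
        connect (inj₂ (inj₁ g)) (inj₂ (inj₁ h)) = good-good g h
        connect (inj₂ (inj₁ g)) (inj₂ (inj₂ i)) = good-iso g i
        connect (inj₂ (inj₂ i)) (inj₂ (inj₁ g)) = flip (good-iso g i)
        connect (inj₂ (inj₂ i)) (inj₂ (inj₂ j)) = iso-iso i j

      next : Stage C′ (suc j)
      next = record
        { D = D′
        ; D? = D′?
        ; ρ∈D = inj₁ ρ∈D
        ; π-closed = closed
        ; covers = covers′
        ; col = col′
        ; col-sym = col′-sym
        ; rainbow = λ p q → connect (kind p) (kind q) }
        where
        closed : ∀ {v} → v ≢ ρ → D′ v → D′ (π v)
        closed {v} v≢ρ (inj₁ p) = inj₁ (π-closed v≢ρ p)
        closed {v} v≢ρ (inj₂ (¬p , inj₂ q)) = inj₁ q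
        closed {v} v≢ρ (inj₂ (¬p , inj₁ g)) with D? (π v)
        ... | yes q = inj₁ q
        ... | no ¬q = good∈D′ (good-anc g (up ¬p (self ¬q)))
        covers′ : ∀ {v} → d v ≤ suc j → D′ v
        covers′ {v} le with D? v
        ... | yes p = inj₁ p
        ... | no ¬p = inj₂ (¬p , inj₂ (covers (≤-pred (≤-trans (parent-< ¬p) le))))

    palette : ℕ
    palette = (suc L + suc L) + (1 + suc M)

    private
      toNested : ∀ {C : Set} → New C L M → C ⊎ ((Fin (suc L) ⊎ Fin (suc L)) ⊎ (Fin 1 ⊎ Fin (suc M)))
      toNested (old c)        = inj₁ c
      toNested (tree true i)  = inj₂ (inj₁ (inj₁ i))
      toNested (tree false i) = inj₂ (inj₁ (inj₂ i))
      toNested cross          = inj₂ (inj₂ (inj₁ zero))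
      toNested (special i)    = inj₂ (inj₂ (inj₂ i))

      toNested-injective : ∀ {C : Set} {x y : New C L M} → toNested x ≡ toNested y → x ≡ y
      toNested-injective {x = old _}        {old _}        refl = refl
      toNested-injective {x = old _}        {tree true _}  ()
      toNested-injective {x = old _}        {tree false _} ()
      toNested-injective {x = cross}        {tree true _}  ()
      toNested-injective {x = cross}        {tree false _} ()
      toNested-injective {x = special _}    {tree true _}  ()
      toNested-injective {x = special _}    {tree false _} ()
      toNested-injective {x = tree true _}  {tree true _}  refl = refl
      toNested-injective {x = tree false _} {tree false _} refl = refl
      toNested-injective {x = cross}        {cross}        refl = refl
      toNested-injective {x = special _}    {special _}    refl = refl
      toNested-injective {x = tree true _}  {tree false _} ()
      toNested-injective {x = tree false _} {tree true _}  ()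

      encode : ∀ {k} → New (Fin k) L M → Fin (k + palette)
      encode {k} x = join k palette (Data.Sum.map₂
        (λ s → join (suc L + suc L) (1 + suc M) (Data.Sum.map (join (suc L) (suc L)) (join 1 (suc M)) s)) (toNested x))

      join-injective : ∀ m k {x y : Fin m ⊎ Fin k} → join m k x ≡ join m k y → x ≡ y
      join-injective m k {x} {y} e =
        trans (sym (splitAt-join m k x)) (trans (cong (splitAt m) e) (splitAt-join m k y))

      map-injective : ∀ {A B A′ B′ : Set} {f : A → A′} {g : B → B′} →
        (∀ {a b} → f a ≡ f b → a ≡ b) → (∀ {a b} → g a ≡ g b → a ≡ b) →
        ∀ {x y} → Data.Sum.map f g x ≡ Data.Sum.map f g y → x ≡ y
      map-injective fi gi {inj₁ _} {inj₁ _} e = cong inj₁ (fi (inj₁-injective e))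
      map-injective fi gi {inj₂ _} {inj₂ _} e = cong inj₂ (gi (inj₂-injective e))

      encode-injective : ∀ {k} {x y : New (Fin k) L M} → encode x ≡ encode y → x ≡ y
      encode-injective {k} e = toNested-injective (map-injective id
        (λ e′ → map-injective (join-injective (suc L) (suc L)) (join-injective 1 (suc M))
          (join-injective (suc L + suc L) (1 + suc M) e′))
        (join-injective k palette e))

    recolour : ∀ {C C′ j} (f : C → C′) → (∀ {x y} → f x ≡ f y → x ≡ y) → Stage C j → Stage C′ j
    recolour f inj S = record
      { D = D ; D? = D? ; ρ∈D = ρ∈D ; π-closed = π-closed ; covers = covers
      ; col = λ u v → f (col u v)
      ; col-sym = λ u v → cong f (col-sym u v)
      ; rainbow = λ p q → let (cs , w , un) = rainbow p q in map f cs , lift w , Unique.map⁺ inj un }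
      where
      open Stage S
      lift : ∀ {u v cs} → RWalk G D col u v cs → RWalk G D (λ u v → f (col u v)) u v (map f cs)
      lift stop         = stop
      lift (go e p q w) = go e p q (lift w)

    stage : ∀ j → Stage (Fin (1 + j * palette)) j
    -- D is the root alone. One colour is provided because `col` is a total function.
    stage zero = record
      { D = _≡ ρ ; D? = _≟ ρ ; ρ∈D = refl ; π-closed = λ v≢ρ v≡ρ → contradiction v≡ρ v≢ρ
      ; covers = λ {v} le → root v le
      ; col = λ _ _ → zero ; col-sym = λ _ _ → refl
      ; rainbow = λ { refl refl → [] , stop , [] } }
      where
      root : ∀ v → d v ≤ 0 → v ≡ ρ
      root v le with v ≟ ρ
      ... | yes e = e
      ... | no ne = contradiction (≤-trans (proj₂ (π-spec ne)) le) n≮0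
    stage (suc j) = subst (λ k → Stage (Fin k) (suc j))
      (cong suc (+-comm (j * palette) palette))
      (recolour encode encode-injective (Next.next (stage j)))

-- From rainbow walks to the exact value of the rainbow connectivity.

module Connectivity where

  open Growth
  open Rainbow
  open import Data.Empty using (⊥)
  open import Data.Fin using (Fin; zero; suc; _≟_)
  open import Data.Fin.Properties using (any?; all?)
  open import Data.Fin.Subset.Properties using (_∈?_)
  open import Data.List using ([]; _∷_; length)
  open import Data.List.Membership.Propositional using (_∈_; _∉_)
  import Data.List.Membership.DecPropositional as DecMembership
  open import Data.List.Relation.Unary.All as All using (All; []; _∷_)
  open import Data.List.Relation.Unary.AllPairs using ([]; _∷_)
  open import Data.List.Relation.Unary.Any using (here; there)
  open import Data.List.Relation.Unary.Unique.Propositional using (Unique)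
  import Data.List.Relation.Unary.Unique.DecPropositional as DecUnique
  import Data.List.Relation.Unary.Unique.Propositional.Properties as Unique
  open import Data.Nat as ℕ using (ℕ; zero; suc; _≤_; _<_; z≤n; s≤s)
  import Data.Nat.Properties as ℕ
  open import Data.Product using (_×_; _,_; proj₁; proj₂; ∃; ∃-syntax; Σ-syntax)
  open import Data.Sum using (_⊎_; inj₁; inj₂; [_,_]′)
  open import Data.Vec using (Vec; []; _∷_; lookup; tabulate; _[_]=_; here; there)
  open import Data.Vec.Properties using (lookup∘tabulate)
  open import Function using (_∘_; id)
  open import Relation.Binary.Construct.Closure.ReflexiveTransitive using (ε; _◅_)
  open import Relation.Binary.PropositionalEquality
  open import Relation.Nullary using (¬_; yes; no; Dec; contradiction)
  open import Relation.Nullary.Decidable using (_×-dec_; _⊎-dec_; map′)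

  -- Colours depend on adjacency proofs; uniqueness of these proofs makes colours a function of the
  -- edge.
  []=-irrelevant : ∀ {A : Set} {m} {xs : Vec A m} {i x} (p q : xs [ i ]= x) → p ≡ q
  []=-irrelevant here      here      = refl
  []=-irrelevant (there p) (there q) = cong there ([]=-irrelevant p q)

  module _ {n} (G : Graph n) {k} (c : EdgeColoring G k) where

    open EdgeColoring c

    open DecMembership (_≟_ {n}) using () renaming (_∈?_ to _∈ˡ?_)

    private
      Sub : ∀ {u u′ v} → Walk G u v → Walk G u′ v → Set
      Sub w w′ = ∀ {a} → a ∈ colors w → a ∈ colors w′

      suffix : ∀ {u v x} (w : Walk G u v) → IsPath G w → Unique (colors w) → x ∈ vertices G w →
               ∃[ w′ ] (IsPath G {x} {v} w′ × Unique (colors w′) × Sub w′ w)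
      suffix ε       p        un       (here refl) = ε , p , un , id
      suffix (e ◅ w) p        un       (here refl) = e ◅ w , p , un , id
      suffix (e ◅ w) (_ ∷ p)  (_ ∷ un) (there x∈)  =
        let (w′ , p′ , un′ , sub) = suffix w p un x∈ in w′ , p′ , un′ , there ∘ sub

    -- Erasing loops only drops colours, so they stay distinct. `Sub` is carried along to see that
    -- the colour of a prepended edge is still fresh.
    loop-erasure : ∀ {u v} (w : Walk G u v) → Unique (colors w) →
                   ∃[ w′ ] (IsPath G {u} {v} w′ × Unique (colors w′) × Sub w′ w)
    loop-erasure ε       un        = ε , [] ∷ [] , [] , id
    loop-erasure {u} (e ◅ w) (c∉ ∷ un) with loop-erasure w un
    ... | w′ , p′ , un′ , sub with u ∈ˡ? vertices G w′
    ...   | yes u∈ = let (w″ , p″ , un″ , sub′) = suffix w′ p′ un′ u∈ in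
                     w″ , p″ , un″ , there ∘ sub ∘ sub′
    ...   | no  u∉ = e ◅ w′ ,
                     All.tabulate (λ {x} x∈ u≡x → u∉ (subst (_∈ vertices G w′) (sym u≡x) x∈)) ∷ p′ ,
                     All.tabulate (λ a∈ → All.lookup c∉ (sub a∈)) ∷ un′ ,
                     λ { (here e′) → here e′ ; (there a∈) → there (sub a∈) }

  module _ {n} (G : Graph n) where

    walkLength : ∀ {u v} → Walk G u v → ℕ
    walkLength ε       = 0
    walkLength (_ ◅ w) = suc (walkLength w)

    path-length : ∀ {u v} (w : Walk G u v) → IsPath G w → walkLength w ≤ n
    path-length w p = ℕ.≤-trans (len w) (unique-length-≤n p)
      where
      len : ∀ {u v} (w : Walk G u v) → walkLength w ≤ length (vertices G w)
      len ε       = z≤n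
      len (_ ◅ w) = s≤s (len w)

    -- Adjacency proofs are unique, so it suffices to try one proof per edge.
    someWalk? : ∀ m u v {P : Walk G u v → Set} → (∀ w → Dec (P w)) →
                Dec (∃[ w ] (walkLength w ≤ m × P w))
    someWalk? m u v {P} P? = map′ [ fromε , fromCons m ]′ (split m) (ε? ⊎-dec cons? m)
      where
      ε? : Dec (Σ[ e ∈ u ≡ v ] P (subst (Walk G u) e ε))
      ε? with u ≟ v
      ... | no ne    = no (ne ∘ proj₁)
      ... | yes refl = map′ (refl ,_) (λ { (refl , p) → p }) (P? ε)
      Cons : ℕ → Set
      Cons zero    = ⊥
      Cons (suc m) = ∃[ x ] Σ[ e ∈ Adj G u x ] ∃[ w ] (walkLength w ≤ m × P (e ◅ w))
      cons? : ∀ m → Dec (Cons m)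
      cons? zero    = no λ ()
      cons? (suc m) = any? λ x → via x (x ∈? lookup G u)
        where
        via : ∀ x → Dec (Adj G u x) → Dec (Σ[ e ∈ Adj G u x ] ∃[ w ] (walkLength w ≤ m × P (e ◅ w)))
        via x (no ¬e) = no (¬e ∘ proj₁)
        via x (yes e) = map′ (e ,_)
          (λ (e′ , w , le , p) → w , le , subst (λ e → P (e ◅ w)) ([]=-irrelevant e′ e) p)
          (someWalk? m x v (λ w → P? (e ◅ w)))
      fromε : (Σ[ e ∈ u ≡ v ] P (subst (Walk G u) e ε)) → ∃[ w ] (walkLength w ≤ m × P w)
      fromε (refl , p) = ε , z≤n , p
      fromCons : ∀ m → Cons m → ∃[ w ] (walkLength w ≤ m × P w)
      fromCons (suc m) (x , e , w , le , p) = e ◅ w , s≤s le , p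
      split : ∀ m → (∃[ w ] (walkLength w ≤ m × P w)) →
              (Σ[ e ∈ u ≡ v ] P (subst (Walk G u) e ε)) ⊎ Cons m
      split m       (ε , _ , p)          = inj₁ (refl , p)
      split (suc m) (e ◅ w , s≤s le , p) = inj₂ (_ , e , w , le , p)

    -- A path visits at most n vertices, so a search among walks of at most n edges is complete.
    rainbowConnected? : ∀ {k} (c : EdgeColoring G k) → Dec (EdgeColoring.RainbowEdgeConnected c)
    rainbowConnected? {k} c = all? λ u → all? λ v → map′
      (λ (w , _ , pu) → w , pu) (λ (w , p , un) → w , path-length w p , p , un)
      (someWalk? n u v λ w → DecUnique.unique? _≟_ (vertices G w) ×-dec
                             DecUnique.unique? _≟_ (EdgeColoring.colors c w))

  anyVec? : ∀ {A : Set} → (∀ {P : A → Set} → (∀ a → Dec (P a)) → Dec (∃ P)) →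
            ∀ m {P : Vec A m → Set} → (∀ v → Dec (P v)) → Dec (∃ P)
  anyVec? any zero    P? = map′ ([] ,_) (λ { ([] , p) → p }) (P? [])
  anyVec? any (suc m) P? = map′ (λ (a , v , p) → a ∷ v , p) (λ { (a ∷ v , p) → a , v , p })
    (any λ a → anyVec? any m λ v → P? (a ∷ v))

  module _ {n} (G : Graph n) where

    -- A finite type to search through, standing in for colourings, which are functions on adjacency
    -- proofs.
    Table : ℕ → Set
    Table k = Vec (Vec (Fin k) n) n

    Symmetric : ∀ {k} → Table k → Set
    Symmetric t = ∀ u v → lookup (lookup t u) v ≡ lookup (lookup t v) u

    symmetric? : ∀ {k} (t : Table k) → Dec (Symmetric t)
    symmetric? t = all? λ u → all? λ v → lookup (lookup t u) v ≟ lookup (lookup t v) u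

    fromTable : ∀ {k} (t : Table k) → Symmetric t → EdgeColoring G k
    fromTable t sy = record
      { color     = λ {u} {v} _ → lookup (lookup t u) v
      ; symmetric = λ {u} {v} _ _ → sy u v }

    transfer : ∀ {k} (c c′ : EdgeColoring G k) →
      (∀ {u v} (e : Adj G u v) → EdgeColoring.color c e ≡ EdgeColoring.color c′ e) →
      EdgeColoring.RainbowEdgeConnected c → EdgeColoring.RainbowEdgeConnected c′
    transfer c c′ eq rc u v = let (w , p , un) = rc u v in w , p , subst Unique (agree w) un
      where
      agree : ∀ {u v} (w : Walk G u v) → EdgeColoring.colors c w ≡ EdgeColoring.colors c′ w
      agree ε       = refl
      agree (e ◅ w) = cong₂ _∷_ (eq e) (agree w)

    -- The number of colours is positive so that the table has an entry for pairs that are not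
    -- edges.
    colorable-suc? : Simple G → ∀ k → Dec (RainbowColorable G (suc k))
    colorable-suc? simple k = map′
      (λ (t , sy , rc) → fromTable t sy , rc) toTable
      (anyVec? (λ P? → anyVec? (λ Q? → any? Q?) n P?) n λ t → decide t)
      where
      Works : Table (suc k) → Set
      Works t = Σ[ sy ∈ Symmetric t ] EdgeColoring.RainbowEdgeConnected (fromTable t sy)
      decide : ∀ t → Dec (Works t)
      decide t with symmetric? t
      ... | no ¬sy = no (¬sy ∘ proj₁)
      ... | yes sy = map′ (sy ,_)
        (λ (sy′ , rc) → transfer (fromTable t sy′) (fromTable t sy) (λ _ → refl) rc)
        (rainbowConnected? G (fromTable t sy))
      toTable : RainbowColorable G (suc k) → ∃ Works
      toTable (c , rc) = t , sy , transfer c (fromTable t sy) agree rc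
        where
        open EdgeColoring c
        entry : ∀ u v → Dec (Adj G u v) → Fin (suc k)
        entry u v (yes e) = color e
        entry u v (no _)  = zero
        t : Table (suc k)
        t = tabulate λ u → tabulate λ v → entry u v (v ∈? lookup G u)
        t-entry : ∀ u v → lookup (lookup t u) v ≡ entry u v (v ∈? lookup G u)
        t-entry u v = trans (cong (λ r → lookup r v) (lookup∘tabulate _ u)) (lookup∘tabulate _ v)
        entry-sym : ∀ u v (p : Dec (Adj G u v)) (q : Dec (Adj G v u)) → entry u v p ≡ entry v u q
        entry-sym u v (yes e) (yes e′) = symmetric e e′
        entry-sym u v (yes e) (no ¬e′) = contradiction (proj₂ simple u v e) ¬e′
        entry-sym u v (no ¬e) (yes e′) = contradiction (proj₂ simple v u e′) ¬e
        entry-sym u v (no _)  (no _)   = refl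
        sy : Symmetric t
        sy u v = trans (t-entry u v) (trans (entry-sym u v (v ∈? lookup G u) (u ∈? lookup G v)) (sym (t-entry v u)))
        entry-color : ∀ {u v} (e : Adj G u v) p → color e ≡ entry u v p
        entry-color e (yes e′) = cong color ([]=-irrelevant e e′)
        entry-color e (no ¬e)  = contradiction e ¬e
        agree : ∀ {u v} (e : Adj G u v) → color e ≡ lookup (lookup t u) v
        agree {u} {v} e = trans (entry-color e (v ∈? lookup G u)) (sym (t-entry u v))

  least : {P : ℕ → Set} → (∀ k → Dec (P k)) → ∀ {m} → P m →
          ∃[ k ] (P k × (∀ j → P j → k ≤ j) × k ≤ m)
  least {P} P? {m} Pm = search m 0 (λ _ _ → z≤n) (ℕ.+-identityʳ m)
    where
    search : ∀ fuel i → (∀ j → P j → i ≤ j) → fuel ℕ.+ i ≡ m →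
             ∃[ k ] (P k × (∀ j → P j → k ≤ j) × k ≤ m)
    search fuel i below eq with P? i
    ... | yes Pi = i , Pi , below , subst (i ≤_) eq (ℕ.m≤n+m i fuel)
    search zero       i below refl | no ¬Pi = contradiction Pm ¬Pi
    search (suc fuel) i below eq   | no ¬Pi = search fuel (suc i)
      (λ j Pj → ℕ.≤∧≢⇒< (below j Pj) λ { refl → ¬Pi Pj }) (trans (ℕ.+-suc fuel i) eq)

  -- The minimum exists constructively because colourability is decidable for every number of
  -- colours; the edge rules out zero colours.
  rainbowConnectivity : ∀ {n} (G : Graph n) → Simple G → ∀ {u v} → Adj G u v → ∀ {m} →
    RainbowColorable G m → ∃[ k ] (RainbowConnectivity G k × k ≤ m)
  rainbowConnectivity G simple e Pm with least colorable? Pm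
    where
    colorable? : ∀ k → Dec (RainbowColorable G k)
    colorable? zero    = no λ (c , _) → no-colour (EdgeColoring.color c e)
      where
      no-colour : ¬ Fin 0
      no-colour ()
    colorable? (suc k) = colorable-suc? G simple k
  ... | k , Pk , below , k≤m = k , (Pk , below) , k≤m

  module _ {n} (G : Graph n) {k} (D : Fin n → Set) (col : Fin n → Fin n → Fin k)
           (col-sym : ∀ u v → col u v ≡ col v u) where

    edgeColoring : EdgeColoring G k
    edgeColoring = record
      { color = λ {u} {v} _ → col u v ; symmetric = λ {u} {v} _ _ → col-sym u v }

    rwalk⇒walk : ∀ {u v cs} → RWalk G D col u v cs →
                 ∃[ w ] (EdgeColoring.colors edgeColoring {u} {v} w ≡ cs)
    rwalk⇒walk stop         = ε , refl
    rwalk⇒walk (go e _ _ w) = let (w′ , eq) = rwalk⇒walk w in e ◅ w′ , cong (_ ∷_) eq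

    rainbow⇒colorable : (∀ u v → ∃[ cs ] (RWalk G D col u v cs × Unique cs)) → RainbowColorable G k
    rainbow⇒colorable h = edgeColoring , λ u v →
      let (cs , w , un) = h u v
          (w′ , eq) = rwalk⇒walk w
          (w″ , p , un″ , _) = loop-erasure G edgeColoring w′ (subst Unique (sym eq) un)
      in w″ , p , un″

-- What sparseness gives for a single graph.

module Structure where

  open Counting
  open Switching
  open FirstMoment
  open Growth
  open Rainbow
  open Connectivity
  open import Data.Fin using (Fin)
  open import Data.List using (List; []; _∷_; _++_; length; filter; allFin)
  open import Data.List.Properties using (length-++)
  open import Data.List.Membership.Propositional using (_∈_)
  open import Data.List.Membership.Propositional.Properties
  open import Data.List.Relation.Unary.Any using (here)
  open import Data.List.Relation.Unary.Unique.Propositional using (Unique)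
  import Data.List.Relation.Unary.Unique.Propositional.Properties as Unique
  open import Data.Nat hiding (_≟_)
  open import Data.Nat.Properties hiding (_≟_)
  open import Data.Nat.Tactic.RingSolver using (solve-∀)
  open import Data.Product using (_×_; _,_; proj₁; proj₂; ∃-syntax)
  open import Relation.Binary.Construct.Closure.ReflexiveTransitive using (ε; _◅_; _◅◅_)
  open import Relation.Binary.PropositionalEquality
  open import Relation.Nullary using (¬_; yes; no; contradiction)
  open import Relation.Unary using (Decidable)

  -- The size of the colour set of stage L: one initial colour and a fresh palette in each of the L
  -- stages.
  colours : ℕ → ℕ → ℕ
  colours L M = 1 + L * ((suc L + suc L) + (1 + suc M))

  module _ {r n M : ℕ} .{{_ : NonZero M}} (3≤r : 3 ≤ r) (G : Graph n)
    (simple : Simple G) (regular : Regular G r)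
    (sparse : ∀ {T : List (Fin n)} → T ∈ combos (length T) (allFin n) → 1 ≤ length T →
              M * length T ≤ n → 4 * length (internal G T) < 5 * length T) where

    -- All but one of the at least 3 s ordered edges starting in the set stay inside, so 3 s ≤ 2 i +
    -- 1. Were the set small, 4 i < 5 s would force s = 1; but a single vertex spans no edge, and 3
    -- ≤ 1 would follow.
    one-exit-large : ∀ {P : Fin n → Set} (P? : Decidable P) {y z} → P y →
      (∀ {a b} → P a → Adj G a b → ¬ P b → a ≡ y × b ≡ z) → n < M * length (vertexList P?)
    one-exit-large {P} P? {y} {z} Py leaving = ≰⇒> λ small →
      let 4i<5s = sparse (vertexList∈combos P?) 1≤s small in
      tiny (s≤1 4i<5s)
      where
      open ≤-Reasoning
      T = vertexList P?
      s = length T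
      i = length (internal G T)
      1≤s : 1 ≤ s
      1≤s = ∈-length (∈-vertexList⁺ P? Py)
      inner? : Decidable (λ ((a , b) : Fin n × Fin n) → P b)
      inner? (a , b) = P? b
      E = filter inner? (adjPairsAt G T)
      cover : ∀ {e} → e ∈ adjPairsAt G T → e ∈ E ++ (y , z) ∷ []
      cover {a , b} e∈ with P? b
      ... | yes Pb = ∈-++⁺ˡ (∈-filter⁺ inner? e∈ Pb)
      ... | no ¬Pb with leaving (∈-vertexList⁻ P? (proj₁ (∈-adjPairsAt⁻ G T e∈))) (proj₂ (∈-adjPairsAt⁻ G T e∈)) ¬Pb
      ...   | refl , refl = ∈-++⁺ʳ E (here refl)
      inside′ : ∀ {a b} → (a , b) ∈ E → a ∈ T × b ∈ T × Adj G a b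
      inside′ p = let (q , Pb) = ∈-filter⁻ inner? {xs = adjPairsAt G T} p
                      (a∈ , e) = ∈-adjPairsAt⁻ G T q in a∈ , ∈-vertexList⁺ P? Pb , e
      unique-pairs = unique-adjPairsAt G (unique-vertexList P?)
      3s≤2i+1 : s * 3 ≤ 2 * i + 1
      3s≤2i+1 = begin
        s * 3                          ≤⟨ *-monoʳ-≤ s 3≤r ⟩
        s * r                          ≤⟨ length-adjPairsAt-≥ G regular T ⟩
        length (adjPairsAt G T)        ≤⟨ unique-length-≤ unique-pairs cover ⟩
        length (E ++ (y , z) ∷ [])     ≡⟨ length-++ E ⟩
        length E + 1
          ≤⟨ +-monoˡ-≤ 1 (internal-bound G simple (Unique.filter⁺ inner? unique-pairs) inside′) ⟩
        2 * i + 1                      ∎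
      s≤1 : 4 * i < 5 * s → s ≤ 1
      s≤1 lt = ≤-pred (+-cancelˡ-< (5 * s) s 2 (begin-strict
        5 * s + s          ≡⟨ h s ⟩
        2 * (s * 3)        ≤⟨ *-monoʳ-≤ 2 3s≤2i+1 ⟩
        2 * (2 * i + 1)    ≡⟨ h′ i ⟩
        4 * i + 2          <⟨ +-monoˡ-< 2 lt ⟩
        5 * s + 2          ∎))
        where
        h : ∀ s → 5 * s + s ≡ 2 * (s * 3)
        h = solve-∀
        h′ : ∀ i → 2 * (2 * i + 1) ≡ 4 * i + 2
        h′ = solve-∀
      internal-≤1 : ∀ T → length T ≤ 1 → internal G T ≡ []
      internal-≤1 []           _         = refl
      internal-≤1 (_ ∷ [])     _         = refl
      internal-≤1 (_ ∷ _ ∷ _)  (s≤s ())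
      tiny : ¬ s ≤ 1
      tiny s≤1 = contradiction (begin
        3                ≤⟨ *-monoˡ-≤ 3 1≤s ⟩
        s * 3            ≤⟨ 3s≤2i+1 ⟩
        2 * i + 1        ≡⟨ cong (λ I → 2 * length I + 1) (internal-≤1 T s≤1) ⟩
        1                ∎) λ { (s≤s ()) }

    module _ (ρ : Fin n) (L : ℕ) (reached : ∀ v → Within G ρ L v) where

      private
        module T = BFS G ρ L

      connected : Connected G
      connected u v = walk (within-sym G simple (reached u)) ◅◅′ walk (reached v)
        where
        walk : ∀ {u v k} → Within G u k v → Walk G u v
        walk start      = ε
        walk (stay p)   = walk p
        walk (step p e) = walk p ◅◅ (e ◅ ε)
        _◅◅′_ = λ {u v w} (p : Walk G u v) (q : Walk G v w) → p ◅◅ q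

      few-colours : ∃[ k ] (RainbowConnectivity G k × k ≤ colours L M)
      few-colours = rainbowConnectivity G simple first-edge
        (rainbow⇒colorable G D col col-sym λ u v → rainbow (covers (T.depth≤L u)) (covers (T.depth≤L v)))
        where
        parent-spec : ∀ {v} → v ≢ ρ → Adj G (T.parent v) v × T.depth (T.parent v) < T.depth v
        parent-spec {v} v≢ρ = let (e , _ , lt) = T.parent-spec (reached v) v≢ρ in e , lt
        open RainbowColouring G simple ρ T.parent T.depth L M T.depth≤L parent-spec one-exit-large
        open Stage (stage L)
        nbrs-nonempty : ∃[ x ] x ∈ nbrs G ρ
        nbrs-nonempty with nbrs G ρ | length-nbrs {G = G} regular ρ
        ... | x ∷ _ | _ = x , here refl
        ... | []    | eq with () ← ≤-trans 3≤r (≤-reflexive (sym eq))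
        first-edge : Adj G ρ (proj₁ nbrs-nonempty)
        first-edge = ∈-elems⁻ _ (proj₂ nbrs-nonempty)

-- Rational numbers: order, powers and finite sums.

module RationalOrder where

  open import Data.Integer as ℤ using (+_)
  import Data.Integer.Properties as ℤ
  open import Data.Maybe using (just; nothing)
  open import Data.Nat as ℕ using (ℕ; zero; suc)
  import Data.Nat.Properties as ℕ
  open import Data.Product using (_,_; ∃-syntax)
  open import Data.Rational
  open import Data.Rational.Properties
  import Data.Rational.Unnormalised as ℚᵘ
  import Data.Rational.Unnormalised.Properties as ℚᵘ
  open import Data.Sum using (inj₁; inj₂)
  open import Relation.Binary.Definitions using (tri<; tri≈; tri>)
  open import Relation.Binary.PropositionalEquality
  open import Relation.Nullary using (¬_; yes; no; contradiction)
  open import Relation.Nullary.Decidable using (toWitness)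
  open import Tactic.RingSolver using (solve-∀)
  open import Tactic.RingSolver.Core.AlmostCommutativeRing using (AlmostCommutativeRing; fromCommutativeRing)

  ℚ-ring : AlmostCommutativeRing _ _
  ℚ-ring = fromCommutativeRing +-*-commutativeRing isZero
    where
    isZero : ∀ x → _
    isZero x with 0ℚ ≟ x
    ... | yes p = just p
    ... | no  _ = nothing

  0≤1 : 0ℚ ≤ 1ℚ
  0≤1 = toWitness {a? = 0ℚ ≤? 1ℚ} _

  0<1 : 0ℚ < 1ℚ
  0<1 = toWitness {a? = 0ℚ <? 1ℚ} _

  halve : ∀ a → (a + a) * ½ ≡ a
  halve a = trans (*-distribʳ-+ ½ a a) (trans (sym (*-distribˡ-+ a ½ ½)) (*-identityʳ a))

  *-monoˡ : ∀ {a b c} → 0ℚ ≤ c → a ≤ b → c * a ≤ c * b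
  *-monoˡ {c = c} 0≤c = *-monoˡ-≤-nonNeg c {{nonNegative 0≤c}}

  *-monoʳ : ∀ {a b c} → 0ℚ ≤ c → a ≤ b → a * c ≤ b * c
  *-monoʳ {c = c} 0≤c = *-monoʳ-≤-nonNeg c {{nonNegative 0≤c}}

  *-mono : ∀ {a b c d} → 0ℚ ≤ a → a ≤ b → 0ℚ ≤ c → c ≤ d → a * c ≤ b * d
  *-mono 0≤a a≤b 0≤c c≤d = ≤-trans (*-monoʳ 0≤c a≤b) (*-monoˡ (≤-trans 0≤a a≤b) c≤d)

  *-nonNeg : ∀ {a b} → 0ℚ ≤ a → 0ℚ ≤ b → 0ℚ ≤ a * b
  *-nonNeg {a} {b} 0≤a 0≤b = subst (_≤ a * b) (*-zeroˡ b) (*-monoʳ 0≤b 0≤a)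

  *-pos : ∀ {a b} → 0ℚ < a → 0ℚ < b → 0ℚ < a * b
  *-pos {a} {b} 0<a 0<b = subst (_< a * b) (*-zeroˡ b) (*-monoˡ-<-pos b {{positive 0<b}} 0<a)

  +-nonNeg : ∀ {a b} → 0ℚ ≤ a → 0ℚ ≤ b → 0ℚ ≤ a + b
  +-nonNeg {a} {b} 0≤a 0≤b = subst (_≤ a + b) (+-identityˡ 0ℚ) (+-mono-≤ 0≤a 0≤b)

  cancel-≤ : ∀ {a b c} → 0ℚ < c → a * c ≤ b * c → a ≤ b
  cancel-≤ {c = c} 0<c = *-cancelʳ-≤-pos c {{positive 0<c}}

  cancel-≡ : ∀ {a b c} → 0ℚ < c → a * c ≡ b * c → a ≡ b
  cancel-≡ 0<c e = ≤-antisym (cancel-≤ 0<c (≤-reflexive e)) (cancel-≤ 0<c (≤-reflexive (sym e)))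

  ≤-by : ∀ {a b} e → 0ℚ ≤ e → a + e ≡ b → a ≤ b
  ≤-by {a} {b} e 0≤e eq = subst₂ _≤_ (+-identityʳ a) eq (+-monoʳ-≤ a 0≤e)

  ≤-+ : ∀ {a e} → 0ℚ ≤ e → a ≤ a + e
  ≤-+ {a} {e} 0≤e = ≤-by e 0≤e refl

  0≤- : ∀ {a b} → a ≤ b → 0ℚ ≤ b - a
  0≤- {a} {b} a≤b = subst (_≤ b - a) (+-inverseʳ a) (+-monoˡ-≤ (- a) a≤b)

  0<- : ∀ {a b} → a < b → 0ℚ < b - a
  0<- {a} {b} a<b = subst (_< b - a) (+-inverseʳ a) (+-monoˡ-< (- a) a<b)

  /₀-* : ∀ p {q} → 0ℚ < q → (p /₀ q) * q ≡ p
  /₀-* p {q} 0<q with q ≟ 0ℚ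
  ... | yes refl = contradiction 0<q (<-irrefl refl)
  ... | no q≢0 = trans (*-assoc p (1/q) q) (trans (cong (p *_) (*-inverseˡ q {{≢-nonZero q≢0}})) (*-identityʳ p))
    where
    1/q : ℚ
    1/q = (1/ q) {{≢-nonZero q≢0}}

  /₀-unique : ∀ {p q x} → 0ℚ < q → x * q ≡ p → p /₀ q ≡ x
  /₀-unique {p} 0<q e = cancel-≡ 0<q (trans (/₀-* p 0<q) (sym e))

  /₀-≤ : ∀ {p q x} → 0ℚ < q → p ≤ x * q → p /₀ q ≤ x
  /₀-≤ {p} {q} {x} 0<q h = cancel-≤ 0<q (subst (_≤ x * q) (sym (/₀-* p 0<q)) h)

  ≤-/₀ : ∀ {p q x} → 0ℚ < q → x * q ≤ p → x ≤ p /₀ q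
  ≤-/₀ {p} {q} {x} 0<q h = cancel-≤ 0<q (subst (x * q ≤_) (sym (/₀-* p 0<q)) h)

  inv : ℚ → ℚ
  inv q = 1ℚ /₀ q

  inv-* : ∀ {q} → 0ℚ < q → inv q * q ≡ 1ℚ
  inv-* 0<q = /₀-* 1ℚ 0<q

  /₀≡*inv : ∀ p {q} → 0ℚ < q → p /₀ q ≡ p * inv q
  /₀≡*inv p {q} 0<q = /₀-unique 0<q
    (trans (*-assoc p (inv q) q) (trans (cong (p *_) (inv-* 0<q)) (*-identityʳ p)))

  0≤/₀ : ∀ {p q} → 0ℚ < q → 0ℚ ≤ p → 0ℚ ≤ p /₀ q
  0≤/₀ {p} {q} 0<q 0≤p = ≤-/₀ 0<q (subst (_≤ p) (sym (*-zeroˡ q)) 0≤p)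

  0≤inv : ∀ {q} → 0ℚ < q → 0ℚ ≤ inv q
  0≤inv 0<q = 0≤/₀ 0<q 0≤1

  inv-antimono : ∀ {p q} → 0ℚ < p → p ≤ q → inv q ≤ inv p
  inv-antimono {p} {q} 0<p p≤q = /₀-≤ (<-≤-trans 0<p p≤q)
    (subst (_≤ inv p * q) (inv-* 0<p) (*-monoˡ (0≤inv 0<p) p≤q))

  inv-pos : ∀ {q} → 0ℚ < q → 0ℚ < inv q
  inv-pos {q} 0<q with <-cmp 0ℚ (inv q)
  ... | tri< p _ _ = p
  ... | tri≈ _ e _ = contradiction
    (trans (sym (*-zeroˡ q)) (trans (cong (_* q) e) (inv-* 0<q))) (λ e → <⇒≢ 0<1 e)
  ... | tri> _ _ p = contradiction (0≤inv 0<q) (<⇒≱ p)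
    where
    <⇒≱ : ∀ {a b} → a < b → ¬ b ≤ a
    <⇒≱ p q = <-irrefl refl (<-≤-trans p q)

  private
    ℕ→ℚᵘ : ∀ n → toℚᵘ (ℕ→ℚ n) ℚᵘ.≃ ℚᵘ.mkℚᵘ (+ n) 0
    ℕ→ℚᵘ n = toℚᵘ-fromℚᵘ (ℚᵘ.mkℚᵘ (+ n) 0)

  ν-+ : ∀ m n → ℕ→ℚ (m ℕ.+ n) ≡ ℕ→ℚ m + ℕ→ℚ n
  ν-+ m n = toℚᵘ-injective (ℚᵘ.≃-trans (ℕ→ℚᵘ (m ℕ.+ n)) (ℚᵘ.≃-trans
    (ℚᵘ.*≡* (cong (ℤ._* + 1) (cong₂ ℤ._+_ (sym (ℤ.*-identityʳ (+ m))) (sym (ℤ.*-identityʳ (+ n))))))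
    (ℚᵘ.≃-sym (ℚᵘ.≃-trans (toℚᵘ-homo-+ (ℕ→ℚ m) (ℕ→ℚ n)) (ℚᵘ.+-cong (ℕ→ℚᵘ m) (ℕ→ℚᵘ n))))))

  ν-* : ∀ m n → ℕ→ℚ (m ℕ.* n) ≡ ℕ→ℚ m * ℕ→ℚ n
  ν-* m n = toℚᵘ-injective (ℚᵘ.≃-trans (ℕ→ℚᵘ (m ℕ.* n)) (ℚᵘ.≃-trans
    (ℚᵘ.*≡* (cong (ℤ._* + 1) (ℤ.pos-* m n)))
    (ℚᵘ.≃-sym (ℚᵘ.≃-trans (toℚᵘ-homo-* (ℕ→ℚ m) (ℕ→ℚ n)) (ℚᵘ.*-cong (ℕ→ℚᵘ m) (ℕ→ℚᵘ n))))))

  ν-suc : ∀ n → ℕ→ℚ (suc n) ≡ 1ℚ + ℕ→ℚ n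
  ν-suc n = ν-+ 1 n

  0≤ν : ∀ n → 0ℚ ≤ ℕ→ℚ n
  0≤ν zero    = ≤-refl
  0≤ν (suc n) = subst (0ℚ ≤_) (sym (ν-suc n)) (+-nonNeg 0≤1 (0≤ν n))

  ν-mono : ∀ {m n} → m ℕ.≤ n → ℕ→ℚ m ≤ ℕ→ℚ n
  ν-mono {m} {n} m≤n = ≤-by (ℕ→ℚ (n ℕ.∸ m)) (0≤ν (n ℕ.∸ m))
    (trans (sym (ν-+ m (n ℕ.∸ m))) (cong ℕ→ℚ (ℕ.m+[n∸m]≡n m≤n)))

  0<ν : ∀ n → 0ℚ < ℕ→ℚ (suc n)
  0<ν n = <-≤-trans 0<1 (ν-mono {1} {suc n} (ℕ.s≤s ℕ.z≤n))

  -- The denominator of q serves as N.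
  archimedes : ∀ {q} → 0ℚ < q → ∃[ N ] 1ℚ ≤ ℕ→ℚ N * q
  archimedes {q@(mkℚ (+ suc k) d-1 _)} 0<q = suc d-1 , toℚᵘ-cancel-≤ (ℚᵘ.≤-respʳ-≃
    (ℚᵘ.≃-sym (ℚᵘ.≃-trans (toℚᵘ-homo-* (ℕ→ℚ (suc d-1)) q)
                          (ℚᵘ.*-congʳ {toℚᵘ q} (ℕ→ℚᵘ (suc d-1)))))
    (ℚᵘ.*≤* (subst₂ ℤ._≤_ (sym lhs) (sym rhs) (ℤ.+≤+ (ℕ.m≤m*n (suc d-1) (suc k))))))
    where
    lhs : + 1 ℤ.* + (suc (d-1 ℕ.+ 0)) ≡ + (suc d-1)
    lhs = trans (ℤ.*-identityˡ _) (cong (λ z → + suc z) (ℕ.+-identityʳ d-1))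
    rhs : (+ (suc d-1) ℤ.* + suc k) ℤ.* + 1 ≡ + (suc d-1 ℕ.* suc k)
    rhs = trans (ℤ.*-identityʳ _) (sym (ℤ.pos-* (suc d-1) (suc k)))
  archimedes {mkℚ (+ zero) d-1 _} (*<* (ℤ.+<+ ()))
  archimedes {mkℚ (ℤ.-[1+ _ ]) d-1 _} (*<* ())

  ν-bound : ∀ q → ∃[ N ] q ≤ ℕ→ℚ N
  ν-bound q with ≤-total q 1ℚ
  ... | inj₁ q≤1 = 1 , q≤1
  ... | inj₂ 1≤q =
    let 0<q = <-≤-trans 0<1 1≤q
        (N , h) = archimedes (inv-pos 0<q)
    in N , cancel-≤ (inv-pos 0<q) (subst (_≤ ℕ→ℚ N * inv q) (trans (sym (inv-* 0<q)) (*-comm (inv q) q)) h)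

  infixr 8 _^_
  _^_ : ℚ → ℕ → ℚ
  _^_ = ℚ^._^_

  ^-nonNeg : ∀ {x} k → 0ℚ ≤ x → 0ℚ ≤ x ^ k
  ^-nonNeg zero    0≤x = 0≤1
  ^-nonNeg (suc k) 0≤x = *-nonNeg 0≤x (^-nonNeg k 0≤x)

  ^-mono : ∀ {x y} k → 0ℚ ≤ x → x ≤ y → x ^ k ≤ y ^ k
  ^-mono zero    0≤x x≤y = ≤-refl
  ^-mono (suc k) 0≤x x≤y = *-mono 0≤x x≤y (^-nonNeg k 0≤x) (^-mono k 0≤x x≤y)

  ^-+ : ∀ x i j → x ^ (i ℕ.+ j) ≡ x ^ i * x ^ j
  ^-+ x zero    j = sym (*-identityˡ (x ^ j))
  ^-+ x (suc i) j = trans (cong (x *_) (^-+ x i j)) (sym (*-assoc x (x ^ i) (x ^ j)))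

  ^-* : ∀ x y k → (x * y) ^ k ≡ x ^ k * y ^ k
  ^-* x y zero    = refl
  ^-* x y (suc k) = trans (cong (x * y *_) (^-* x y k)) (h x y (x ^ k) (y ^ k))
    where
    h : ∀ x y a b → x * y * (a * b) ≡ x * a * (y * b)
    h = solve-∀ ℚ-ring

  ^-double : ∀ x k → x ^ (2 ℕ.* k) ≡ (x * x) ^ k
  ^-double x k = trans (^-+ x k (k ℕ.+ 0)) (trans (cong (λ j → x ^ k * x ^ j) (ℕ.+-identityʳ k)) (sym (^-* x x k)))

  ^-≤1 : ∀ {x} k → 0ℚ ≤ x → x ≤ 1ℚ → x ^ k ≤ 1ℚ
  ^-≤1 zero    0≤x x≤1 = ≤-refl
  ^-≤1 {x} (suc k) 0≤x x≤1 = *-mono 0≤x x≤1 (^-nonNeg k 0≤x) (^-≤1 k 0≤x x≤1)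

  ^-antimono : ∀ {x} {i j} → 0ℚ ≤ x → x ≤ 1ℚ → i ℕ.≤ j → x ^ j ≤ x ^ i
  ^-antimono {x} {i} {j} 0≤x x≤1 i≤j = subst₂ _≤_
    (trans (sym (^-+ x i (j ℕ.∸ i))) (cong (x ^_) (ℕ.m+[n∸m]≡n i≤j))) (*-identityʳ (x ^ i))
    (*-monoˡ (^-nonNeg i 0≤x) (^-≤1 (j ℕ.∸ i) 0≤x x≤1))

  module _ {s t : ℚ} (0≤s : 0ℚ ≤ s) (s≤t : s ≤ t) where

    private
      0≤t = ≤-trans 0≤s s≤t
      0≤t-s = 0≤- s≤t

    -- Together with `pow-diff-≥` a mean value estimate: the difference quotient of t^(j+1) lies
    -- between (j+1) s^j and (j+1) t^j. It replaces derivatives for the terms of both power series.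
    pow-diff-≤ : ∀ j → t ^ suc j ≤ s ^ suc j + ℕ→ℚ (suc j) * (t ^ j * (t - s))
    pow-diff-≤ zero    = ≤-reflexive (h t s)
      where
      h : ∀ t s → t * 1ℚ ≡ s * 1ℚ + 1ℚ * (1ℚ * (t - s))
      h = solve-∀ ℚ-ring
    pow-diff-≤ (suc j) = begin
      t * t ^ suc j
        ≤⟨ *-monoˡ 0≤t (pow-diff-≤ j) ⟩
      t * (s ^ suc j + c * (t ^ j * (t - s)))
        ≡⟨ h t s (s ^ suc j) c (t ^ j) ⟩
      s ^ suc (suc j) + ((t - s) * s ^ suc j + c * (t * t ^ j * (t - s)))
        ≤⟨ +-monoʳ-≤ (s ^ suc (suc j)) (+-monoˡ-≤ _ (*-monoˡ 0≤t-s (^-mono (suc j) 0≤s s≤t))) ⟩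
      s ^ suc (suc j) + ((t - s) * (t * t ^ j) + c * (t * t ^ j * (t - s)))
        ≡⟨ h′ t s (s ^ suc (suc j)) c (t * t ^ j) ⟩
      s ^ suc (suc j) + (1ℚ + c) * (t * t ^ j * (t - s))
        ≡⟨ cong (λ z → s ^ suc (suc j) + z * (t * t ^ j * (t - s))) (ν-suc (suc j)) ⟨
      s ^ suc (suc j) + ℕ→ℚ (suc (suc j)) * (t ^ suc j * (t - s)) ∎
      where
      open ≤-Reasoning
      c = ℕ→ℚ (suc j)
      h : ∀ t s a c b → t * (a + c * (b * (t - s))) ≡ s * a + ((t - s) * a + c * (t * b * (t - s)))
      h = solve-∀ ℚ-ring
      h′ : ∀ t s a c b → a + ((t - s) * b + c * (b * (t - s))) ≡ a + (1ℚ + c) * (b * (t - s))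
      h′ = solve-∀ ℚ-ring

    pow-diff-≥ : ∀ j → s ^ suc j + ℕ→ℚ (suc j) * (s ^ j * (t - s)) ≤ t ^ suc j
    pow-diff-≥ zero    = ≤-reflexive (h t s)
      where
      h : ∀ t s → s * 1ℚ + 1ℚ * (1ℚ * (t - s)) ≡ t * 1ℚ
      h = solve-∀ ℚ-ring
    pow-diff-≥ (suc j) = begin
      s ^ suc (suc j) + ℕ→ℚ (suc (suc j)) * (s ^ suc j * (t - s))
        ≡⟨ cong (λ z → s ^ suc (suc j) + z * (s * s ^ j * (t - s))) (ν-suc (suc j)) ⟩
      s ^ suc (suc j) + (1ℚ + c) * (s * s ^ j * (t - s))
        ≡⟨ h t s (s ^ suc j) c (s ^ j) ⟩
      s ^ suc (suc j) + ((t - s) * (s * s ^ j) + s * (c * (s ^ j * (t - s))))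
        ≤⟨ +-monoʳ-≤ (s ^ suc (suc j)) (+-monoʳ-≤ ((t - s) * (s * s ^ j))
             (*-monoʳ (*-nonNeg (0≤ν (suc j)) (*-nonNeg (^-nonNeg j 0≤s) 0≤t-s)) s≤t)) ⟩
      s ^ suc (suc j) + ((t - s) * (s * s ^ j) + t * (c * (s ^ j * (t - s))))
        ≡⟨ h′ t s (s ^ suc j) (c * (s ^ j * (t - s))) ⟩
      t * (s ^ suc j + c * (s ^ j * (t - s)))
        ≤⟨ *-monoˡ 0≤t (pow-diff-≥ j) ⟩
      t * t ^ suc j ∎
      where
      open ≤-Reasoning
      c = ℕ→ℚ (suc j)
      h : ∀ t s a c b → s * a + (1ℚ + c) * (s * b * (t - s)) ≡ s * a + ((t - s) * (s * b) + s * (c * (b * (t - s))))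
      h = solve-∀ ℚ-ring
      h′ : ∀ t s a b → s * a + ((t - s) * a + t * b) ≡ t * (a + b)
      h′ = solve-∀ ℚ-ring

  ∑-mono : ∀ m {f g : ℕ → ℚ} → (∀ k → k ℕ.< m → f k ≤ g k) → ∑< m f ≤ ∑< m g
  ∑-mono zero    h = ≤-refl
  ∑-mono (suc m) h = +-mono-≤ (∑-mono m (λ k lt → h k (ℕ.m≤n⇒m≤1+n lt))) (h m ℕ.≤-refl)

  ∑-+ : ∀ m (f g : ℕ → ℚ) → ∑< m (λ k → f k + g k) ≡ ∑< m f + ∑< m g
  ∑-+ zero    f g = refl
  ∑-+ (suc m) f g = trans (cong (_+ (f m + g m)) (∑-+ m f g)) (h (∑< m f) (∑< m g) (f m) (g m))
    where
    h : ∀ a b c d → a + b + (c + d) ≡ a + c + (b + d)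
    h = solve-∀ ℚ-ring

  ∑-* : ∀ m c (f : ℕ → ℚ) → ∑< m (λ k → c * f k) ≡ c * ∑< m f
  ∑-* zero    c f = sym (*-zeroʳ c)
  ∑-* (suc m) c f = trans (cong (_+ c * f m) (∑-* m c f)) (sym (*-distribˡ-+ c (∑< m f) (f m)))

  ∑-nonNeg : ∀ m {f : ℕ → ℚ} → (∀ k → 0ℚ ≤ f k) → 0ℚ ≤ ∑< m f
  ∑-nonNeg zero    h = ≤-refl
  ∑-nonNeg (suc m) h = +-nonNeg (∑-nonNeg m h) (h m)

  ∑-extend : ∀ {m n} {f : ℕ → ℚ} → (∀ k → 0ℚ ≤ f k) → m ℕ.≤ n → ∑< m f ≤ ∑< n f
  ∑-extend {m} {n} {f} h m≤n = go (ℕ.≤⇒≤′ m≤n)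
    where
    go : ∀ {n} → m ℕ.≤′ n → ∑< m f ≤ ∑< n f
    go ℕ.≤′-refl     = ≤-refl
    go (ℕ.≤′-step p) = ≤-trans (go p) (≤-+ (h _))

  ∑-suc : ∀ m (f : ℕ → ℚ) → ∑< (suc m) f ≡ f 0 + ∑< m (λ k → f (suc k))
  ∑-suc zero    f = +-comm 0ℚ (f 0)
  ∑-suc (suc m) f = trans (cong (_+ f (suc m)) (∑-suc m f)) (+-assoc (f 0) _ _)

-- Cauchy sequences, and power series with varying argument.

module Limits where

  open RationalOrder
  open import Data.Nat as ℕ using (ℕ; zero; suc)
  import Data.Nat.Properties as ℕ
  open import Data.Product using (_×_; _,_; ∃-syntax)
  open import Data.Rational
  open import Data.Rational.Properties
  open import Data.Sum using (inj₁; inj₂)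
  open import Relation.Binary.PropositionalEquality
  open import Tactic.RingSolver using (solve-∀)

  -- The scale factor K spares dividing δ at every use.
  Cauchy : RealSeq → Set
  Cauchy x = ∃[ K ] (0ℚ ≤ K × (∀ δ → 0ℚ < δ →
    ∃[ N ] (∀ m n → N ℕ.≤ m → N ℕ.≤ n → x m ≤ x n + K * δ)))

  Eventually : (ℕ → Set) → Set
  Eventually P = ∃[ N ] (∀ m → N ℕ.≤ m → P m)

  infixr 4 _⊗_
  _⊗_ : {P Q : ℕ → Set} → Eventually P → Eventually Q → Eventually (λ m → P m × Q m)
  (N , p) ⊗ (M , q) = N ℕ.⊔ M , λ m le →
    p m (ℕ.≤-trans (ℕ.m≤m⊔n N M) le) , q m (ℕ.≤-trans (ℕ.m≤n⊔m N M) le)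

  ev-map : {P Q : ℕ → Set} → (∀ {m} → P m → Q m) → Eventually P → Eventually Q
  ev-map f (N , p) = N , λ m le → f (p m le)

  always : {P : ℕ → Set} → (∀ m → P m) → Eventually P
  always p = 0 , λ m _ → p m

  Bounded : ℚ → ℚ → RealSeq → Set
  Bounded a b x = Eventually λ m → a ≤ x m × x m ≤ b

  -- The one-sided bound is applied to (m , n) and to (n , m). Dividing δ by 1 + K instead of K also
  -- covers K = 0.
  cauchy⇒convergent : ∀ {x} → Cauchy x → Convergent x
  cauchy⇒convergent {x} (K , 0≤K , h) δ 0<δ with h (δ * inv (1ℚ + K)) (*-pos 0<δ (inv-pos 0<1+K))
    where
    0<1+K : 0ℚ < 1ℚ + K
    0<1+K = <-≤-trans 0<1 (≤-+ 0≤K)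
  ... | N , bound = N , λ m n p q → abs-≤ (one-sided m n p q) (subst (_≤ δ) (swap-sub (x m) (x n)) (one-sided n m q p))
    where
    0<1+K : 0ℚ < 1ℚ + K
    0<1+K = <-≤-trans 0<1 (≤-+ 0≤K)
    Kε≤δ : K * (δ * inv (1ℚ + K)) ≤ δ
    Kε≤δ = begin
      K * (δ * inv (1ℚ + K))           ≤⟨ *-monoʳ (*-nonNeg (<⇒≤ 0<δ) (0≤inv 0<1+K)) (≤-by {K} 1ℚ 0≤1 (+-comm K 1ℚ)) ⟩
      (1ℚ + K) * (δ * inv (1ℚ + K))    ≡⟨ g (1ℚ + K) δ (inv (1ℚ + K)) ⟩
      δ * (inv (1ℚ + K) * (1ℚ + K))    ≡⟨ cong (δ *_) (inv-* 0<1+K) ⟩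
      δ * 1ℚ                           ≡⟨ *-identityʳ δ ⟩
      δ                                ∎
      where
      open ≤-Reasoning
      g : ∀ a d b → a * (d * b) ≡ d * (b * a)
      g = solve-∀ ℚ-ring
    one-sided : ∀ m n → N ℕ.≤ m → N ℕ.≤ n → x m - x n ≤ δ
    one-sided m n p q = begin
      x m - x n                                 ≤⟨ +-monoˡ-≤ (- x n) (bound m n p q) ⟩
      x n + K * (δ * inv (1ℚ + K)) - x n        ≡⟨ g (x n) (K * (δ * inv (1ℚ + K))) ⟩
      K * (δ * inv (1ℚ + K))                    ≤⟨ Kε≤δ ⟩
      δ                                         ∎
      where
      open ≤-Reasoning
      g : ∀ a b → a + b - a ≡ b
      g = solve-∀ ℚ-ring
    swap-sub : ∀ a b → b - a ≡ - (a - b)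
    swap-sub = solve-∀ ℚ-ring
    abs-≤ : ∀ {a b} → a ≤ b → - a ≤ b → ∣ a ∣ ≤ b
    abs-≤ {a} p q with ∣p∣≡p∨∣p∣≡-p a
    ... | inj₁ e = subst (_≤ _) (sym e) p
    ... | inj₂ e = subst (_≤ _) (sym e) q

  cauchy-const : ∀ c → Cauchy (λ _ → c)
  cauchy-const c = 0ℚ , ≤-refl , λ δ _ → 0 , λ _ _ _ _ →
    ≤-reflexive (trans (sym (+-identityʳ c)) (cong (λ z → c + z) (sym (*-zeroˡ δ))))

  cauchy-shift : ∀ {x} c → Cauchy x → Cauchy (λ m → x m + c)
  cauchy-shift {x} c (K , 0≤K , h) = K , 0≤K , λ δ 0<δ → let (N , b) = h δ 0<δ in
    N , λ m n p q → subst (x m + c ≤_) (g (x n) (K * δ) c) (+-monoˡ-≤ c (b m n p q))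
    where
    g : ∀ a b c → a + b + c ≡ a + c + b
    g = solve-∀ ℚ-ring

  cauchy-ext : ∀ {x y} → Eventually (λ m → x m ≡ y m) → Cauchy x → Cauchy y
  cauchy-ext {x} {y} (M , e) (K , 0≤K , h) = K , 0≤K , λ δ 0<δ → let (N , b) = h δ 0<δ in
    M ℕ.⊔ N , λ m n p q → subst₂ (λ a b → a ≤ b + K * δ)
      (e m (ℕ.≤-trans (ℕ.m≤m⊔n M N) p)) (e n (ℕ.≤-trans (ℕ.m≤m⊔n M N) q))
      (b m n (ℕ.≤-trans (ℕ.m≤n⊔m M N) p) (ℕ.≤-trans (ℕ.m≤n⊔m M N) q))

  cauchy-bounded : ∀ {x} → Cauchy x → ∃[ X ] Eventually (λ m → x m ≤ X)
  cauchy-bounded {x} (K , _ , h) = let (N , b) = h 1ℚ 0<1 in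
    x N + K * 1ℚ , N , λ m le → b m N le ℕ.≤-refl

  -- Restricted to nonnegative factors, for which one-sided bounds can be multiplied.
  cauchy-* : ∀ {x y X Y} → 0ℚ ≤ X → 0ℚ ≤ Y → Bounded 0ℚ X x → Bounded 0ℚ Y y →
             Cauchy x → Cauchy y → Cauchy (x *ʳ y)
  cauchy-* {x} {y} {X} {Y} 0≤X 0≤Y bx by (K , 0≤K , h) (L , 0≤L , g) =
    X * L + K * Y , +-nonNeg (*-nonNeg 0≤X 0≤L) (*-nonNeg 0≤K 0≤Y) , λ δ 0<δ →
      let (N , both) = bx ⊗ by
          (N₁ , b₁) = h δ 0<δ
          (N₂ , b₂) = g δ 0<δ
      in N ℕ.⊔ (N₁ ℕ.⊔ N₂) , λ m n p q →
        let N≤ = ℕ.m≤m⊔n N (N₁ ℕ.⊔ N₂)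
            N₁≤ = ℕ.≤-trans (ℕ.m≤m⊔n N₁ N₂) (ℕ.m≤n⊔m N (N₁ ℕ.⊔ N₂))
            N₂≤ = ℕ.≤-trans (ℕ.m≤n⊔m N₁ N₂) (ℕ.m≤n⊔m N (N₁ ℕ.⊔ N₂))
            ((0≤xm , xm≤X) , _) = both m (ℕ.≤-trans N≤ p)
            (_ , (0≤yn , yn≤Y)) = both n (ℕ.≤-trans N≤ q)
        in main δ {x m} {x n} {y m} {y n} (<⇒≤ 0<δ) 0≤xm xm≤X 0≤yn yn≤Y
             (b₁ m n (ℕ.≤-trans N₁≤ p) (ℕ.≤-trans N₁≤ q))
             (b₂ m n (ℕ.≤-trans N₂≤ p) (ℕ.≤-trans N₂≤ q))
    where
    open ≤-Reasoning
    r₁ : ∀ a b c → a * (b + c) ≡ a * b + a * c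
    r₁ = solve-∀ ℚ-ring
    r₂ : ∀ xn K δ yn X L → (xn + K * δ) * yn + X * (L * δ) ≡ xn * yn + (X * L * δ + K * δ * yn)
    r₂ = solve-∀ ℚ-ring
    r₃ : ∀ xy X L K Y δ → xy + (X * L * δ + K * δ * Y) ≡ xy + (X * L + K * Y) * δ
    r₃ = solve-∀ ℚ-ring
    main : ∀ δ {xm xn ym yn} → 0ℚ ≤ δ → 0ℚ ≤ xm → xm ≤ X → 0ℚ ≤ yn → yn ≤ Y →
           xm ≤ xn + K * δ → ym ≤ yn + L * δ → xm * ym ≤ xn * yn + (X * L + K * Y) * δ
    main δ {xm} {xn} {ym} {yn} 0≤δ 0≤xm xm≤X 0≤yn yn≤Y p q = begin
      xm * ym                          ≤⟨ *-monoˡ 0≤xm q ⟩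
      xm * (yn + L * δ)                ≡⟨ r₁ xm yn (L * δ) ⟩
      xm * yn + xm * (L * δ)           ≤⟨ +-mono-≤ (*-monoʳ 0≤yn p) (*-monoʳ (*-nonNeg 0≤L 0≤δ) xm≤X) ⟩
      (xn + K * δ) * yn + X * (L * δ)  ≡⟨ r₂ xn K δ yn X L ⟩
      xn * yn + (X * L * δ + K * δ * yn)
        ≤⟨ +-monoʳ-≤ (xn * yn) (+-monoʳ-≤ (X * L * δ) (*-monoˡ (*-nonNeg 0≤K 0≤δ) yn≤Y)) ⟩
      xn * yn + (X * L * δ + K * δ * Y) ≡⟨ r₃ (xn * yn) X L K Y δ ⟩
      xn * yn + (X * L + K * Y) * δ    ∎

  cauchy-inv : ∀ {y c} → 0ℚ < c → Eventually (λ m → c ≤ y m) → Cauchy y → Cauchy (λ m → inv (y m))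
  cauchy-inv {y} {c} 0<c (N , low) (K , 0≤K , h) =
    K * (inv c * inv c) , *-nonNeg 0≤K (*-nonNeg (0≤inv 0<c) (0≤inv 0<c)) , λ δ 0<δ →
      let (N₁ , b) = h δ 0<δ in N ℕ.⊔ N₁ , λ m n p q →
        main δ (<⇒≤ 0<δ) (low m (ℕ.≤-trans (ℕ.m≤m⊔n N N₁) p)) (low n (ℕ.≤-trans (ℕ.m≤m⊔n N N₁) q))
          (b n m (ℕ.≤-trans (ℕ.m≤n⊔m N N₁) q) (ℕ.≤-trans (ℕ.m≤n⊔m N N₁) p))
    where
    open ≤-Reasoning
    r₂ : ∀ a b y → a * (b * y) ≡ y * (b * a)
    r₂ = solve-∀ ℚ-ring
    r₃ : ∀ ym K δ a b → (ym + K * δ) * (a * b) ≡ a * (b * ym) + K * (a * b) * δ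
    r₃ = solve-∀ ℚ-ring
    main : ∀ δ {ym yn} → 0ℚ ≤ δ → c ≤ ym → c ≤ yn → yn ≤ ym + K * δ →
           inv ym ≤ inv yn + K * (inv c * inv c) * δ
    main δ {ym} {yn} 0≤δ c≤ym c≤yn p = begin
      inv ym                           ≡⟨ *-identityʳ (inv ym) ⟨
      inv ym * 1ℚ                      ≡⟨ cong (inv ym *_) (inv-* 0<yn) ⟨
      inv ym * (inv yn * yn)           ≡⟨ r₂ (inv ym) (inv yn) yn ⟩
      yn * (inv yn * inv ym)           ≤⟨ *-monoʳ (*-nonNeg (0≤inv 0<yn) (0≤inv 0<ym)) p ⟩
      (ym + K * δ) * (inv yn * inv ym) ≡⟨ r₃ ym K δ (inv yn) (inv ym) ⟩
      inv yn * (inv ym * ym) + K * (inv yn * inv ym) * δ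
        ≡⟨ cong (_+ K * (inv yn * inv ym) * δ) (trans (cong (inv yn *_) (inv-* 0<ym)) (*-identityʳ (inv yn))) ⟩
      inv yn + K * (inv yn * inv ym) * δ
        ≤⟨ +-monoʳ-≤ (inv yn) (*-monoʳ 0≤δ (*-monoˡ 0≤K
             (*-mono (0≤inv 0<yn) (inv-antimono 0<c c≤yn) (0≤inv 0<ym) (inv-antimono 0<c c≤ym)))) ⟩
      inv yn + K * (inv c * inv c) * δ ∎
      where
      0<ym = <-≤-trans 0<c c≤ym
      0<yn = <-≤-trans 0<c c≤yn

  geometric-closed : ∀ ρ m → ∑< m (ρ ^_) * (1ℚ - ρ) ≡ 1ℚ - ρ ^ m
  geometric-closed ρ zero    = g₀ ρ
    where
    g₀ : ∀ ρ → 0ℚ * (1ℚ - ρ) ≡ 1ℚ - 1ℚ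
    g₀ = solve-∀ ℚ-ring
  geometric-closed ρ (suc m) = trans (g₁ (∑< m (ρ ^_)) (ρ ^ m) ρ)
    (trans (cong (_+ ρ ^ m * (1ℚ - ρ)) (geometric-closed ρ m)) (g₂ (ρ ^ m) ρ))
    where
    g₁ : ∀ s a ρ → (s + a) * (1ℚ - ρ) ≡ s * (1ℚ - ρ) + a * (1ℚ - ρ)
    g₁ = solve-∀ ℚ-ring
    g₂ : ∀ a ρ → 1ℚ - a + a * (1ℚ - ρ) ≡ 1ℚ - ρ * a
    g₂ = solve-∀ ℚ-ring

  geometric-bound : ∀ {ρ} m → 0ℚ ≤ ρ → ρ < 1ℚ → ∑< m (ρ ^_) ≤ inv (1ℚ - ρ)
  geometric-bound {ρ} m 0≤ρ ρ<1 = ≤-/₀ (0<- ρ<1) (subst (_≤ 1ℚ) (sym (geometric-closed ρ m))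
    (≤-by (ρ ^ m) (^-nonNeg m 0≤ρ) (g (ρ ^ m))))
    where
    g : ∀ a → 1ℚ - a + a ≡ 1ℚ
    g = solve-∀ ℚ-ring

  -- By Bernoulli's inequality in the form ρ^n (1 + n (1 - ρ)) ≤ 1.
  powers-vanish : ∀ {ρ} → 0ℚ ≤ ρ → ρ < 1ℚ → ∀ δ → 0ℚ < δ → ∃[ N ] (∀ n → N ℕ.≤ n → ρ ^ n ≤ δ)
  powers-vanish {ρ} 0≤ρ ρ<1 δ 0<δ with archimedes (*-pos (0<- ρ<1) 0<δ)
  ... | N , big = N , λ n N≤n → ≤-trans (^-antimono 0≤ρ (<⇒≤ ρ<1) N≤n) small
    where
    open ≤-Reasoning
    h = 1ℚ - ρ
    0≤h : 0ℚ ≤ h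
    0≤h = <⇒≤ (0<- ρ<1)
    r₀ : ∀ ρ → 1ℚ * (1ℚ + 0ℚ * (1ℚ - ρ)) ≡ 1ℚ
    r₀ = solve-∀ ℚ-ring
    r₁ : ∀ ρ a n → ρ * a * (1ℚ + (1ℚ + n) * (1ℚ - ρ)) + a * (1ℚ + n) * ((1ℚ - ρ) * (1ℚ - ρ)) ≡ a * (1ℚ + n * (1ℚ - ρ))
    r₁ = solve-∀ ℚ-ring
    bernoulli : ∀ n → ρ ^ n * (1ℚ + ℕ→ℚ n * h) ≤ 1ℚ
    bernoulli zero    = ≤-reflexive (r₀ ρ)
    bernoulli (suc n) = ≤-trans
      (subst (λ z → ρ * ρ ^ n * (1ℚ + z * h) ≤ ρ ^ n * (1ℚ + ℕ→ℚ n * h)) (sym (ν-suc n))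
        (≤-by (ρ ^ n * (1ℚ + ℕ→ℚ n) * (h * h))
          (*-nonNeg (*-nonNeg (^-nonNeg n 0≤ρ) (+-nonNeg 0≤1 (0≤ν n))) (*-nonNeg 0≤h 0≤h))
          (r₁ ρ (ρ ^ n) (ℕ→ℚ n))))
      (bernoulli n)
    r₂ : ∀ a n h δ → a * (n * (h * δ)) ≡ a * (n * h) * δ
    r₂ = solve-∀ ℚ-ring
    small : ρ ^ N ≤ δ
    small = begin
      ρ ^ N                          ≡⟨ *-identityʳ (ρ ^ N) ⟨
      ρ ^ N * 1ℚ                     ≤⟨ *-monoˡ (^-nonNeg N 0≤ρ) big ⟩
      ρ ^ N * (ℕ→ℚ N * (h * δ))      ≡⟨ r₂ (ρ ^ N) (ℕ→ℚ N) h δ ⟩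
      ρ ^ N * (ℕ→ℚ N * h) * δ
        ≤⟨ *-monoʳ (<⇒≤ 0<δ) (*-monoˡ (^-nonNeg N 0≤ρ) (≤-by 1ℚ 0≤1 (+-comm (ℕ→ℚ N * h) 1ℚ))) ⟩
      ρ ^ N * (1ℚ + ℕ→ℚ N * h) * δ   ≤⟨ *-monoʳ (<⇒≤ 0<δ) (bernoulli N) ⟩
      1ℚ * δ                         ≡⟨ *-identityˡ δ ⟩
      δ                              ∎

  module _ (a : ℚ → ℕ → ℚ) {Q B ρ : ℚ} (0≤B : 0ℚ ≤ B) (0≤ρ : 0ℚ ≤ ρ) (ρ<1 : ρ < 1ℚ)
    (nonNeg : ∀ {t} k → 0ℚ ≤ t → 0ℚ ≤ a t k)
    (bound : ∀ {t} k → 0ℚ ≤ t → t ≤ Q → a t k ≤ B * ρ ^ k)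
    (mono : ∀ {s t} k → 0ℚ ≤ s → s ≤ t → a s k ≤ a t k)
    (lipschitz : ∀ {s t} k → 0ℚ ≤ s → s ≤ t → t ≤ Q → a t k ≤ a s k + B * ρ ^ k * (t - s)) where

    private
      w = inv (1ℚ - ρ)
      0≤w : 0ℚ ≤ w
      0≤w = 0≤inv (0<- ρ<1)
      0≤Bw : 0ℚ ≤ B * w
      0≤Bw = *-nonNeg 0≤B 0≤w
      F : ℕ → ℚ → ℚ
      F m t = ∑< m (a t)

      move-argument : ∀ m {s t ε} → 0ℚ ≤ s → 0ℚ ≤ t → t ≤ Q → 0ℚ ≤ ε → t ≤ s + ε → F m t ≤ F m s + B * w * ε
      move-argument m {s} {t} {ε} 0≤s 0≤t t≤Q 0≤ε t≤s+ε with ≤-total s t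
      ... | inj₂ t≤s = ≤-trans (∑-mono m λ k _ → mono k 0≤t t≤s) (≤-+ (*-nonNeg 0≤Bw 0≤ε))
      ... | inj₁ s≤t = begin
        ∑< m (a t)
          ≤⟨ ∑-mono m (λ k _ → lipschitz k 0≤s s≤t t≤Q) ⟩
        ∑< m (λ k → a s k + B * ρ ^ k * (t - s))
          ≡⟨ ∑-+ m (a s) (λ k → B * ρ ^ k * (t - s)) ⟩
        F m s + ∑< m (λ k → B * ρ ^ k * (t - s))
          ≡⟨ cong (λ z → F m s + z) (trans (∑-cong m (λ k → r B (ρ ^ k) (t - s))) (∑-* m (B * (t - s)) (ρ ^_))) ⟩
        F m s + B * (t - s) * ∑< m (ρ ^_)
          ≤⟨ +-monoʳ-≤ (F m s) (*-mono (*-nonNeg 0≤B (0≤- s≤t)) (*-monoˡ 0≤B t-s≤ε)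
               (∑-nonNeg m (λ k → ^-nonNeg k 0≤ρ)) (geometric-bound m 0≤ρ ρ<1)) ⟩
        F m s + B * ε * w
          ≡⟨ cong (λ z → F m s + z) (r B ε w) ⟩
        F m s + B * w * ε ∎
        where
        open ≤-Reasoning
        r : ∀ a b c → a * b * c ≡ a * c * b
        r = solve-∀ ℚ-ring
        r′ : ∀ s ε → s + ε - s ≡ ε
        r′ = solve-∀ ℚ-ring
        t-s≤ε : t - s ≤ ε
        t-s≤ε = subst (t - s ≤_) (r′ s ε) (+-monoˡ-≤ (- s) t≤s+ε)
        ∑-cong : ∀ m {f g : ℕ → ℚ} → (∀ k → f k ≡ g k) → ∑< m f ≡ ∑< m g
        ∑-cong zero    h = refl
        ∑-cong (suc m) h = cong₂ _+_ (∑-cong m h) (h m)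

      tail : ∀ n j {t} → 0ℚ ≤ t → t ≤ Q → F (j ℕ.+ n) t ≤ F n t + B * ρ ^ n * ∑< j (ρ ^_)
      tail n zero    {t} 0≤t t≤Q = ≤-+ (*-nonNeg (*-nonNeg 0≤B (^-nonNeg n 0≤ρ)) ≤-refl)
      tail n (suc j) {t} 0≤t t≤Q = begin
        F (j ℕ.+ n) t + a t (j ℕ.+ n)
          ≤⟨ +-mono-≤ (tail n j 0≤t t≤Q) (bound (j ℕ.+ n) 0≤t t≤Q) ⟩
        F n t + B * ρ ^ n * ∑< j (ρ ^_) + B * ρ ^ (j ℕ.+ n)
          ≡⟨ cong (λ z → F n t + B * ρ ^ n * ∑< j (ρ ^_) + B * z) (^-+ ρ j n) ⟩
        F n t + B * ρ ^ n * ∑< j (ρ ^_) + B * (ρ ^ j * ρ ^ n)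
          ≡⟨ r (F n t) B (ρ ^ n) (∑< j (ρ ^_)) (ρ ^ j) ⟩
        F n t + B * ρ ^ n * (∑< j (ρ ^_) + ρ ^ j) ∎
        where
        open ≤-Reasoning
        r : ∀ f b p s q → f + b * p * s + b * (q * p) ≡ f + b * p * (s + q)
        r = solve-∀ ℚ-ring

      change-length : ∀ {m n t ε} → 0ℚ ≤ t → t ≤ Q → 0ℚ ≤ ε → ρ ^ n ≤ ε → F m t ≤ F n t + B * w * ε
      change-length {m} {n} {t} {ε} 0≤t t≤Q 0≤ε small with ℕ.≤-total m n
      ... | inj₁ m≤n = ≤-trans (∑-extend (λ k → nonNeg k 0≤t) m≤n) (≤-+ (*-nonNeg 0≤Bw 0≤ε))
      ... | inj₂ n≤m = begin
        F m t                        ≡⟨ cong (λ k → F k t) (ℕ.m∸n+n≡m n≤m) ⟨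
        F (m ℕ.∸ n ℕ.+ n) t          ≤⟨ tail n (m ℕ.∸ n) 0≤t t≤Q ⟩
        F n t + B * ρ ^ n * ∑< (m ℕ.∸ n) (ρ ^_)
          ≤⟨ +-monoʳ-≤ (F n t) (*-mono (*-nonNeg 0≤B (^-nonNeg n 0≤ρ)) (*-monoˡ 0≤B small)
               (∑-nonNeg (m ℕ.∸ n) (λ k → ^-nonNeg k 0≤ρ)) (geometric-bound (m ℕ.∸ n) 0≤ρ ρ<1)) ⟩
        F n t + B * ε * w            ≡⟨ cong (λ z → F n t + z) (r B ε w) ⟩
        F n t + B * w * ε            ∎
        where
        open ≤-Reasoning
        r : ∀ a b c → a * b * c ≡ a * c * b
        r = solve-∀ ℚ-ring

    -- Argument and truncation index both change with m. The argument is moved first, at a fixed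
    -- index, with the Lipschitz constant B / (1 - ρ) common to all indices; then the tail is cut by
    -- the geometric majorant.
    cauchy-series : ∀ {x} → Bounded 0ℚ Q x → Cauchy x → Cauchy (λ m → ∑< m (a (x m)))
    cauchy-series {x} (N , bd) (K , 0≤K , h) =
      B * w * K + B * w , +-nonNeg (*-nonNeg 0≤Bw 0≤K) 0≤Bw , λ δ 0<δ →
        let (N₁ , near) = h δ 0<δ
            (N₂ , small) = powers-vanish 0≤ρ ρ<1 δ 0<δ
            N≤ = ℕ.m≤m⊔n N (N₁ ℕ.⊔ N₂)
            N₁≤ = ℕ.≤-trans (ℕ.m≤m⊔n N₁ N₂) (ℕ.m≤n⊔m N (N₁ ℕ.⊔ N₂))
            N₂≤ = ℕ.≤-trans (ℕ.m≤n⊔m N₁ N₂) (ℕ.m≤n⊔m N (N₁ ℕ.⊔ N₂))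
        in N ℕ.⊔ (N₁ ℕ.⊔ N₂) , λ m n p q →
          let (0≤xm , xm≤Q) = bd m (ℕ.≤-trans N≤ p)
              (0≤xn , xn≤Q) = bd n (ℕ.≤-trans N≤ q)
              0≤δ = <⇒≤ 0<δ
          in begin
            F m (x m)
              ≤⟨ move-argument m 0≤xn 0≤xm xm≤Q (*-nonNeg 0≤K 0≤δ)
                   (near m n (ℕ.≤-trans N₁≤ p) (ℕ.≤-trans N₁≤ q)) ⟩
            F m (x n) + B * w * (K * δ)
              ≤⟨ +-monoˡ-≤ (B * w * (K * δ)) (change-length {m} {n} 0≤xn xn≤Q 0≤δ (small n (ℕ.≤-trans N₂≤ q))) ⟩
            F n (x n) + B * w * δ + B * w * (K * δ)
              ≡⟨ r (F n (x n)) (B * w) δ K ⟩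
            F n (x n) + (B * w * K + B * w) * δ ∎
      where
      open ≤-Reasoning
      r : ∀ f b δ K → f + b * δ + b * (K * δ) ≡ f + (b * K + b) * δ
      r = solve-∀ ℚ-ring

-- Logarithm and exponential as truncated series.

module LogExp where

  open RationalOrder
  open Limits
  open import Data.Nat as ℕ using (ℕ; zero; suc)
  import Data.Nat.Properties as ℕ
  open import Data.Product using (_×_; _,_; proj₁; proj₂; ∃-syntax)
  open import Data.Rational
  open import Data.Rational.Properties
  open import Data.Sum using (inj₁; inj₂)
  open import Relation.Binary.PropositionalEquality
  open import Relation.Nullary.Decidable using (toWitness)
  open import Tactic.RingSolver using (solve-∀)

  -- The argument of artanh in `log`. It sends x ≥ 1 into the interval from 0 to 1, where the terms
  -- of the series are nonnegative and increasing.
  cayley : ℚ → ℚ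
  cayley x = (x - 1ℚ) /₀ (x + 1ℚ)

  0<x+1 : ∀ {x} → 1ℚ ≤ x → 0ℚ < x + 1ℚ
  0<x+1 {x} 1≤x = <-≤-trans 0<1 (≤-trans 1≤x (≤-+ 0≤1))

  cayley-mono : ∀ {x y} → 1ℚ ≤ x → x ≤ y → cayley x ≤ cayley y
  cayley-mono {x} {y} 1≤x x≤y = /₀-≤ (0<x+1 1≤x) (cancel-≤ 0<y+1 (begin
    (x - 1ℚ) * (y + 1ℚ)                     ≤⟨ ≤-by ((y - x) + (y - x)) (+-nonNeg (0≤- x≤y) (0≤- x≤y)) (g x y) ⟩
    (y - 1ℚ) * (x + 1ℚ)                     ≡⟨ cong (_* (x + 1ℚ)) (/₀-* (y - 1ℚ) 0<y+1) ⟨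
    cayley y * (y + 1ℚ) * (x + 1ℚ)          ≡⟨ g′ (cayley y) (y + 1ℚ) (x + 1ℚ) ⟩
    cayley y * (x + 1ℚ) * (y + 1ℚ)          ∎))
    where
    open ≤-Reasoning
    0<y+1 = 0<x+1 (≤-trans 1≤x x≤y)
    g : ∀ x y → (x - 1ℚ) * (y + 1ℚ) + ((y - x) + (y - x)) ≡ (y - 1ℚ) * (x + 1ℚ)
    g = solve-∀ ℚ-ring
    g′ : ∀ a b c → a * b * c ≡ a * c * b
    g′ = solve-∀ ℚ-ring

  0≤cayley : ∀ {x} → 1ℚ ≤ x → 0ℚ ≤ cayley x
  0≤cayley 1≤x = 0≤/₀ (0<x+1 1≤x) (0≤- 1≤x)

  cayley<1 : ∀ {x} → 1ℚ ≤ x → cayley x < 1ℚ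
  cayley<1 {x} 1≤x = *-cancelʳ-<-nonNeg (x + 1ℚ) {{nonNegative (<⇒≤ (0<x+1 1≤x))}}
    (subst₂ _<_ (sym (/₀-* (x - 1ℚ) (0<x+1 1≤x))) (sym (*-identityˡ (x + 1ℚ)))
      (+-monoʳ-< x (toWitness {a? = - 1ℚ <? 1ℚ} _)))

  module _ (k : ℕ) where

    private
      ν = ℕ→ℚ (suc (2 ℕ.* k))

      artanhTerm≡ : ∀ t → artanhTerm t k ≡ (t ^ suc (2 ℕ.* k)) /₀ ν
      artanhTerm≡ t = cong (λ j → (t ^ j) /₀ ℕ→ℚ j) (ℕ.+-comm (2 ℕ.* k) 1)

      artanhTerm-* : ∀ t → artanhTerm t k * ν ≡ t ^ suc (2 ℕ.* k)
      artanhTerm-* t = trans (cong (_* ν) (artanhTerm≡ t)) (/₀-* (t ^ suc (2 ℕ.* k)) (0<ν (2 ℕ.* k)))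

      scale : ∀ s d x → (artanhTerm s k + (x * x) ^ k * d) * ν ≡ s ^ suc (2 ℕ.* k) + ν * (x ^ (2 ℕ.* k) * d)
      scale s d x = trans (g (artanhTerm s k) ((x * x) ^ k * d) ν)
        (cong₂ _+_ (artanhTerm-* s) (cong (λ z → ν * (z * d)) (sym (^-double x k))))
        where
        g : ∀ a b c → (a + b) * c ≡ a * c + c * b
        g = solve-∀ ℚ-ring

    -- The derivative of the term is t^(2k). Writing it as (t * t) ^ k makes these derivatives a
    -- geometric series in k.
    artanh-≥ : ∀ {s t} → 0ℚ ≤ s → s ≤ t → artanhTerm s k + (s * s) ^ k * (t - s) ≤ artanhTerm t k
    artanh-≥ {s} {t} 0≤s s≤t = cancel-≤ (0<ν (2 ℕ.* k))
      (subst₂ _≤_ (sym (scale s (t - s) s)) (sym (artanhTerm-* t)) (pow-diff-≥ 0≤s s≤t (2 ℕ.* k)))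

    artanh-≤ : ∀ {s t} → 0ℚ ≤ s → s ≤ t → artanhTerm t k ≤ artanhTerm s k + (t * t) ^ k * (t - s)
    artanh-≤ {s} {t} 0≤s s≤t = cancel-≤ (0<ν (2 ℕ.* k))
      (subst₂ _≤_ (sym (artanhTerm-* t)) (sym (scale s (t - s) t)) (pow-diff-≤ 0≤s s≤t (2 ℕ.* k)))

    artanh-nonNeg : ∀ {t} → 0ℚ ≤ t → 0ℚ ≤ artanhTerm t k
    artanh-nonNeg {t} 0≤t = subst (0ℚ ≤_) (sym (artanhTerm≡ t))
      (0≤/₀ (0<ν (2 ℕ.* k)) (^-nonNeg (suc (2 ℕ.* k)) 0≤t))

    artanh-mono : ∀ {s t} → 0ℚ ≤ s → s ≤ t → artanhTerm s k ≤ artanhTerm t k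
    artanh-mono {s} 0≤s s≤t = ≤-trans
      (≤-+ (*-nonNeg (^-nonNeg k (*-nonNeg 0≤s 0≤s)) (0≤- s≤t))) (artanh-≥ 0≤s s≤t)

    artanh-bound : ∀ {t q} → 0ℚ ≤ t → t ≤ q → q ≤ 1ℚ → artanhTerm t k ≤ q ^ k
    artanh-bound {t} {q} 0≤t t≤q q≤1 = subst (_≤ q ^ k) (sym (artanhTerm≡ t)) (/₀-≤ (0<ν (2 ℕ.* k)) (begin
      t ^ suc (2 ℕ.* k)   ≤⟨ ^-mono (suc (2 ℕ.* k)) 0≤t t≤q ⟩
      q ^ suc (2 ℕ.* k)   ≤⟨ ^-antimono 0≤q q≤1 (ℕ.≤-trans (ℕ.m≤m+n k (k ℕ.+ 0)) (ℕ.n≤1+n _)) ⟩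
      q ^ k               ≡⟨ *-identityʳ (q ^ k) ⟨
      q ^ k * 1ℚ          ≤⟨ *-monoˡ (^-nonNeg k 0≤q) (ν-mono {1} {suc (2 ℕ.* k)} (ℕ.s≤s ℕ.z≤n)) ⟩
      q ^ k * ν           ∎))
      where
      open ≤-Reasoning
      0≤q = ≤-trans 0≤t t≤q

  cauchy-scale : ∀ {x c} → 0ℚ ≤ c → Cauchy x → Cauchy (λ m → c * x m)
  cauchy-scale {x} {c} 0≤c (K , 0≤K , h) = c * K , *-nonNeg 0≤c 0≤K , λ δ 0<δ → let (N , b) = h δ 0<δ in
    N , λ m n p q → subst (c * x m ≤_) (g c (x n) K δ) (*-monoˡ 0≤c (b m n p q))
    where
    g : ∀ c x K δ → c * (x + K * δ) ≡ c * x + c * K * δ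
    g = solve-∀ ℚ-ring

  cauchy-log : ∀ {x X} → Bounded 1ℚ X x → Cauchy x → Cauchy (log x)
  cauchy-log {x} {X} bd@(N , b) cx = cauchy-scale (0≤ν 2)
    -- `q` bounds the argument and is also the ratio of the majorant: for t ≤ q ≤ 1 both the term
    -- and its derivative are at most q^k.
    (cauchy-series artanhTerm {Q = q} {B = 1ℚ} {ρ = q} 0≤1 0≤q (cayley<1 1≤X)
      (λ k → artanh-nonNeg k)
      (λ k 0≤t t≤q → subst (artanhTerm _ k ≤_) (sym (*-identityˡ (q ^ k))) (artanh-bound k 0≤t t≤q q≤1))
      (λ k → artanh-mono k)
      lip
      (ev-map (λ (p , p′) → 0≤cayley p , cayley-mono p p′) bd)
      cayley-cauchy)
    where
    open ≤-Reasoning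
    1≤X : 1ℚ ≤ X
    1≤X = let (p , p′) = b N ℕ.≤-refl in ≤-trans p p′
    q = cayley X
    0≤q = 0≤cayley 1≤X
    q≤1 = <⇒≤ (cayley<1 1≤X)
    lip : ∀ {s t} k → 0ℚ ≤ s → s ≤ t → t ≤ q → artanhTerm t k ≤ artanhTerm s k + 1ℚ * q ^ k * (t - s)
    lip {s} {t} k 0≤s s≤t t≤q = begin
      artanhTerm t k                             ≤⟨ artanh-≤ k 0≤s s≤t ⟩
      artanhTerm s k + (t * t) ^ k * (t - s)
        ≤⟨ +-monoʳ-≤ (artanhTerm s k) (*-monoʳ (0≤- s≤t) (^-mono k (*-nonNeg 0≤t 0≤t) tt≤q)) ⟩
      artanhTerm s k + q ^ k * (t - s)
        ≡⟨ cong (λ z → artanhTerm s k + z * (t - s)) (*-identityˡ (q ^ k)) ⟨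
      artanhTerm s k + 1ℚ * q ^ k * (t - s)      ∎
      where
      0≤t = ≤-trans 0≤s s≤t
      tt≤q : t * t ≤ q
      tt≤q = subst (t * t ≤_) (*-identityʳ q) (*-mono 0≤t t≤q 0≤t (≤-trans t≤q q≤1))
    inv≤1 : ∀ {x} → 1ℚ ≤ x → inv (x + 1ℚ) ≤ 1ℚ
    inv≤1 {x} 1≤x = /₀-≤ (0<x+1 1≤x) (subst (1ℚ ≤_) (sym (*-identityˡ (x + 1ℚ))) (≤-trans 1≤x (≤-+ 0≤1)))
    cayley-cauchy : Cauchy (λ m → cayley (x m))
    cayley-cauchy = cauchy-ext (ev-map (λ (p , _) → sym (/₀≡*inv _ (0<x+1 p))) bd)
      (cauchy-* {X = X - 1ℚ} {Y = 1ℚ} (0≤- 1≤X) 0≤1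
        (ev-map (λ (p , p′) → 0≤- p , +-monoˡ-≤ (- 1ℚ) p′) bd)
        (ev-map (λ (p , _) → 0≤inv (0<x+1 p) , inv≤1 p) bd)
        (cauchy-shift (- 1ℚ) cx)
        (cauchy-inv 0<1 (ev-map (λ (p , _) → ≤-trans p (≤-+ 0≤1)) bd) (cauchy-shift 1ℚ cx)))

  expTerm-closed : ∀ x k → expTerm x k ≡ x ^ k * expTerm 1ℚ k
  expTerm-closed x zero    = refl
  expTerm-closed x (suc k) = trans (cong₂ _*_ (expTerm-closed x k) (/₀≡*inv x (0<ν k)))
    (trans (g (x ^ k) (expTerm 1ℚ k) x (inv (ℕ→ℚ (suc k)))) refl)
    where
    g : ∀ a c x v → a * c * (x * v) ≡ x * a * (c * v)
    g = solve-∀ ℚ-ring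

  expTerm-nonNeg : ∀ {x} k → 0ℚ ≤ x → 0ℚ ≤ expTerm x k
  expTerm-nonNeg zero    0≤x = 0≤1
  expTerm-nonNeg (suc k) 0≤x = *-nonNeg (expTerm-nonNeg k 0≤x) (0≤/₀ (0<ν k) 0≤x)

  module _ (k : ℕ) where

    private
      ν = ℕ→ℚ (suc k)
      c = expTerm 1ℚ k
      c′ = expTerm 1ℚ (suc k)

      c′ν : c′ * ν ≡ c
      c′ν = trans (*-assoc c (inv ν) ν) (trans (cong (c *_) (inv-* (0<ν k))) (*-identityʳ c))

      0≤c′ : 0ℚ ≤ c′
      0≤c′ = expTerm-nonNeg (suc k) 0≤1

      scale : ∀ s x d → c′ * (s ^ suc k + ν * (x ^ k * d)) ≡ expTerm s (suc k) + expTerm x k * d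
      scale s x d = trans (g c′ (s ^ suc k) ν (x ^ k) d) (cong₂ _+_ (sym (expTerm-closed s (suc k)))
        (cong (_* d) (trans (cong (x ^ k *_) c′ν) (sym (expTerm-closed x k)))))
        where
        g : ∀ c a v b d → c * (a + v * (b * d)) ≡ a * c + b * (c * v) * d
        g = solve-∀ ℚ-ring

      unscale : ∀ t → c′ * t ^ suc k ≡ expTerm t (suc k)
      unscale t = trans (*-comm c′ (t ^ suc k)) (sym (expTerm-closed t (suc k)))

    exp-≥ : ∀ {s t} → 0ℚ ≤ s → s ≤ t → expTerm s (suc k) + expTerm s k * (t - s) ≤ expTerm t (suc k)
    exp-≥ {s} {t} 0≤s s≤t = subst₂ _≤_ (scale s s (t - s)) (unscale t) (*-monoˡ 0≤c′ (pow-diff-≥ 0≤s s≤t k))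

    exp-≤ : ∀ {s t} → 0ℚ ≤ s → s ≤ t → expTerm t (suc k) ≤ expTerm s (suc k) + expTerm t k * (t - s)
    exp-≤ {s} {t} 0≤s s≤t = subst₂ _≤_ (unscale t) (scale s t (t - s)) (*-monoˡ 0≤c′ (pow-diff-≤ 0≤s s≤t k))

  expTerm-mono : ∀ {s t} k → 0ℚ ≤ s → s ≤ t → expTerm s k ≤ expTerm t k
  expTerm-mono zero    0≤s s≤t = ≤-refl
  expTerm-mono (suc k) 0≤s s≤t = ≤-trans (≤-+ (*-nonNeg (expTerm-nonNeg k 0≤s) (0≤- s≤t))) (exp-≥ k 0≤s s≤t)

  -- From k = P on the terms P^k / k! do not increase, so the sum of those up to k = P bounds them
  -- all.
  expTerm-bounded : ∀ P → ∃[ B ] (0ℚ ≤ B × (∀ k → expTerm (ℕ→ℚ P) k ≤ B))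
  expTerm-bounded P = B , ∑-nonNeg (suc P) e≥0 , bound
    where
    e : ℕ → ℚ
    e = expTerm (ℕ→ℚ P)
    e≥0 : ∀ k → 0ℚ ≤ e k
    e≥0 k = expTerm-nonNeg k (0≤ν P)
    B = ∑< (suc P) e
    early : ∀ {k} → k ℕ.≤ P → e k ≤ B
    early {k} k≤P = ≤-trans (≤-by (∑< k e) (∑-nonNeg k e≥0) (+-comm (e k) (∑< k e)))
                            (∑-extend e≥0 (ℕ.s≤s k≤P))
    decreasing : ∀ k → P ℕ.≤ suc k → e (suc k) ≤ e k
    decreasing k P≤ = subst (e (suc k) ≤_) (*-identityʳ (e k))
      (*-monoˡ (e≥0 k) (/₀-≤ (0<ν k) (subst (ℕ→ℚ P ≤_) (sym (*-identityˡ _)) (ν-mono P≤))))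
    late : ∀ j → e (j ℕ.+ P) ≤ e P
    late zero    = ≤-refl
    late (suc j) = ≤-trans (decreasing (j ℕ.+ P) (ℕ.≤-trans (ℕ.m≤n+m P j) (ℕ.n≤1+n _))) (late j)
    bound : ∀ k → e k ≤ B
    bound k with ℕ.≤-total k P
    ... | inj₁ k≤P = early k≤P
    ... | inj₂ P≤k = ≤-trans (subst (λ j → e j ≤ e P) (ℕ.m∸n+n≡m P≤k) (late (k ℕ.∸ P))) (early ℕ.≤-refl)

  -- The ratio ½ comes from Q^k / k! = ((2Q)^k / k!) (½)^k, where the first factor is bounded. B + B
  -- in place of B makes up for an index shift: the slope of term k + 1 is term k.
  cauchy-exp : ∀ {x X} → Bounded 0ℚ X x → Cauchy x → Cauchy (exp x)
  cauchy-exp {x} {X} bd cx = cauchy-series expTerm {Q = Q} {B = B + B} {ρ = ½} (+-nonNeg 0≤B 0≤B)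
    (toWitness {a? = 0ℚ ≤? ½} _) (toWitness {a? = ½ <? 1ℚ} _)
    expTerm-nonNeg
    (λ k 0≤t t≤Q → ≤-trans (bound k 0≤t t≤Q) (*-monoʳ {B} {B + B} (^-nonNeg k 0≤½) (≤-+ 0≤B)))
    expTerm-mono lip (ev-map (λ (p , p′) → p , ≤-trans p′ X≤Q) bd) cx
    where
    open ≤-Reasoning
    P = proj₁ (ν-bound X)
    X≤Q = proj₂ (ν-bound X)
    Q = ℕ→ℚ P
    B = proj₁ (expTerm-bounded (P ℕ.+ P))
    0≤B = proj₁ (proj₂ (expTerm-bounded (P ℕ.+ P)))
    0≤½ : 0ℚ ≤ ½
    0≤½ = toWitness {a? = 0ℚ ≤? ½} _
    Q≡ : Q ≡ ℕ→ℚ (P ℕ.+ P) * ½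
    Q≡ = trans (sym (halve Q)) (cong (_* ½) (sym (ν-+ P P)))
    bound : ∀ {t} k → 0ℚ ≤ t → t ≤ Q → expTerm t k ≤ B * ½ ^ k
    bound {t} k 0≤t t≤Q = begin
      expTerm t k                              ≤⟨ expTerm-mono k 0≤t t≤Q ⟩
      expTerm Q k                              ≡⟨ expTerm-closed Q k ⟩
      Q ^ k * expTerm 1ℚ k                     ≡⟨ cong (λ z → z ^ k * expTerm 1ℚ k) Q≡ ⟩
      (ℕ→ℚ (P ℕ.+ P) * ½) ^ k * expTerm 1ℚ k   ≡⟨ cong (_* expTerm 1ℚ k) (^-* (ℕ→ℚ (P ℕ.+ P)) ½ k) ⟩
      ℕ→ℚ (P ℕ.+ P) ^ k * ½ ^ k * expTerm 1ℚ k ≡⟨ g (ℕ→ℚ (P ℕ.+ P) ^ k) (½ ^ k) (expTerm 1ℚ k) ⟩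
      ℕ→ℚ (P ℕ.+ P) ^ k * expTerm 1ℚ k * ½ ^ k ≡⟨ cong (_* ½ ^ k) (expTerm-closed (ℕ→ℚ (P ℕ.+ P)) k) ⟨
      expTerm (ℕ→ℚ (P ℕ.+ P)) k * ½ ^ k
        ≤⟨ *-monoʳ (^-nonNeg k 0≤½) (proj₂ (proj₂ (expTerm-bounded (P ℕ.+ P))) k) ⟩
      B * ½ ^ k                                ∎
      where
      g : ∀ a b c → a * b * c ≡ a * c * b
      g = solve-∀ ℚ-ring
    lip : ∀ {s t} k → 0ℚ ≤ s → s ≤ t → t ≤ Q → expTerm t k ≤ expTerm s k + (B + B) * ½ ^ k * (t - s)
    lip {s} {t} zero    0≤s s≤t t≤Q = ≤-+ (*-nonNeg (*-nonNeg (+-nonNeg 0≤B 0≤B) 0≤1) (0≤- s≤t))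
    lip {s} {t} (suc k) 0≤s s≤t t≤Q = begin
      expTerm t (suc k)
        ≤⟨ exp-≤ k 0≤s s≤t ⟩
      expTerm s (suc k) + expTerm t k * (t - s)
        ≤⟨ +-monoʳ-≤ (expTerm s (suc k)) (*-monoʳ (0≤- s≤t) (bound k (≤-trans 0≤s s≤t) t≤Q)) ⟩
      expTerm s (suc k) + B * ½ ^ k * (t - s)
        ≡⟨ cong (λ z → expTerm s (suc k) + z * (t - s)) (B½ (½ ^ k)) ⟩
      expTerm s (suc k) + (B + B) * (½ * ½ ^ k) * (t - s) ∎
      where
      B½ : ∀ p → B * p ≡ (B + B) * (½ * p)
      B½ p = trans (cong (_* p) (sym (halve B))) (*-assoc (B + B) ½ p)

  logAt : ℕ → ℚ → ℚ
  logAt m x = log (fromℚ x) m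

  logAt-nonNeg : ∀ m {x} → 1ℚ ≤ x → 0ℚ ≤ logAt m x
  logAt-nonNeg m 1≤x = *-nonNeg (0≤ν 2) (∑-nonNeg m (λ k → artanh-nonNeg k (0≤cayley 1≤x)))

  logAt-mono : ∀ m {x y} → 1ℚ ≤ x → x ≤ y → logAt m x ≤ logAt m y
  logAt-mono m 1≤x x≤y = *-monoˡ (0≤ν 2)
    (∑-mono m (λ k _ → artanh-mono k (0≤cayley 1≤x) (cayley-mono 1≤x x≤y)))

  -- Comparison with a geometric series gives, without truncation, log a - log x ≥ 2 (t - s) / (1 -
  -- s²) = a / (a² - 1). The excess over 1 / a absorbs the truncation once s^(2m) ≤ 1 / a².
  logAt-+1 : ∀ {x a} → 1ℚ ≤ x → a ≡ x + 1ℚ → Eventually λ m → logAt m x + inv a ≤ logAt m a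
  logAt-+1 {x} {a} 1≤x a≡x+1 = proj₁ vanish , λ m N≤m → begin
    two * A m s + u              ≤⟨ +-monoʳ-≤ (two * A m s) (u≤ m (proj₂ vanish m N≤m)) ⟩
    two * A m s + two * (t - s) * G m ≡⟨ r₀ two (A m s) (t - s) (G m) ⟩
    two * (A m s + (t - s) * G m) ≡⟨ cong (λ z → two * (A m s + z)) (∑-* m (t - s) ((s * s) ^_)) ⟨
    two * (A m s + ∑< m (λ k → (t - s) * (s * s) ^ k))
      ≡⟨ cong (two *_) (∑-+ m (artanhTerm s) (λ k → (t - s) * (s * s) ^ k)) ⟨
    two * ∑< m (λ k → artanhTerm s k + (t - s) * (s * s) ^ k)
      ≤⟨ *-monoˡ (0≤ν 2) (∑-mono m λ k _ → subst (λ z → artanhTerm s k + z ≤ artanhTerm t k)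
           (*-comm ((s * s) ^ k) (t - s)) (artanh-≥ k 0≤s s≤t)) ⟩
    two * A m t                  ∎
    where
    open ≤-Reasoning
    two = ℕ→ℚ 2
    u = inv a
    s = cayley x
    t = cayley a
    A : ℕ → ℚ → ℚ
    A m t = ∑< m (artanhTerm t)
    G : ℕ → ℚ
    G m = ∑< m ((s * s) ^_)
    x≤a : x ≤ a
    x≤a = subst (x ≤_) (sym a≡x+1) (≤-+ 0≤1)
    0≤s = 0≤cayley 1≤x
    s≤t = cayley-mono 1≤x x≤a
    0<x = <-≤-trans 0<1 1≤x
    0<a = <-≤-trans 0<x x≤a
    0<a+1 = 0<x+1 (≤-trans 1≤x x≤a)
    0<aa = *-pos 0<a 0<a
    ss<1 : s * s < 1ℚ
    ss<1 = ≤-<-trans (subst (s * s ≤_) (*-identityˡ s) (*-monoʳ 0≤s (<⇒≤ (cayley<1 1≤x)))) (cayley<1 1≤x)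
    vanish : ∃[ N ] (∀ n → N ℕ.≤ n → (s * s) ^ n ≤ inv (a * a))
    vanish = powers-vanish {s * s} (*-nonNeg 0≤s 0≤s) ss<1 (inv (a * a)) (inv-pos 0<aa)
    sa : s * a ≡ x - 1ℚ
    sa = trans (cong (s *_) a≡x+1) (/₀-* (x - 1ℚ) (0<x+1 1≤x))
    ta : t * (a + 1ℚ) ≡ x
    ta = trans (/₀-* (a - 1ℚ) 0<a+1) (trans (cong (_- 1ℚ) a≡x+1) (g x))
      where
      g : ∀ x → x + 1ℚ - 1ℚ ≡ x
      g = solve-∀ ℚ-ring
    r₀ : ∀ w A d G → w * A + w * d * G ≡ w * (A + d * G)
    r₀ = solve-∀ ℚ-ring
    r₁ : ∀ t s a → (t - s) * (a * (a + 1ℚ)) ≡ t * (a + 1ℚ) * a - s * a * (a + 1ℚ)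
    r₁ = solve-∀ ℚ-ring
    r₂ : ∀ x → x * (x + 1ℚ) - (x - 1ℚ) * (x + 1ℚ + 1ℚ) ≡ 1ℚ + 1ℚ
    r₂ = solve-∀ ℚ-ring
    four = (1ℚ + 1ℚ) * (1ℚ + 1ℚ)
    [t-s]aa : (t - s) * (a * (a + 1ℚ)) ≡ 1ℚ + 1ℚ
    [t-s]aa = trans (r₁ t s a) (trans (cong₂ (λ y z → y * a - z * (a + 1ℚ)) ta sa)
      (trans (cong (λ z → x * z - (x - 1ℚ) * (z + 1ℚ)) a≡x+1) (r₂ x)))
    r₃ : ∀ s a → (1ℚ - s * s) * (a * a) ≡ a * a - s * a * (s * a)
    r₃ = solve-∀ ℚ-ring
    r₄ : ∀ x → (x + 1ℚ) * (x + 1ℚ) - (x - 1ℚ) * (x - 1ℚ) ≡ (1ℚ + 1ℚ) * (1ℚ + 1ℚ) * x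
    r₄ = solve-∀ ℚ-ring
    [1-ss]aa : (1ℚ - s * s) * (a * a) ≡ four * x
    [1-ss]aa = trans (r₃ s a) (trans (cong₂ (λ y z → y * y - z * z) a≡x+1 sa) (r₄ x))
    r₅ : ∀ f G x → f * G * x ≡ G * (f * x)
    r₅ = solve-∀ ℚ-ring
    r₆ : ∀ σ a → (1ℚ - σ) * a ≡ a - σ * a
    r₆ = solve-∀ ℚ-ring
    r₇ : ∀ x → (x + 1ℚ + 1ℚ) * x ≡ (x + 1ℚ) * (x + 1ℚ) - 1ℚ
    r₇ = solve-∀ ℚ-ring
    4G≥a+1 : ∀ m → (s * s) ^ m ≤ inv (a * a) → a + 1ℚ ≤ four * G m
    4G≥a+1 m σ≤ = cancel-≤ 0<x (begin
      (a + 1ℚ) * x                     ≡⟨ cong (λ z → (z + 1ℚ) * x) a≡x+1 ⟩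
      (x + 1ℚ + 1ℚ) * x                ≡⟨ r₇ x ⟩
      (x + 1ℚ) * (x + 1ℚ) - 1ℚ         ≡⟨ cong (λ z → z * z - 1ℚ) a≡x+1 ⟨
      a * a - 1ℚ                       ≤⟨ +-monoʳ-≤ (a * a) (neg-antimono-≤ σaa≤1) ⟩
      a * a - (s * s) ^ m * (a * a)    ≡⟨ r₆ ((s * s) ^ m) (a * a) ⟨
      (1ℚ - (s * s) ^ m) * (a * a)     ≡⟨ cong (_* (a * a)) (geometric-closed (s * s) m) ⟨
      G m * (1ℚ - s * s) * (a * a)     ≡⟨ *-assoc (G m) _ _ ⟩
      G m * ((1ℚ - s * s) * (a * a))   ≡⟨ cong (G m *_) [1-ss]aa ⟩
      G m * (four * x)                 ≡⟨ r₅ four (G m) x ⟨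
      four * G m * x                   ∎)
      where
      σaa≤1 : (s * s) ^ m * (a * a) ≤ 1ℚ
      σaa≤1 = subst ((s * s) ^ m * (a * a) ≤_) (inv-* 0<aa) (*-monoʳ (<⇒≤ 0<aa) σ≤)
    r₈ : ∀ u a → u * (a * (a + 1ℚ)) ≡ u * a * (a + 1ℚ)
    r₈ = solve-∀ ℚ-ring
    r₉ : ∀ w d G c → w * d * G * c ≡ w * (d * c) * G
    r₉ = solve-∀ ℚ-ring
    u≤ : ∀ m → (s * s) ^ m ≤ inv (a * a) → u ≤ two * (t - s) * G m
    u≤ m σ≤ = cancel-≤ (*-pos 0<a 0<a+1) (begin
      u * (a * (a + 1ℚ))                    ≡⟨ r₈ u a ⟩
      u * a * (a + 1ℚ)                      ≡⟨ cong (_* (a + 1ℚ)) (inv-* 0<a) ⟩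
      1ℚ * (a + 1ℚ)                         ≡⟨ *-identityˡ (a + 1ℚ) ⟩
      a + 1ℚ                                ≤⟨ 4G≥a+1 m σ≤ ⟩
      four * G m                            ≡⟨ cong (λ z → two * z * G m) [t-s]aa ⟨
      two * ((t - s) * (a * (a + 1ℚ))) * G m ≡⟨ r₉ two (t - s) (G m) (a * (a + 1ℚ)) ⟨
      two * (t - s) * G m * (a * (a + 1ℚ))  ∎)

  1≤ν : ∀ n → 1 ℕ.≤ n → 1ℚ ≤ ℕ→ℚ n
  1≤ν n = ν-mono {1} {n}

  logAt-suc : ∀ p → Eventually λ m →
    logAt m (ℕ→ℚ (suc p)) + inv (ℕ→ℚ (suc (suc p))) ≤ logAt m (ℕ→ℚ (suc (suc p)))
  logAt-suc p = logAt-+1 (1≤ν (suc p) (ℕ.s≤s ℕ.z≤n)) (trans (ν-suc (suc p)) (+-comm 1ℚ (ℕ→ℚ (suc p))))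

  -- Each of the j increments is at least 1 / K, as all the points reached are at most K.
  logAt-+ : ∀ N K j → suc N ℕ.+ j ℕ.≤ K → Eventually λ m →
    logAt m (ℕ→ℚ (suc N)) + ℕ→ℚ j * inv (ℕ→ℚ K) ≤ logAt m (ℕ→ℚ (suc N ℕ.+ j))
  logAt-+ N K zero    _  = always λ m → ≤-reflexive
    (trans (cong (λ z → logAt m (ℕ→ℚ (suc N)) + z) (*-zeroˡ (inv (ℕ→ℚ K))))
      (trans (+-identityʳ _) (cong (λ k → logAt m (ℕ→ℚ k)) (sym (ℕ.+-identityʳ (suc N))))))
  logAt-+ N K (suc j) le = ev-map (λ {m} → main m) (logAt-+ N K j (ℕ.≤-trans (ℕ.n≤1+n _) le′) ⊗ logAt-suc (N ℕ.+ j))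
    where
    open ≤-Reasoning
    le′ : suc (suc N ℕ.+ j) ℕ.≤ K
    le′ = subst (ℕ._≤ K) (ℕ.+-suc (suc N) j) le
    v = inv (ℕ→ℚ K)
    r : ∀ a b v → a + (1ℚ + b) * v ≡ a + b * v + v
    r = solve-∀ ℚ-ring
    main : ∀ m → _ × _ → logAt m (ℕ→ℚ (suc N)) + ℕ→ℚ (suc j) * v ≤ logAt m (ℕ→ℚ (suc N ℕ.+ suc j))
    main m (p , q) = begin
      logAt m (ℕ→ℚ (suc N)) + ℕ→ℚ (suc j) * v
        ≡⟨ cong (λ z → logAt m (ℕ→ℚ (suc N)) + z * v) (ν-suc j) ⟩
      logAt m (ℕ→ℚ (suc N)) + (1ℚ + ℕ→ℚ j) * v
        ≡⟨ r (logAt m (ℕ→ℚ (suc N))) (ℕ→ℚ j) v ⟩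
      logAt m (ℕ→ℚ (suc N)) + ℕ→ℚ j * v + v
        ≤⟨ +-mono-≤ p (inv-antimono (0<ν (suc (N ℕ.+ j))) (ν-mono le′)) ⟩
      logAt m (ℕ→ℚ (suc (N ℕ.+ j))) + inv (ℕ→ℚ (suc (suc (N ℕ.+ j))))
        ≤⟨ q ⟩
      logAt m (ℕ→ℚ (suc (suc (N ℕ.+ j))))
        ≡⟨ cong (λ k → logAt m (ℕ→ℚ k)) (ℕ.+-suc (suc N) j) ⟨
      logAt m (ℕ→ℚ (suc N ℕ.+ suc j)) ∎

  -- Passing from N to 2 N takes N increments of at least 1 / (2 N), a gain of ½.
  logAt-2^ : ∀ ℓ → Eventually λ m → ℕ→ℚ ℓ * ½ ≤ logAt m (ℕ→ℚ (2 ℕ.^ ℓ))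
  logAt-2^ zero    = always λ m → subst (_≤ logAt m (ℕ→ℚ 1)) (sym (*-zeroˡ ½)) (logAt-nonNeg m ≤-refl)
  logAt-2^ (suc ℓ) = double (2 ℕ.^ ℓ) (ℕ.m^n>0 2 ℓ) (logAt-2^ ℓ)
    where
    double : ∀ N → 1 ℕ.≤ N → (Eventually λ m → ℕ→ℚ ℓ * ½ ≤ logAt m (ℕ→ℚ N)) →
             Eventually λ m → ℕ→ℚ (suc ℓ) * ½ ≤ logAt m (ℕ→ℚ (2 ℕ.* N))
    double (suc N) _ h = ev-map (λ {m} → main m) (h ⊗ logAt-+ N (suc N ℕ.+ suc N) (suc N) ℕ.≤-refl)
      where
      open ≤-Reasoning
      K = ℕ→ℚ (suc N ℕ.+ suc N)
      0<K = 0<ν (N ℕ.+ suc N)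
      r : ∀ a → ½ * (a + a) ≡ a
      r a = trans (*-comm ½ (a + a)) (halve a)
      half : ½ ≡ ℕ→ℚ (suc N) * inv K
      half = cancel-≡ 0<K (trans (cong (½ *_) (ν-+ (suc N) (suc N))) (trans (r (ℕ→ℚ (suc N)))
        (sym (trans (*-assoc (ℕ→ℚ (suc N)) (inv K) K)
          (trans (cong (ℕ→ℚ (suc N) *_) (inv-* 0<K)) (*-identityʳ (ℕ→ℚ (suc N))))))))
      r′ : ∀ l h → (1ℚ + l) * h ≡ l * h + h
      r′ = solve-∀ ℚ-ring
      main : ∀ m → _ × _ → ℕ→ℚ (suc ℓ) * ½ ≤ logAt m (ℕ→ℚ (2 ℕ.* suc N))
      main m (p , q) = begin
        ℕ→ℚ (suc ℓ) * ½                  ≡⟨ cong (_* ½) (ν-suc ℓ) ⟩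
        (1ℚ + ℕ→ℚ ℓ) * ½                 ≡⟨ r′ (ℕ→ℚ ℓ) ½ ⟩
        ℕ→ℚ ℓ * ½ + ½                    ≤⟨ +-mono-≤ p (≤-reflexive half) ⟩
        logAt m (ℕ→ℚ (suc N)) + ℕ→ℚ (suc N) * inv K ≤⟨ q ⟩
        logAt m (ℕ→ℚ (suc N ℕ.+ suc N))
          ≡⟨ cong (λ k → logAt m (ℕ→ℚ (suc N ℕ.+ k))) (ℕ.+-identityʳ (suc N)) ⟨
        logAt m (ℕ→ℚ (2 ℕ.* suc N)) ∎

  logAt-≥ : ∀ {n} ℓ → 2 ℕ.^ ℓ ℕ.≤ n → Eventually λ m → ℕ→ℚ ℓ * ½ ≤ logAt m (ℕ→ℚ n)
  logAt-≥ ℓ 2^ℓ≤n = ev-map (λ {m} p → ≤-trans p (logAt-mono m (1≤ν (2 ℕ.^ ℓ) (ℕ.m^n>0 2 ℓ)) (ν-mono 2^ℓ≤n))) (logAt-2^ ℓ)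

  expSum : ℕ → ℚ → ℚ
  expSum m y = ∑< m (expTerm y)

  expSum-mono : ∀ {m m′ y y′} → m ℕ.≤ m′ → 0ℚ ≤ y → y ≤ y′ → expSum m y ≤ expSum m′ y′
  expSum-mono {m} m≤m′ 0≤y y≤y′ = ≤-trans (∑-mono m (λ k _ → expTerm-mono k 0≤y y≤y′))
    (∑-extend (λ k → expTerm-nonNeg k (≤-trans 0≤y y≤y′)) m≤m′)

  -- A truncated form of exp (y + h) ≥ (1 + h) exp y. The factor h shifts the index by one, and the
  -- additional summand on the right makes room for this.
  expSum-+ : ∀ p {y h} → 0ℚ ≤ y → 0ℚ ≤ h → (1ℚ + h) * expSum p y ≤ expSum (suc p) (y + h)
  expSum-+ p {y} {h} 0≤y 0≤h = begin
    (1ℚ + h) * E                       ≡⟨ r h E ⟩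
    E + h * E
      ≤⟨ +-monoˡ-≤ (h * E) (∑-extend (λ k → expTerm-nonNeg k 0≤y) (ℕ.n≤1+n p)) ⟩
    expSum (suc p) y + h * E           ≡⟨ cong (_+ h * E) (∑-suc p (expTerm y)) ⟩
    1ℚ + ∑< p (λ k → expTerm y (suc k)) + h * E
      ≡⟨ +-assoc 1ℚ (∑< p (λ k → expTerm y (suc k))) (h * E) ⟩
    1ℚ + (∑< p (λ k → expTerm y (suc k)) + h * E)
      ≡⟨ cong (λ z → 1ℚ + (∑< p (λ k → expTerm y (suc k)) + z)) (∑-* p h (expTerm y)) ⟨
    1ℚ + (∑< p (λ k → expTerm y (suc k)) + ∑< p (λ k → h * expTerm y k))
      ≡⟨ cong (1ℚ +_) (∑-+ p (λ k → expTerm y (suc k)) (λ k → h * expTerm y k)) ⟨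
    1ℚ + ∑< p (λ k → expTerm y (suc k) + h * expTerm y k)
      ≤⟨ +-monoʳ-≤ 1ℚ (∑-mono p λ k _ → subst (λ z → expTerm y (suc k) + z ≤ expTerm (y + h) (suc k))
           (trans (cong (expTerm y k *_) (r′ y h)) (*-comm (expTerm y k) h)) (exp-≥ k 0≤y (≤-+ 0≤h))) ⟩
    1ℚ + ∑< p (λ k → expTerm (y + h) (suc k))
      ≡⟨ ∑-suc p (expTerm (y + h)) ⟨
    expSum (suc p) (y + h)             ∎
    where
    open ≤-Reasoning
    E = expSum p y
    r : ∀ h E → (1ℚ + h) * E ≡ E + h * E
    r = solve-∀ ℚ-ring
    r′ : ∀ y h → y + h - y ≡ h
    r′ = solve-∀ ℚ-ring

  -- Passing from x to a = x + 1 multiplies exp (2 log x) by at least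
  -- 1 + 2 / a = (a + 2) / a, and the product of these factors telescopes.
  exp-2log-step : ∀ {x a m p} → 1ℚ ≤ x → a ≡ x + 1ℚ →
    (x + 1ℚ) * (x + 1ℚ + 1ℚ) ≤ ℕ→ℚ 6 * expSum p (ℕ→ℚ 2 * logAt m x) →
    logAt m x + inv a ≤ logAt m a →
    (a + 1ℚ) * (a + 1ℚ + 1ℚ) ≤ ℕ→ℚ 6 * expSum (suc p) (ℕ→ℚ 2 * logAt m a)
  exp-2log-step {x} {a} {m} {p} 1≤x a≡x+1 ih inc = begin
    (a + 1ℚ) * (a + 1ℚ + 1ℚ)                  ≡⟨ r₁ a ⟩
    (a + two) * (a + 1ℚ)                      ≡⟨ cong (λ z → (a + z) * (a + 1ℚ)) 2≡ha ⟩
    (a + h * a) * (a + 1ℚ)                    ≡⟨ r₂ h a ⟩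
    (1ℚ + h) * (a * (a + 1ℚ))                 ≡⟨ cong (λ z → (1ℚ + h) * (z * (z + 1ℚ))) a≡x+1 ⟩
    (1ℚ + h) * ((x + 1ℚ) * (x + 1ℚ + 1ℚ))     ≤⟨ *-monoˡ (+-nonNeg 0≤1 0≤h) ih ⟩
    (1ℚ + h) * (six * expSum p y)             ≡⟨ r₃ six h (expSum p y) ⟩
    six * ((1ℚ + h) * expSum p y)             ≤⟨ *-monoˡ (0≤ν 6) (expSum-+ p 0≤y 0≤h) ⟩
    six * expSum (suc p) (y + h)
      ≤⟨ *-monoˡ (0≤ν 6) (expSum-mono {suc p} ℕ.≤-refl (+-nonNeg 0≤y 0≤h)
           (subst (_≤ two * logAt m a) (*-distribˡ-+ two (logAt m x) (inv a)) (*-monoˡ (0≤ν 2) inc))) ⟩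
    six * expSum (suc p) (two * logAt m a) ∎
    where
    open ≤-Reasoning
    two = ℕ→ℚ 2
    six = ℕ→ℚ 6
    h = two * inv a
    y = two * logAt m x
    0<a : 0ℚ < a
    0<a = subst (0ℚ <_) (sym a≡x+1) (0<x+1 1≤x)
    0≤h : 0ℚ ≤ h
    0≤h = *-nonNeg (0≤ν 2) (0≤inv 0<a)
    0≤y : 0ℚ ≤ y
    0≤y = *-nonNeg (0≤ν 2) (logAt-nonNeg m 1≤x)
    2≡ha : two ≡ h * a
    2≡ha = sym (trans (*-assoc two (inv a) a) (trans (cong (two *_) (inv-* 0<a)) (*-identityʳ two)))
    r₁ : ∀ a → (a + 1ℚ) * (a + 1ℚ + 1ℚ) ≡ (a + (1ℚ + 1ℚ)) * (a + 1ℚ)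
    r₁ = solve-∀ ℚ-ring
    r₂ : ∀ h a → (a + h * a) * (a + 1ℚ) ≡ (1ℚ + h) * (a * (a + 1ℚ))
    r₂ = solve-∀ ℚ-ring
    r₃ : ∀ s h E → (1ℚ + h) * (s * E) ≡ s * ((1ℚ + h) * E)
    r₃ = solve-∀ ℚ-ring

  -- A lower bound (x + 1)(x + 2) / 6 for exp (2 log x) at the integers x = j + 1. Equality at x = 1
  -- fixes the constant 6; each step uses up one more summand of the exponential series.
  exp-2log : ∀ j → Eventually λ m →
    (ℕ→ℚ (suc j) + 1ℚ) * (ℕ→ℚ (suc j) + 1ℚ + 1ℚ) ≤
    ℕ→ℚ 6 * expSum (suc j) (ℕ→ℚ 2 * logAt m (ℕ→ℚ (suc j)))
  exp-2log zero    = always λ m → toWitness {a? = (1ℚ + 1ℚ) * (1ℚ + 1ℚ + 1ℚ) ≤? ℕ→ℚ 6 * (0ℚ + 1ℚ)} _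
  exp-2log (suc j) = ev-map
    (λ {m} (p , q) → exp-2log-step {m = m} {suc j} (1≤ν (suc j) (ℕ.s≤s ℕ.z≤n))
      (trans (ν-suc (suc j)) (+-comm 1ℚ (ℕ→ℚ (suc j)))) p q)
    (exp-2log j ⊗ logAt-suc j)

-- Comparison of ℓ² with the order of growth in the theorem.

module Order where

  open RationalOrder
  open Limits
  open LogExp
  open import Data.Nat as ℕ using (ℕ; zero; suc; ⌊_/2⌋)
  import Data.Nat.Properties as ℕ
  open import Data.Product using (_×_; _,_; proj₁; proj₂; ∃-syntax)
  open import Data.Rational
  open import Data.Rational.Properties
  open import Relation.Binary.PropositionalEquality
  open import Relation.Nullary.Decidable using (toWitness)
  open import Tactic.RingSolver using (solve-∀)

  cauchy-^ : ∀ {x X} k → 0ℚ ≤ X → Bounded 0ℚ X x → Cauchy x → Cauchy (x ^ⁿ k)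
  cauchy-^ zero    0≤X bd cx = cauchy-const 1ℚ
  cauchy-^ {x} {X} (suc k) 0≤X bd cx = cauchy-* 0≤X (^-nonNeg k 0≤X) bd
    (ev-map (λ (p , q) → ^-nonNeg k p , ^-mono k p q) bd) cx (cauchy-^ k 0≤X bd cx)

  -- 2 ≤ ℓ makes y = ℓ / 2 at least 1. So log n is eventually at least 1, and the iterated logarithm
  -- falls under `cauchy-log`.
  module _ (n ℓ : ℕ) (2≤ℓ : 2 ℕ.≤ ℓ) (2^ℓ≤n : 2 ℕ.^ ℓ ℕ.≤ n) where

    private
      x : RealSeq
      x = log (fromℕ n)

      y = ℕ→ℚ ℓ * ½

      1≤y : 1ℚ ≤ y
      1≤y = *-monoʳ (toWitness {a? = 0ℚ ≤? ½} _) (ν-mono 2≤ℓ)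

      0≤y : 0ℚ ≤ y
      0≤y = ≤-trans 0≤1 1≤y

      y≤x : Eventually λ m → y ≤ x m
      y≤x = logAt-≥ ℓ 2^ℓ≤n

      x-cauchy : Cauchy x
      x-cauchy = cauchy-log {X = ℕ→ℚ n}
        (always λ _ → 1≤ν n (ℕ.≤-trans (ℕ.m^n>0 2 ℓ) 2^ℓ≤n) , ≤-refl) (cauchy-const (ℕ→ℚ n))

      X = proj₁ (cauchy-bounded x-cauchy)

      x-bounded : Bounded 1ℚ X x
      x-bounded = ev-map (λ (p , q) → ≤-trans 1≤y p , q) (y≤x ⊗ proj₂ (cauchy-bounded x-cauchy))

      0≤X : 0ℚ ≤ X
      0≤X = let (N , b) = x-bounded ; (p , q) = b N ℕ.≤-refl in ≤-trans 0≤1 (≤-trans p q)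

      square : ℕ→ℚ (ℓ ℕ.* ℓ) ≡ (1ℚ + 1ℚ) * (1ℚ + 1ℚ) * (y * y)
      square = trans (ν-* ℓ ℓ) (trans (cong₂ _*_ (double (ℕ→ℚ ℓ)) (double (ℕ→ℚ ℓ))) (r y))
        where
        double : ∀ a → a ≡ (1ℚ + 1ℚ) * (a * ½)
        double a = sym (trans (g a ½) (halve a))
          where
          g : ∀ a h → (1ℚ + 1ℚ) * (a * h) ≡ (a + a) * h
          g = solve-∀ ℚ-ring
        r : ∀ y → (1ℚ + 1ℚ) * y * ((1ℚ + 1ℚ) * y) ≡ (1ℚ + 1ℚ) * (1ℚ + 1ℚ) * (y * y)
        r = solve-∀ ℚ-ring

      four≤24 : (1ℚ + 1ℚ) * (1ℚ + 1ℚ) ≤ ℕ→ℚ 24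
      four≤24 = toWitness {a? = (1ℚ + 1ℚ) * (1ℚ + 1ℚ) ≤? ℕ→ℚ 24} _

    -- From 1 ≤ y ≤ x follows ℓ² = 4 y² ≤ 4 x⁴; the larger constant 24 is chosen to agree with the
    -- case r ≥ 4.
    cubic : Cauchy (rcOrder 3 n) × Eventually λ m → ℕ→ℚ (ℓ ℕ.* ℓ) ≤ ℕ→ℚ 24 * rcOrder 3 n m
    cubic = cauchy-^ 4 0≤X (ev-map (λ (p , q) → ≤-trans 0≤1 p , q) x-bounded) x-cauchy ,
      ev-map (λ {m} p → begin
        ℕ→ℚ (ℓ ℕ.* ℓ)                        ≡⟨ square ⟩
        (1ℚ + 1ℚ) * (1ℚ + 1ℚ) * (y * y)
          ≤⟨ *-mono (toWitness {a? = 0ℚ ≤? (1ℚ + 1ℚ) * (1ℚ + 1ℚ)} _) four≤24 (*-nonNeg 0≤y 0≤y) (fourth p) ⟩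
        ℕ→ℚ 24 * (x ^ⁿ 4) m                  ∎) y≤x
      where
      open ≤-Reasoning
      fourth : ∀ {z} → y ≤ z → y * y ≤ z ^ 4
      fourth {z} y≤z = *-mono 0≤y y≤z 0≤y (subst (_≤ z ^ 3) (*-identityʳ y)
        (*-mono 0≤y y≤z 0≤1 (*-mono 0≤1 (≤-trans 1≤y y≤z) 0≤1 (*-mono 0≤1 (≤-trans 1≤y y≤z) 0≤1 ≤-refl))))

    module _ (s : ℕ) where

      private
        l₁ l₂ : RealSeq
        l₁ = log (fromℕ (3 ℕ.+ s))
        l₂ = log (fromℕ (2 ℕ.+ s))

        l-cauchy : ∀ k → Cauchy (log (fromℕ (suc k)))
        l-cauchy k = cauchy-log {X = ℕ→ℚ (suc k)}
          (always λ _ → 1≤ν (suc k) (ℕ.s≤s ℕ.z≤n) , ≤-refl) (cauchy-const (ℕ→ℚ (suc k)))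

        0<½ : 0ℚ < ½
        0<½ = toWitness {a? = 0ℚ <? ½} _

        -- As r - 2 ≥ 2, the divisor log (r - 2) of θ stays away from zero.
        ½≤l₂ : Eventually λ m → ½ ≤ l₂ m
        ½≤l₂ = logAt-≥ {2 ℕ.+ s} 1 (ℕ.s≤s (ℕ.s≤s ℕ.z≤n))

        l₂≤l₁ : ∀ m → l₂ m ≤ l₁ m
        l₂≤l₁ m = logAt-mono m (1≤ν (2 ℕ.+ s) (ℕ.s≤s ℕ.z≤n)) (ν-mono (ℕ.n≤1+n (2 ℕ.+ s)))

        Λ = proj₁ (cauchy-bounded (l-cauchy (2 ℕ.+ s)))

        l₁-bounded : Bounded 0ℚ Λ l₁
        l₁-bounded = always (λ m → logAt-nonNeg m (1≤ν (3 ℕ.+ s) (ℕ.s≤s ℕ.z≤n))) ⊗ proj₂ (cauchy-bounded (l-cauchy (2 ℕ.+ s)))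

        0≤Λ : 0ℚ ≤ Λ
        0≤Λ = let (N , b) = l₁-bounded ; (p , q) = b N ℕ.≤-refl in ≤-trans p q

        ϑ : RealSeq
        ϑ = θ (4 ℕ.+ s)

        ϑ≡ : Eventually λ m → l₁ m * inv (l₂ m) ≡ ϑ m
        ϑ≡ = ev-map (λ {m} p → sym (/₀≡*inv (l₁ m) (<-≤-trans 0<½ p))) ½≤l₂

        inv-bounded : Bounded 0ℚ (inv ½) (λ m → inv (l₂ m))
        inv-bounded = ev-map (λ p → 0≤inv (<-≤-trans 0<½ p) , inv-antimono 0<½ p) ½≤l₂

        ϑ-cauchy : Cauchy ϑ
        ϑ-cauchy = cauchy-ext ϑ≡ (cauchy-* 0≤Λ (0≤inv 0<½) l₁-bounded inv-bounded
          (l-cauchy (2 ℕ.+ s)) (cauchy-inv 0<½ ½≤l₂ (l-cauchy (1 ℕ.+ s))))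

        1≤ϑ : Eventually λ m → 1ℚ ≤ ϑ m
        1≤ϑ = ev-map (λ {m} p → ≤-/₀ (<-≤-trans 0<½ p)
          (subst (_≤ l₁ m) (sym (*-identityˡ (l₂ m))) (l₂≤l₁ m))) ½≤l₂

        exponent : RealSeq
        exponent = (fromℕ 2 *ʳ ϑ) *ʳ log x

        2ϑ-cauchy : Cauchy (fromℕ 2 *ʳ ϑ)
        2ϑ-cauchy = cauchy-scale (0≤ν 2) ϑ-cauchy

        z-cauchy : Cauchy (log x)
        z-cauchy = cauchy-log x-bounded x-cauchy

        0≤z : Eventually λ m → 0ℚ ≤ log x m
        0≤z = ev-map (λ {m} (p , _) → logAt-nonNeg m p) x-bounded

        0≤2ϑ : Eventually λ m → 0ℚ ≤ (fromℕ 2 *ʳ ϑ) m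
        0≤2ϑ = ev-map (λ p → *-nonNeg (0≤ν 2) (≤-trans 0≤1 p)) 1≤ϑ

        upper : ∀ {w} → Eventually (λ m → 0ℚ ≤ w m) → Cauchy w → ∃[ W ] (0ℚ ≤ W × Bounded 0ℚ W w)
        upper pos cw =
          let (W , b) = cauchy-bounded cw
              (N , both) = pos ⊗ b
              (p , q) = both N ℕ.≤-refl
          in W , ≤-trans p q , (N , both)

        0≤exponent : Eventually λ m → 0ℚ ≤ exponent m
        0≤exponent = ev-map (λ (p , q) → *-nonNeg p q) (0≤2ϑ ⊗ 0≤z)

        exponent-cauchy : Cauchy exponent
        exponent-cauchy =
          let (_ , 0≤A , bA) = upper 0≤2ϑ 2ϑ-cauchy
              (_ , 0≤B , bB) = upper 0≤z z-cauchy
          in cauchy-* 0≤A 0≤B bA bB 2ϑ-cauchy z-cauchy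

        -- `exp-2log` speaks of integers, so log n is replaced by h = ⌊ℓ/2⌋ = j + 1 from below. Then
        -- exp (2 θ log log n) ≥ exp (2 log h) ≥ (h + 1)² / 6, and ℓ ≤ 2 (h + 1) yields the constant
        -- 24 = 4 * 6.
        lower : ∀ j → suc j ℕ.+ suc j ℕ.≤ ℓ → ℓ ℕ.≤ suc (suc j ℕ.+ suc j) →
                Eventually λ m → ℕ→ℚ (ℓ ℕ.* ℓ) ≤ ℕ→ℚ 24 * exp exponent m
        lower j 2j≤ℓ ℓ≤2j+1 = ev-map (λ {m} → main {m}) (exp-2log j ⊗ y≤x ⊗ 1≤ϑ ⊗ (suc j , λ m le → le))
          where
          open ≤-Reasoning
          h = ℕ→ℚ (suc j)
          1≤h : 1ℚ ≤ h
          1≤h = 1≤ν (suc j) (ℕ.s≤s ℕ.z≤n)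
          h≤y : h ≤ y
          h≤y = subst (_≤ y) (trans (cong (_* ½) (ν-+ (suc j) (suc j))) (halve h))
            (*-monoʳ (<⇒≤ 0<½) (ν-mono 2j≤ℓ))
          4* = (1ℚ + 1ℚ) * (1ℚ + 1ℚ)
          ℓ≤ : ℕ→ℚ ℓ ≤ (1ℚ + 1ℚ) * (h + 1ℚ)
          ℓ≤ = begin
            ℕ→ℚ ℓ                             ≤⟨ ν-mono ℓ≤2j+1 ⟩
            ℕ→ℚ (suc (suc j ℕ.+ suc j))       ≡⟨ ν-suc (suc j ℕ.+ suc j) ⟩
            1ℚ + ℕ→ℚ (suc j ℕ.+ suc j)        ≡⟨ cong (1ℚ +_) (ν-+ (suc j) (suc j)) ⟩
            1ℚ + (h + h)                      ≤⟨ ≤-by 1ℚ 0≤1 (r h) ⟩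
            (1ℚ + 1ℚ) * (h + 1ℚ)              ∎
            where
            r : ∀ h → 1ℚ + (h + h) + 1ℚ ≡ (1ℚ + 1ℚ) * (h + 1ℚ)
            r = solve-∀ ℚ-ring
          r₁ : ∀ h → (1ℚ + 1ℚ) * (h + 1ℚ) * ((1ℚ + 1ℚ) * (h + 1ℚ)) ≡ (1ℚ + 1ℚ) * (1ℚ + 1ℚ) * ((h + 1ℚ) * (h + 1ℚ))
          r₁ = solve-∀ ℚ-ring
          0≤h+1 : 0ℚ ≤ h + 1ℚ
          0≤h+1 = <⇒≤ (0<x+1 1≤h)
          main : ∀ {m} → _ × _ × _ × _ → ℕ→ℚ (ℓ ℕ.* ℓ) ≤ ℕ→ℚ 24 * exp exponent m
          main {m} (p , y≤xm , 1≤ϑm , le) = begin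
            ℕ→ℚ (ℓ ℕ.* ℓ)                                  ≡⟨ ν-* ℓ ℓ ⟩
            ℕ→ℚ ℓ * ℕ→ℚ ℓ                                  ≤⟨ *-mono (0≤ν ℓ) ℓ≤ (0≤ν ℓ) ℓ≤ ⟩
            (1ℚ + 1ℚ) * (h + 1ℚ) * ((1ℚ + 1ℚ) * (h + 1ℚ))  ≡⟨ r₁ h ⟩
            4* * ((h + 1ℚ) * (h + 1ℚ))
              ≤⟨ *-monoˡ 0≤4 (*-monoˡ 0≤h+1 (≤-+ 0≤1)) ⟩
            4* * ((h + 1ℚ) * (h + 1ℚ + 1ℚ))                ≤⟨ *-monoˡ 0≤4 p ⟩
            4* * (ℕ→ℚ 6 * expSum (suc j) (ℕ→ℚ 2 * logAt m h)) ≡⟨ *-assoc 4* (ℕ→ℚ 6) (expSum (suc j) (ℕ→ℚ 2 * logAt m h)) ⟨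
            4* * ℕ→ℚ 6 * expSum (suc j) (ℕ→ℚ 2 * logAt m h)
              ≤⟨ *-monoˡ (0≤ν 24) (expSum-mono le (*-nonNeg (0≤ν 2) (logAt-nonNeg m 1≤h)) arg) ⟩
            ℕ→ℚ 24 * exp exponent m                        ∎
            where
            0≤4 : 0ℚ ≤ 4*
            0≤4 = toWitness {a? = 0ℚ ≤? 4*} _
            arg : ℕ→ℚ 2 * logAt m h ≤ ℕ→ℚ 2 * ϑ m * log x m
            arg = *-mono (0≤ν 2) (subst (_≤ ℕ→ℚ 2 * ϑ m) (*-identityʳ (ℕ→ℚ 2)) (*-monoˡ (0≤ν 2) 1≤ϑm))
              (logAt-nonNeg m 1≤h) (logAt-mono m 1≤h (≤-trans h≤y y≤xm))

        half-bounds : ∀ ℓ → ⌊ ℓ /2⌋ ℕ.+ ⌊ ℓ /2⌋ ℕ.≤ ℓ × ℓ ℕ.≤ suc (⌊ ℓ /2⌋ ℕ.+ ⌊ ℓ /2⌋)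
        half-bounds zero          = ℕ.z≤n , ℕ.z≤n
        half-bounds (suc zero)    = ℕ.z≤n , ℕ.≤-refl
        half-bounds (suc (suc ℓ)) = let (p , q) = half-bounds ℓ in
          ℕ.s≤s (subst (ℕ._≤ suc ℓ) (sym (ℕ.+-suc ⌊ ℓ /2⌋ ⌊ ℓ /2⌋)) (ℕ.s≤s p)) ,
          ℕ.s≤s (ℕ.s≤s (subst (ℓ ℕ.≤_) (sym (ℕ.+-suc ⌊ ℓ /2⌋ ⌊ ℓ /2⌋)) q))

        half-of : ∃[ j ] ⌊ ℓ /2⌋ ≡ suc j
        half-of with ⌊ ℓ /2⌋ | ℕ.⌊n/2⌋-mono 2≤ℓ
        ... | suc j | _ = j , refl

      quartic : Cauchy (rcOrder (4 ℕ.+ s) n) ×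
                Eventually λ m → ℕ→ℚ (ℓ ℕ.* ℓ) ≤ ℕ→ℚ 24 * rcOrder (4 ℕ.+ s) n m
      quartic = cauchy-exp (proj₂ (proj₂ (upper 0≤exponent exponent-cauchy))) exponent-cauchy ,
        lower (proj₁ half-of)
          (subst (λ h → h ℕ.+ h ℕ.≤ ℓ) (proj₂ half-of) (proj₁ (half-bounds ℓ)))
          (subst (λ h → ℓ ℕ.≤ suc (h ℕ.+ h)) (proj₂ half-of) (proj₂ (half-bounds ℓ)))

  order-bound : ∀ {r n ℓ} → 3 ℕ.≤ r → 2 ℕ.≤ ℓ → 2 ℕ.^ ℓ ℕ.≤ n →
    Cauchy (rcOrder r n) × Eventually λ m → ℕ→ℚ (ℓ ℕ.* ℓ) ≤ ℕ→ℚ 24 * rcOrder r n m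
  order-bound {suc (suc (suc zero))}    {n} {ℓ} _ = cubic n ℓ
  order-bound {suc (suc (suc (suc s)))} {n} {ℓ} _ p q = quartic n ℓ p q s
  order-bound {suc zero} (ℕ.s≤s ())
  order-bound {suc (suc zero)} (ℕ.s≤s (ℕ.s≤s ()))

  ≤ʳ-from-bound : ∀ {r n ℓ c k} → 3 ℕ.≤ r → 2 ℕ.≤ ℓ → 2 ℕ.^ ℓ ℕ.≤ n → k ℕ.≤ c ℕ.* (ℓ ℕ.* ℓ) →
    fromℕ k ≤ʳ fromℚ (ℕ→ℚ c * ℕ→ℚ 24) *ʳ rcOrder r n
  ≤ʳ-from-bound {r} {n} {ℓ} {c} {k} 3≤r 2≤ℓ 2^ℓ≤n k≤ =
    cauchy⇒convergent (cauchy-const (ℕ→ℚ k)) ,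
    cauchy⇒convergent (cauchy-scale (*-nonNeg (0≤ν c) (0≤ν 24)) (proj₁ bounds)) ,
    λ δ 0<δ → ev-map (λ {m} p → ≤-trans (main m p) (≤-+ (<⇒≤ 0<δ))) (proj₂ bounds)
    where
    open ≤-Reasoning
    bounds = order-bound {r} {n} {ℓ} 3≤r 2≤ℓ 2^ℓ≤n
    main : ∀ m → ℕ→ℚ (ℓ ℕ.* ℓ) ≤ ℕ→ℚ 24 * rcOrder r n m → ℕ→ℚ k ≤ ℕ→ℚ c * ℕ→ℚ 24 * rcOrder r n m
    main m p = begin
      ℕ→ℚ k                               ≤⟨ ν-mono k≤ ⟩
      ℕ→ℚ (c ℕ.* (ℓ ℕ.* ℓ))               ≡⟨ ν-* c (ℓ ℕ.* ℓ) ⟩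
      ℕ→ℚ c * ℕ→ℚ (ℓ ℕ.* ℓ)               ≤⟨ *-monoˡ (0≤ν c) p ⟩
      ℕ→ℚ c * (ℕ→ℚ 24 * rcOrder r n m)    ≡⟨ *-assoc (ℕ→ℚ c) (ℕ→ℚ 24) _ ⟨
      ℕ→ℚ c * ℕ→ℚ 24 * rcOrder r n m      ∎

-- Assembly: constants and the probability of failure.

open Counting
open Switching
open FirstMoment
open Density
open Growth
open Components
open Structure
open RationalOrder hiding (_^_; ^-*)
open Order
open import Data.Fin using (Fin; fromℕ<)
open import Data.Fin.Properties using (nonZeroIndex)
open import Data.List using (List; length; filter; _++_)
open import Data.List.Properties using (length-++)
open import Data.List.Membership.Propositional using (_∈_)
open import Data.List.Membership.Propositional.Properties using (∈-filter⁺; ∈-filter⁻; ∈-++⁺ˡ; ∈-++⁺ʳ)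
import Data.List.Relation.Binary.Sublist.Propositional.Properties as Sub
import Data.List.Relation.Unary.All as All
import Data.List.Relation.Unary.All.Properties as All
import Data.List.Relation.Unary.Unique.Propositional.Properties as Unique
open import Data.Nat
open import Data.Nat.Properties
open import Data.Nat.Tactic.RingSolver using (solve-∀)
open import Data.Product using (_×_; _,_; proj₁; proj₂; ∃-syntax; Σ-syntax)
open import Data.Rational as ℚ using (ℚ; 0ℚ; 1ℚ)
import Data.Rational.Properties as ℚ
open import Data.Sum using (_⊎_; inj₁; inj₂)
import Tactic.RingSolver as Solver
open import Function using (_∘_)
open import Relation.Binary.PropositionalEquality
open import Relation.Nullary using (¬_; yes; no; contradiction)
open import Relation.Nullary.Decidable using (¬?; _⊎-dec_; decidable-stable)
open import Relation.Unary using (Decidable)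

power-bracket : ∀ n → 1 ≤ n → ∃[ ℓ ] (2 ^ ℓ ≤ n × n < 2 ^ suc ℓ)
power-bracket (suc zero)    _ = 0 , ≤-refl , ≤-refl
power-bracket (suc (suc n)) _ with power-bracket (suc n) (s≤s z≤n)
... | ℓ , lo , hi with suc (suc n) <? 2 ^ suc ℓ
...   | yes lt = ℓ , m≤n⇒m≤1+n lo , lt
...   | no ¬lt = suc ℓ , ≮⇒≥ ¬lt , (begin-strict
  suc (suc n)      ≤⟨ hi ⟩
  2 ^ suc ℓ        <⟨ ^-monoʳ-< 2 ≤-refl {suc ℓ} {suc (suc ℓ)} ≤-refl ⟩
  2 ^ suc (suc ℓ)  ∎)
  where open ≤-Reasoning

square≤2^ : ∀ j → (4 + j) * (4 + j) ≤ 2 ^ (4 + j)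
square≤2^ zero    = ≤-refl
square≤2^ (suc j) = begin
  (5 + j) * (5 + j)                              ≤⟨ m≤m+n _ ((2 + j) * (2 + j) + (2 * j + 3)) ⟩
  (5 + j) * (5 + j) + ((2 + j) * (2 + j) + (2 * j + 3)) ≡⟨ h j ⟩
  2 * ((4 + j) * (4 + j))                        ≤⟨ *-monoʳ-≤ 2 (square≤2^ j) ⟩
  2 ^ (5 + j)                                    ∎
  where
  open ≤-Reasoning
  h : ∀ j → (5 + j) * (5 + j) + ((2 + j) * (2 + j) + (2 * j + 3)) ≡ 2 * ((4 + j) * (4 + j))
  h = solve-∀

-- Turns a failure probability of order ℓ / n into one below any given δ, as 2^ℓ ≤ n.
linear≤2^ : ∀ q ℓ → 4 + q ≤ ℓ → q * ℓ ≤ 2 ^ ℓ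
linear≤2^ q ℓ le = begin
  q * ℓ        ≤⟨ *-monoˡ-≤ ℓ (≤-trans (m≤n+m q 4) le) ⟩
  ℓ * ℓ        ≡⟨ cong₂ _*_ eq eq ⟨
  (4 + (ℓ ∸ 4)) * (4 + (ℓ ∸ 4)) ≤⟨ square≤2^ (ℓ ∸ 4) ⟩
  2 ^ (4 + (ℓ ∸ 4)) ≡⟨ cong (2 ^_) eq ⟩
  2 ^ ℓ        ∎
  where
  open ≤-Reasoning
  eq : 4 + (ℓ ∸ 4) ≡ ℓ
  eq = m+[n∸m]≡n (≤-trans (m≤m+n 4 q) le)

-- The structural results are applied with ℓ + 1, because they ask for n < 2^(ℓ+1); the constant 17
-- = 8 + 9 absorbs this shift.
radius-≤ : ∀ M ℓ → 1 ≤ ℓ → radius-of M (suc ℓ) ≤ 17 * M * ℓ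
radius-≤ M ℓ 1≤ℓ = begin
  M * suc (4 * suc ℓ + 4 * suc ℓ)   ≡⟨ cong (M *_) (h ℓ) ⟩
  M * (8 * ℓ + 9)                   ≤⟨ *-monoʳ-≤ M (+-monoʳ-≤ (8 * ℓ) (*-monoʳ-≤ 9 1≤ℓ)) ⟩
  M * (8 * ℓ + 9 * ℓ)               ≡⟨ h′ M ℓ ⟩
  17 * M * ℓ                        ∎
  where
  open ≤-Reasoning
  h : ∀ ℓ → suc (4 * suc ℓ + 4 * suc ℓ) ≡ 8 * ℓ + 9
  h = solve-∀
  h′ : ∀ M ℓ → M * (8 * ℓ + 9 * ℓ) ≡ 17 * M * ℓ
  h′ = solve-∀

-- The value of `colours L M` at L = 17 M ℓ, with all lower powers of ℓ raised to ℓ².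
coefficient : ℕ → ℕ
coefficient M = 1 + 17 * M * (2 * (17 * M) + (4 + M))

colours-≤ : ∀ M ℓ → 1 ≤ ℓ → colours (radius-of M (suc ℓ)) M ≤ coefficient M * (ℓ * ℓ)
colours-≤ M ℓ 1≤ℓ = bound (radius-of M (suc ℓ)) (17 * M) (radius-≤ M ℓ 1≤ℓ)
  where
  open ≤-Reasoning
  h : ∀ L M → 1 + L * ((suc L + suc L) + (1 + suc M)) ≡ 1 + L * (2 * L + (4 + M))
  h = solve-∀
  h′ : ∀ A M ℓ → 1 * (ℓ * ℓ) + A * ℓ * (2 * (A * ℓ) + (4 + M) * ℓ) ≡ (1 + A * (2 * A + (4 + M))) * (ℓ * ℓ)
  h′ = solve-∀
  bound : ∀ L A → L ≤ A * ℓ → colours L M ≤ (1 + A * (2 * A + (4 + M))) * (ℓ * ℓ)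
  bound L A L≤ = begin
    1 + L * ((suc L + suc L) + (1 + suc M))   ≡⟨ h L M ⟩
    1 + L * (2 * L + (4 + M))
      ≤⟨ +-mono-≤ (≤-trans (*-mono-≤ 1≤ℓ 1≤ℓ) (≤-reflexive (sym (*-identityˡ (ℓ * ℓ)))))
           (*-mono-≤ L≤ (+-mono-≤ (*-monoʳ-≤ 2 L≤) (m≤m*n (4 + M) ℓ {{>-nonZero 1≤ℓ}}))) ⟩
    1 * (ℓ * ℓ) + A * ℓ * (2 * (A * ℓ) + (4 + M) * ℓ)   ≡⟨ h′ A M ℓ ⟩
    (1 + A * (2 * A + (4 + M))) * (ℓ * ℓ)     ∎

-- `rarity r M` * ℓ / n bounds the probability of failure: M comes from dense graphs, and M² r (4 L
-- + 1) with L = 17 M ℓ from disconnected ones.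
rarity : ℕ → ℕ → ℕ
rarity r M = M + M * M * (r * (4 * (17 * M) + 1))

rarity-≥ : ∀ r M N ℓ → 1 ≤ ℓ →
  M * N + M * M * (N * (r * detour (radius-of M (suc ℓ)))) ≤ rarity r M * ℓ * N
rarity-≥ r M N ℓ 1≤ℓ = bound (radius-of M (suc ℓ)) (17 * M) (radius-≤ M ℓ 1≤ℓ)
  where
  open ≤-Reasoning
  h : ∀ L → L + (L + suc (L + L)) ≡ 4 * L + 1
  h = solve-∀
  h′ : ∀ M N r A ℓ → M * N * ℓ + M * M * (N * (r * (4 * (A * ℓ) + 1 * ℓ))) ≡
                     (M + M * M * (r * (4 * A + 1))) * ℓ * N
  h′ = solve-∀
  bound : ∀ L A → L ≤ A * ℓ →
    M * N + M * M * (N * (r * detour L)) ≤ (M + M * M * (r * (4 * A + 1))) * ℓ * N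
  bound L A L≤ = begin
    M * N + M * M * (N * (r * detour L))
      ≤⟨ +-mono-≤ (m≤m*n (M * N) ℓ {{>-nonZero 1≤ℓ}})
           (*-monoʳ-≤ (M * M) (*-monoʳ-≤ N (*-monoʳ-≤ r (begin
             detour L             ≡⟨ h L ⟩
             4 * L + 1            ≤⟨ +-mono-≤ (*-monoʳ-≤ 4 L≤) (*-monoʳ-≤ 1 1≤ℓ) ⟩
             4 * (A * ℓ) + 1 * ℓ  ∎)))) ⟩
    M * N * ℓ + M * M * (N * (r * (4 * (A * ℓ) + 1 * ℓ)))   ≡⟨ h′ M N r A ℓ ⟩
    (M + M * M * (r * (4 * A + 1))) * ℓ * N   ∎

module _ {r : ℕ} (3≤r : 3 ≤ r) where

  private
    instance
      r≢0 : NonZero r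
      r≢0 = >-nonZero (≤-trans (s≤s z≤n) 3≤r)
    M = threshold r
    instance threshold-nonZero = threshold≢0 r

  module _ {n} (ℓ : ℕ) (n<2^ℓ : n < 2 ^ suc ℓ) (ρ : Fin n) where

    private
      N = length (regularGraphs r n)
      instance
        n≢0 : NonZero n
        n≢0 = nonZeroIndex ρ

    Bad : Graph n → Set
    Bad G = Dense r G ⊎ Unreached {r} {n} 3≤r (suc ℓ) n<2^ℓ ρ G

    bad? : Decidable Bad
    bad? G = dense? r G ⊎-dec unreached? {r} {n} 3≤r (suc ℓ) n<2^ℓ ρ G

    bad-rare : 1 ≤ ℓ → length (filter bad? (regularGraphs r n)) * n ≤ rarity r M * ℓ * N
    bad-rare 1≤ℓ = begin
      length (filter bad? Gs) * n
        ≤⟨ *-monoˡ-≤ n (unique-length-≤ (Unique.filter⁺ bad? (regularGraphs-unique r n)) cover) ⟩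
      length (dense ++ split) * n           ≡⟨ cong (_* n) (length-++ dense) ⟩
      (length dense + length split) * n     ≡⟨ *-distribʳ-+ n (length dense) (length split) ⟩
      length dense * n + length split * n
        ≤⟨ +-mono-≤ (dense-rare {r} {n} 3≤r) (split-rare {r} {n} 3≤r (suc ℓ) n<2^ℓ ρ) ⟩
      M * N + M * M * (N * (r * detour (radius-of M (suc ℓ))))
        ≤⟨ rarity-≥ r M N ℓ 1≤ℓ ⟩
      rarity r M * ℓ * N                    ∎
      where
      open ≤-Reasoning
      Gs = regularGraphs r n
      isSplit? = split? {r} {n} 3≤r (suc ℓ) n<2^ℓ ρ
      dense = filter (dense? r) Gs
      split = filter isSplit? Gs
      cover : ∀ {G} → G ∈ filter bad? Gs → G ∈ dense ++ split
      cover {G} G∈ with ∈-filter⁻ bad? {xs = Gs} G∈ | dense? r G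
      ... | G∈r , _      | yes d = ∈-++⁺ˡ (∈-filter⁺ (dense? r) G∈r d)
      ... | G∈r , inj₁ d | no ¬d = contradiction d ¬d
      ... | G∈r , inj₂ u | no ¬d = ∈-++⁺ʳ dense (∈-filter⁺ isSplit? G∈r (¬d , u))

    good-structure : ∀ {G} → G ∈ regularGraphs r n → ¬ Bad G →
      Connected G × ∃[ k ] (RainbowConnectivity G k × k ≤ colours (radius-of M (suc ℓ)) M)
    good-structure {G} G∈ good =
      connected {r} {n} {M} 3≤r G simple regular sparse ρ L reached ,
      few-colours {r} {n} {M} 3≤r G simple regular sparse ρ L reached
      where
      simple = proj₁ (∈-regular⁻ G∈)
      regular = proj₂ (∈-regular⁻ G∈)
      sparse = ¬dense r {n} {G} (good ∘ inj₁)
      L = radius-of M (suc ℓ)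
      reached : ∀ v → Within G ρ L v
      reached v = decidable-stable (within? G ρ L v) λ ¬p → good (inj₂ (v , ¬p))

-- The integer d with 1 ≤ d δ allows the rarity of failures to be stated in natural numbers.
rare⇒likely : {A : Set} {E B : A → Set} (B? : Decidable B) (xs : List A) {δ : ℚ} (d : ℕ) → 0ℚ ℚ.< δ →
  1ℚ ℚ.≤ ℕ→ℚ d ℚ.* δ → d * length (filter B? xs) ≤ length xs →
  (∀ {x} → x ∈ xs → ¬ B x → E x) → ProbabilityAtLeast (1ℚ ℚ.- δ) xs E
rare⇒likely B? xs {δ} d 0<δ 1≤dδ rare good = filter (¬? ∘ B?) xs , Sub.filter-⊆ (¬? ∘ B?) xs ,
  All.tabulate (λ x∈ → let (x∈xs , ¬b) = ∈-filter⁻ (¬? ∘ B?) {xs = xs} x∈ in good x∈xs ¬b) ,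
  (begin
    (1ℚ ℚ.- δ) ℚ.* ν N                       ≡⟨ r₁ δ (ν N) ⟩
    ν N ℚ.- δ ℚ.* ν N                        ≤⟨ ℚ.+-monoʳ-≤ (ν N) (ℚ.neg-antimono-≤ bad≤) ⟩
    ν N ℚ.- ν b                              ≡⟨ cong (λ k → ν k ℚ.- ν b) (length-filter-¬ B? xs) ⟨
    ν (b + g) ℚ.- ν b                        ≡⟨ cong (ℚ._- ν b) (ν-+ b g) ⟩
    ν b ℚ.+ ν g ℚ.- ν b                      ≡⟨ r₂ (ν b) (ν g) ⟩
    ν g                                      ∎)
  where
  open ℚ.≤-Reasoning
  ν = ℕ→ℚ
  N = length xs
  b = length (filter B? xs)
  g = length (filter (¬? ∘ B?) xs)
  r₁ : ∀ δ x → (1ℚ ℚ.- δ) ℚ.* x ≡ x ℚ.- δ ℚ.* x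
  r₁ = Solver.solve-∀ ℚ-ring
  r₂ : ∀ b g → b ℚ.+ g ℚ.- b ≡ g
  r₂ = Solver.solve-∀ ℚ-ring
  r₃ : ∀ d δ b → d ℚ.* δ ℚ.* b ≡ δ ℚ.* (d ℚ.* b)
  r₃ = Solver.solve-∀ ℚ-ring
  bad≤ : ν b ℚ.≤ δ ℚ.* ν N
  bad≤ = begin
    ν b                      ≡⟨ ℚ.*-identityˡ (ν b) ⟨
    1ℚ ℚ.* ν b               ≤⟨ *-monoʳ (0≤ν b) 1≤dδ ⟩
    ν d ℚ.* δ ℚ.* ν b        ≡⟨ r₃ (ν d) δ (ν b) ⟩
    δ ℚ.* (ν d ℚ.* ν b)      ≡⟨ cong (δ ℚ.*_) (ν-* d b) ⟨
    δ ℚ.* ν (d * b)          ≤⟨ *-monoˡ (ℚ.<⇒≤ 0<δ) (ν-mono rare) ⟩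
    δ ℚ.* ν N                ∎

theorem2 : ∀ (r : ℕ) → 3 ≤ r →
    Σ[ C ∈ ℚ ] WithHighProbability r (λ n G →
    Connected G ×
    (∃[ k ] (RainbowConnectivity G k × fromℕ k ≤ʳ fromℚ C *ʳ rcOrder r n)))
theorem2 r 3≤r = ℕ→ℚ c ℚ.* ℕ→ℚ 24 , λ δ 0<δ →
  let (d , 1≤dδ) = archimedes 0<δ
      q = d * rarity r M
  -- For n ≥ 2^(4 + q) the exponent is at least 4 + q, hence q ℓ ≤ 2^ℓ ≤ n, and failures make up at
  -- most a fraction 1 / d ≤ δ.
  in 2 ^ (4 + q) , λ n large _ →
    let 1≤n = ≤-trans (m^n>0 2 (4 + q)) large
        (ℓ , 2^ℓ≤n , n<) = power-bracket n 1≤n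
        4+q≤ℓ = ≤-pred (2^-cancel-< (≤-<-trans large n<))
        2≤ℓ = ≤-trans (m≤m+n 2 (2 + q)) 4+q≤ℓ
    in rare⇒likely (bad? 3≤r ℓ n< (fromℕ< 1≤n)) (regularGraphs r n) d 0<δ 1≤dδ
         (few-bad n d ℓ 1≤n (≤-trans (n≤1+n 1) 2≤ℓ)
           (≤-trans (linear≤2^ q ℓ 4+q≤ℓ) 2^ℓ≤n) (bad-rare 3≤r ℓ n< (fromℕ< 1≤n)))
         (conclude n ℓ n< (fromℕ< 1≤n) 2≤ℓ 2^ℓ≤n)
  where
  M = threshold r
  c = coefficient M
  2^-cancel-< : ∀ {i j} → 2 ^ i < 2 ^ j → i < j
  2^-cancel-< lt = ≰⇒> λ j≤i → <⇒≱ lt (^-monoʳ-≤ 2 j≤i)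
  few-bad : ∀ n d ℓ {b N} → 1 ≤ n → 1 ≤ ℓ → d * rarity r M * ℓ ≤ n →
            (1 ≤ ℓ → b * n ≤ rarity r M * ℓ * N) → d * b ≤ N
  few-bad n d ℓ {b} {N} 1≤n 1≤ℓ small rare = *-cancelʳ-≤ (d * b) N n {{>-nonZero 1≤n}} (begin
    d * b * n                      ≡⟨ *-assoc d b n ⟩
    d * (b * n)                    ≤⟨ *-monoʳ-≤ d (rare 1≤ℓ) ⟩
    d * (rarity r M * ℓ * N)       ≡⟨ h d (rarity r M) ℓ N ⟩
    N * (d * rarity r M * ℓ)       ≤⟨ *-monoʳ-≤ N small ⟩
    N * n                          ∎)
    where
    open ≤-Reasoning
    h : ∀ d e ℓ N → d * (e * ℓ * N) ≡ N * (d * e * ℓ)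
    h = solve-∀
  conclude : ∀ n ℓ (n< : n < 2 ^ suc ℓ) (ρ : Fin n) → 2 ≤ ℓ → 2 ^ ℓ ≤ n →
    ∀ {G : Graph n} → G ∈ regularGraphs r n → ¬ Bad 3≤r ℓ n< ρ G →
    Connected G × ∃[ k ] (RainbowConnectivity G k ×
      fromℕ k ≤ʳ fromℚ (ℕ→ℚ c ℚ.* ℕ→ℚ 24) *ʳ rcOrder r n)
  conclude n ℓ n< ρ 2≤ℓ 2^ℓ≤n G∈ good =
    let (conn , k , rc , k≤) = good-structure 3≤r ℓ n< ρ G∈ good
    in conn , k , rc , ≤ʳ-from-bound {r} {n} {ℓ} {c} 3≤r 2≤ℓ 2^ℓ≤n
         (≤-trans k≤ (colours-≤ M ℓ (≤-trans (n≤1+n 1) 2≤ℓ)))
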